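{- Let $n\ge 1$ be an integer, let $[\beta(i,j)]$ be the $n\times n$ matrix with $(i,j)$th entry $\beta(i,j)$, $1\le i,j\le n$, where $\beta$ is the beta function, and let $I$ be the $n\times n$ identity matrix. Then $[\beta(i,j)]$ is Birkhoff-James orthogonal to $I$ in the trace norm if and only if $n$ is even.
   Context: For $x,y>0$, $\beta(x,y)=\frac{\Gamma(x)\Gamma(y)}{\Gamma(x+y)}$; for positive integers $i,j$, $\beta(i,j)=\frac{(i-1)!(j-1)!}{(i+j-1)!}$. Let $\|\cdot\|_1$ denote the trace norm (sum of singular values) on the space of $n\times n$ real matrices. For $n\times n$ real matrices $X,Y$, $X$ is said to be Birkhoff-James orthogonal to $Y$ in the trace norm if $\|X+tY\|_1\ge \|X\|_1$ for all $t\in\mathbb{R}$. -}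

module Defs where

open import Data.Bool.Base using (if_then_else_)
open import Data.Fin.Base using (Fin; toℕ)
open import Data.Fin.Properties using () renaming (_≟_ to _≟ᶠ_)
open import Data.Integer.Base using (+_)
open import Data.Nat.Base as ℕ using (ℕ; suc; _!)
import Data.Nat.Properties as ℕₚ
open import Data.Product.Base using (∃-syntax; _×_; _,_)
open import Data.Rational.Base as ℚ using (ℚ; 0ℚ; 1ℚ; ½; ∣_∣; Positive)
import Data.Rational.Properties as ℚₚ
open import Data.Vec.Functional using (foldr)
open import Level using (0ℓ)
open import Relation.Binary.PropositionalEquality
  using (_≡_; sym; trans; cong; subst; subst₂)
open import Relation.Nullary.Decidable using (does; dec⇒maybe)
open import Tactic.RingSolver using (solve-∀)
open import Tactic.RingSolver.Core.AlmostCommutativeRing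
  using (AlmostCommutativeRing; fromCommutativeRing)

-- Cauchy sequences of rationals.  Real equality is _≈_ (difference
-- tends to 0), not _≡_.

IsCauchy : (ℕ → ℚ) → Set
IsCauchy x = ∀ ε → 0ℚ ℚ.< ε →
  ∃[ N ] (∀ m n → N ℕ.≤ m → N ℕ.≤ n → ∣ x m ℚ.- x n ∣ ℚ.< ε)

record ℝ : Set where
  constructor mkℝ
  field
    seq    : ℕ → ℚ
    cauchy : IsCauchy seq

open ℝ public

infix 4 _≈_ _≤_

_≈_ : ℝ → ℝ → Set
x ≈ y = ∀ ε → 0ℚ ℚ.< ε →
  ∃[ N ] (∀ n → N ℕ.≤ n → ∣ seq x n ℚ.- seq y n ∣ ℚ.< ε)

-- The slack ε is needed: pointwise comparison of representatives would
-- not respect _≈_.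
_≤_ : ℝ → ℝ → Set
x ≤ y = ∀ ε → 0ℚ ℚ.< ε →
  ∃[ N ] (∀ n → N ℕ.≤ n → seq x n ℚ.< seq y n ℚ.+ ε)

private
  ℚ-ring : AlmostCommutativeRing 0ℓ 0ℓ
  ℚ-ring = fromCommutativeRing ℚₚ.+-*-commutativeRing λ q → dec⇒maybe (0ℚ ℚₚ.≟ q)

  ½*-pos : ∀ {ε} → 0ℚ ℚ.< ε → 0ℚ ℚ.< ½ ℚ.* ε
  ½*-pos {ε} ε>0 =
    subst (ℚ._< ½ ℚ.* ε) (ℚₚ.*-zeroʳ ½) (ℚₚ.*-monoʳ-<-pos ½ ε>0)

  halves : ∀ ε → ½ ℚ.* ε ℚ.+ ½ ℚ.* ε ≡ ε
  halves ε = trans (sym (ℚₚ.*-distribʳ-+ ε ½ ½)) (ℚₚ.*-identityˡ ε)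

  const-cauchy : ∀ q → IsCauchy (λ _ → q)
  const-cauchy q ε ε>0 =
    0 , λ _ _ _ _ → subst (λ z → ∣ z ∣ ℚ.< ε) (sym (ℚₚ.+-inverseʳ q)) ε>0

  +-cauchy : ∀ {x y} → IsCauchy x → IsCauchy y → IsCauchy (λ n → x n ℚ.+ y n)
  +-cauchy {x} {y} cx cy ε ε>0 with cx (½ ℚ.* ε) (½*-pos ε>0) | cy (½ ℚ.* ε) (½*-pos ε>0)
  ... | M , p | N , q = M ℕ.⊔ N , λ m n m≥ n≥ → begin-strict
      ∣ (x m ℚ.+ y m) ℚ.- (x n ℚ.+ y n) ∣
        ≡⟨ cong ∣_∣ (rearrange (x m) (y m) (x n) (y n)) ⟩
      ∣ (x m ℚ.- x n) ℚ.+ (y m ℚ.- y n) ∣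
        ≤⟨ ℚₚ.∣p+q∣≤∣p∣+∣q∣ (x m ℚ.- x n) (y m ℚ.- y n) ⟩
      ∣ x m ℚ.- x n ∣ ℚ.+ ∣ y m ℚ.- y n ∣
        <⟨ ℚₚ.+-mono-<
             (p m n (ℕₚ.m⊔n≤o⇒m≤o M N m≥) (ℕₚ.m⊔n≤o⇒m≤o M N n≥))
             (q m n (ℕₚ.m⊔n≤o⇒n≤o M N m≥) (ℕₚ.m⊔n≤o⇒n≤o M N n≥)) ⟩
      ½ ℚ.* ε ℚ.+ ½ ℚ.* ε
        ≡⟨ halves ε ⟩
      ε ∎
    where
    open ℚₚ.≤-Reasoning
    rearrange : ∀ a b c d →
      (a ℚ.+ b) ℚ.- (c ℚ.+ d) ≡ (a ℚ.- c) ℚ.+ (b ℚ.- d)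
    rearrange = solve-∀ ℚ-ring

  eventually-bounded : ∀ {x} → IsCauchy x →
    ∃[ B ] ∃[ N ] (0ℚ ℚ.< B × (∀ n → N ℕ.≤ n → ∣ x n ∣ ℚ.≤ B))
  eventually-bounded {x} cx with cx 1ℚ (ℚₚ.positive⁻¹ 1ℚ)
  ... | N , p = 1ℚ ℚ.+ ∣ x N ∣ , N
      , ℚₚ.+-mono-<-≤ {0ℚ} {1ℚ} {0ℚ} (ℚₚ.positive⁻¹ 1ℚ) (ℚₚ.0≤∣p∣ (x N))
      , λ n n≥ → begin
      ∣ x n ∣
        ≡⟨ cong ∣_∣ (split (x n) (x N)) ⟩
      ∣ (x n ℚ.- x N) ℚ.+ x N ∣
        ≤⟨ ℚₚ.∣p+q∣≤∣p∣+∣q∣ (x n ℚ.- x N) (x N) ⟩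
      ∣ x n ℚ.- x N ∣ ℚ.+ ∣ x N ∣
        ≤⟨ ℚₚ.+-monoˡ-≤ ∣ x N ∣ (ℚₚ.<⇒≤ (p n N n≥ ℕₚ.≤-refl)) ⟩
      1ℚ ℚ.+ ∣ x N ∣ ∎
    where
    open ℚₚ.≤-Reasoning
    split : ∀ a b → a ≡ (a ℚ.- b) ℚ.+ b
    split = solve-∀ ℚ-ring

  *-mono-abs : ∀ a b {B D} → 0ℚ ℚ.< B → ∣ a ∣ ℚ.≤ B → ∣ b ∣ ℚ.≤ D →
    ∣ a ℚ.* b ∣ ℚ.≤ B ℚ.* D
  *-mono-abs a b {B} {D} B>0 a≤B b≤D =
    subst (ℚ._≤ B ℚ.* D) (sym (ℚₚ.∣p*q∣≡∣p∣*∣q∣ a b))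
      (ℚₚ.≤-trans {∣ a ∣ ℚ.* ∣ b ∣} {B ℚ.* ∣ b ∣} {B ℚ.* D} left right)
    where
    left : ∣ a ∣ ℚ.* ∣ b ∣ ℚ.≤ B ℚ.* ∣ b ∣
    left = ℚₚ.*-monoʳ-≤-nonNeg ∣ b ∣ {{ℚ.nonNegative (ℚₚ.0≤∣p∣ b)}} {∣ a ∣} {B} a≤B
    right : B ℚ.* ∣ b ∣ ℚ.≤ B ℚ.* D
    right = ℚₚ.*-monoˡ-≤-nonNeg B {{ℚ.nonNegative (ℚₚ.<⇒≤ B>0)}} {∣ b ∣} {D} b≤D

  ½*-< : ∀ {ε} → 0ℚ ℚ.< ε → ½ ℚ.* ε ℚ.< ε
  ½*-< {ε} ε>0 = subst₂ ℚ._<_ (ℚₚ.+-identityʳ (½ ℚ.* ε)) (halves ε)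
    (ℚₚ.+-monoʳ-< (½ ℚ.* ε) (½*-pos ε>0))

  shrink : ∀ C {ε} → 0ℚ ℚ.< C → 0ℚ ℚ.< ε → ∃[ δ ] (0ℚ ℚ.< δ × C ℚ.* δ ℚ.< ε)
  shrink C {ε} C>0 ε>0 = r ℚ.* (½ ℚ.* ε)
    , ℚₚ.positive⁻¹ (r ℚ.* (½ ℚ.* ε))
        {{ℚₚ.pos*pos⇒pos r {{ℚₚ.1/pos⇒pos C}} (½ ℚ.* ε) {{ℚ.positive (½*-pos ε>0)}}}}
    , subst (ℚ._< ε) (sym C*r*h≡h) (½*-< ε>0)
    where
    instance
      C-pos : Positive C
      C-pos = ℚ.positive C>0
      C-nonZero : ℚ.NonZero C
      C-nonZero = ℚₚ.pos⇒nonZero C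
    r = ℚ.1/ C
    C*r*h≡h : C ℚ.* (r ℚ.* (½ ℚ.* ε)) ≡ ½ ℚ.* ε
    C*r*h≡h = trans (sym (ℚₚ.*-assoc C r (½ ℚ.* ε)))
      (trans (cong (ℚ._* (½ ℚ.* ε)) (ℚₚ.*-inverseʳ C)) (ℚₚ.*-identityˡ (½ ℚ.* ε)))

  *-difference : ∀ {B D δ} a b c d → 0ℚ ℚ.< B → 0ℚ ℚ.< D →
    ∣ a ∣ ℚ.≤ B → ∣ d ∣ ℚ.≤ D → ∣ a ℚ.- c ∣ ℚ.≤ δ → ∣ b ℚ.- d ∣ ℚ.≤ δ →
    ∣ (a ℚ.* b) ℚ.- (c ℚ.* d) ∣ ℚ.≤ (B ℚ.+ D) ℚ.* δ
  *-difference {B} {D} {δ} a b c d B>0 D>0 a≤ d≤ ac≤ bd≤ = begin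
      ∣ (a ℚ.* b) ℚ.- (c ℚ.* d) ∣
        ≡⟨ cong ∣_∣ (rearrange a b c d) ⟩
      ∣ a ℚ.* (b ℚ.- d) ℚ.+ d ℚ.* (a ℚ.- c) ∣
        ≤⟨ ℚₚ.∣p+q∣≤∣p∣+∣q∣ (a ℚ.* (b ℚ.- d)) (d ℚ.* (a ℚ.- c)) ⟩
      ∣ a ℚ.* (b ℚ.- d) ∣ ℚ.+ ∣ d ℚ.* (a ℚ.- c) ∣
        ≤⟨ ℚₚ.+-mono-≤ (*-mono-abs a (b ℚ.- d) B>0 a≤ bd≤)
                       (*-mono-abs d (a ℚ.- c) D>0 d≤ ac≤) ⟩
      B ℚ.* δ ℚ.+ D ℚ.* δ
        ≡⟨ sym (ℚₚ.*-distribʳ-+ δ B D) ⟩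
      (B ℚ.+ D) ℚ.* δ ∎
    where
    open ℚₚ.≤-Reasoning
    rearrange : ∀ a b c d →
      (a ℚ.* b) ℚ.- (c ℚ.* d) ≡ a ℚ.* (b ℚ.- d) ℚ.+ d ℚ.* (a ℚ.- c)
    rearrange = solve-∀ ℚ-ring

  *-cauchy : ∀ {x y} → IsCauchy x → IsCauchy y → IsCauchy (λ n → x n ℚ.* y n)
  *-cauchy {x} {y} cx cy ε ε>0 =
    let B , K , B>0 , bx = eventually-bounded cx
        D , L , D>0 , by = eventually-bounded cy
        δ , δ>0 , small  = shrink (B ℚ.+ D) {ε} (ℚₚ.+-mono-< {0ℚ} {B} {0ℚ} {D} B>0 D>0) ε>0
        P , px           = cx δ δ>0
        Q , py           = cy δ δ>0
        KL≤ : ∀ {k} → (K ℕ.⊔ L) ℕ.⊔ (P ℕ.⊔ Q) ℕ.≤ k → K ℕ.⊔ L ℕ.≤ k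
        KL≤ = ℕₚ.m⊔n≤o⇒m≤o (K ℕ.⊔ L) (P ℕ.⊔ Q)
        PQ≤ : ∀ {k} → (K ℕ.⊔ L) ℕ.⊔ (P ℕ.⊔ Q) ℕ.≤ k → P ℕ.⊔ Q ℕ.≤ k
        PQ≤ = ℕₚ.m⊔n≤o⇒n≤o (K ℕ.⊔ L) (P ℕ.⊔ Q)
    in (K ℕ.⊔ L) ℕ.⊔ (P ℕ.⊔ Q) , λ m n m≥ n≥ →
      ℚₚ.≤-<-trans
        {∣ (x m ℚ.* y m) ℚ.- (x n ℚ.* y n) ∣} {(B ℚ.+ D) ℚ.* δ} {ε}
        (*-difference {B} {D} {δ} (x m) (y m) (x n) (y n) B>0 D>0
          (bx m (ℕₚ.m⊔n≤o⇒m≤o K L (KL≤ m≥)))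
          (by n (ℕₚ.m⊔n≤o⇒n≤o K L (KL≤ n≥)))
          (ℚₚ.<⇒≤ (px m n (ℕₚ.m⊔n≤o⇒m≤o P Q (PQ≤ m≥)) (ℕₚ.m⊔n≤o⇒m≤o P Q (PQ≤ n≥))))
          (ℚₚ.<⇒≤ (py m n (ℕₚ.m⊔n≤o⇒n≤o P Q (PQ≤ m≥)) (ℕₚ.m⊔n≤o⇒n≤o P Q (PQ≤ n≥)))))
        small

fromℚ : ℚ → ℝ
fromℚ q = mkℝ (λ _ → q) (const-cauchy q)

0ℝ 1ℝ : ℝ
0ℝ = fromℚ 0ℚ
1ℝ = fromℚ 1ℚ

infixl 6 _+_
infixl 7 _*_

_+_ : ℝ → ℝ → ℝ
x + y = mkℝ (λ n → seq x n ℚ.+ seq y n) (+-cauchy {seq x} {seq y} (cauchy x) (cauchy y))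

_*_ : ℝ → ℝ → ℝ
x * y = mkℝ (λ n → seq x n ℚ.* seq y n) (*-cauchy {seq x} {seq y} (cauchy x) (cauchy y))

∑ : ∀ {n} → (Fin n → ℝ) → ℝ
∑ = foldr _+_ 0ℝ

Matrix : ℕ → Set
Matrix n = Fin n → Fin n → ℝ

infix  4 _≋_
infixl 6 _⊞_
infixl 7 _⊡_ _⊠_

_≋_ : ∀ {n} → Matrix n → Matrix n → Set
X ≋ Y = ∀ i j → X i j ≈ Y i j

_⊞_ : ∀ {n} → Matrix n → Matrix n → Matrix n
(X ⊞ Y) i j = X i j + Y i j

_⊡_ : ∀ {n} → ℝ → Matrix n → Matrix n
(t ⊡ X) i j = t * X i j

_⊠_ : ∀ {n} → Matrix n → Matrix n → Matrix n
(X ⊠ Y) i j = ∑ λ k → X i k * Y k j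

_ᵀ : ∀ {n} → Matrix n → Matrix n
(X ᵀ) i j = X j i

diag : ∀ {n} → (Fin n → ℝ) → Matrix n
diag d i j = if does (i ≟ᶠ j) then d i else 0ℝ

𝐈 : ∀ {n} → Matrix n
𝐈 = diag λ _ → 1ℝ

Orthogonal : ∀ {n} → Matrix n → Set
Orthogonal U = (U ᵀ ⊠ U ≋ 𝐈) × (U ⊠ U ᵀ ≋ 𝐈)

-- σ lists the singular values of X, with multiplicity and in some order:
-- X = U diag(σ) Vᵀ with U, V orthogonal and σ ≥ 0.
SingularValues : ∀ {n} → Matrix n → (Fin n → ℝ) → Set
SingularValues X σ =
  (∀ i → 0ℝ ≤ σ i) ×
  ∃[ U ] ∃[ V ] (Orthogonal U × Orthogonal V × X ≋ U ⊠ diag σ ⊠ V ᵀ)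

-- "‖ X ‖₁ = r".  The norm is given by its graph, since a singular value
-- decomposition cannot be computed from the entries constructively.
‖_‖₁≈_ : ∀ {n} → Matrix n → ℝ → Set
‖ X ‖₁≈ r = ∃[ σ ] (SingularValues X σ × r ≈ ∑ σ)

-- ‖ X + tY ‖₁ ≥ ‖ X ‖₁ for every real t.  The norm has classically exactly
-- one value up to _≈_, so quantifying over its values p and q is the same
-- as evaluating it.
BirkhoffJamesOrthogonal : ∀ {n} → Matrix n → Matrix n → Set
BirkhoffJamesOrthogonal X Y =
  ∀ t p q → ‖ X ‖₁≈ p → ‖ X ⊞ t ⊡ Y ‖₁≈ q → p ≤ q

-- β(i, j) = (i-1)! (j-1)! / (i+j-1)!; used only for i, j ≥ 1, where the
-- truncated subtraction is exact.
β : ℕ → ℕ → ℚ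
β i j = ℚ._/_ (+ ((i ℕ.∸ 1) ! ℕ.* (j ℕ.∸ 1) !)) ((i ℕ.+ j ℕ.∸ 1) !)
  {{ℕₚ._!≢0 (i ℕ.+ j ℕ.∸ 1)}}

-- Fin n counts from 0, the matrix indices from 1.
betaMatrix : ∀ n → Matrix n
betaMatrix n i j = fromℚ (β (suc (toℕ i)) (suc (toℕ j)))

module Submission where

-- The beta matrix is the Gram matrix of the form ∫ f(x) g(1−x) dx on [0,1] in
-- the monomial basis, and the shifted Legendre polynomials, being even or odd
-- about 1/2, diagonalise it with alternating signs.  By Sylvester's law of
-- inertia its eigenvalues are nonzero and the difference between the numbers
-- of positive and negative ones is 0 for n even and 1 for n odd.  If B = Q Λ Qᵀ
-- then S = Q sgn(Λ) Qᵀ is orthogonal and tr(S (B + t I)) = ‖B‖₁ + t tr S.  As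
-- tr(W X) ≤ ‖X‖₁ for every orthogonal W, tr S = 0 gives ‖B + t I‖₁ ≥ ‖B‖₁, while
-- for tr S = 1 a small negative t makes the norm strictly smaller.
--
-- The spectral theorem is only available up to double negation, which is
-- enough since ≤ on the reals is stable.  The eigenvalue itself must be
-- constructed without it: for each ε one can decide, by elimination, whether
-- r I − A is positive semidefinite or has an ε-null vector, and this locates the
-- largest eigenvalue as a Cauchy sequence.

open import Algebra.Bundles using (CommutativeRing)
import Algebra.Properties.Semiring.Sum as SemiringSum
import Algebra.Solver.Ring as RingSolver
import Algebra.Solver.Ring.AlmostCommutativeRing as SolverRing
open import Algebra.Structures using (IsCommutativeRing)
open import Data.Bool.Base using (Bool; true; false; not; if_then_else_)
open import Data.Empty using (⊥; ⊥-elim)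
open import Data.Fin.Base using (Fin; zero; suc; toℕ; punchIn)
import Data.Fin.Properties as Finₚ
open import Data.Integer.Base as ℤ using (+_; -[1+_])
import Data.Integer.Properties as ℤₚ
open import Data.List.Base as List using (List; []; _∷_; length)
import Data.List.Properties as Listₚ
open import Data.List.Relation.Unary.All as All using (All; []; _∷_)
import Data.List.Relation.Unary.All.Properties as Allₚ
import Data.Maybe.Base as Maybe
open import Data.Nat.Base as ℕ using (ℕ; zero; suc; _!) renaming (_≤_ to _≤ℕ_)
import Data.Nat.Coprimality as Coprimality
open import Data.Nat.Divisibility using (_∣_; divides)
import Data.Nat.Properties as ℕₚ
open import Data.Product.Base using (∃₂; ∃-syntax; _×_; _,_; proj₁; proj₂)
open import Data.Rational.Base as ℚ using (ℚ; mkℚ; 0ℚ; 1ℚ; ½; ∣_∣; *≤*)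
import Data.Rational.Properties as ℚₚ
open import Data.Rational.Unnormalised.Base as ℚᵘ using (*≡*)
import Data.Rational.Unnormalised.Properties as ℚᵘₚ
open import Data.Sum.Base using (_⊎_; inj₁; inj₂; [_,_]′)
open import Data.Vec.Functional using (removeAt; insertAt) renaming (_∷_ to _◂_)
open import Data.Vec.Functional.Properties using (insertAt-lookup; insertAt-punchIn)
import Defs
open import Function.Base using (_∘_; case_of_)
open import Function.Bundles using (_⇔_; mk⇔)
open import Level using (0ℓ)
open import Relation.Binary.Bundles using (Poset)
open import Relation.Binary.Definitions using (tri<; tri≈; tri>)
open import Relation.Binary.PropositionalEquality as ≡ using (_≡_)
open import Relation.Nullary.Decidable using (yes; no; does; dec⇒maybe)
open import Relation.Nullary.Negation using (¬_; contradiction)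
open import Tactic.RingSolver using (solve-∀)
open import Tactic.RingSolver.Core.AlmostCommutativeRing using (AlmostCommutativeRing; fromCommutativeRing)

-- A real is a function ℕ → ℚ, and double negation passes through finite products (`finite-choice`)
-- but not constructively through choice over ℕ. A supremum whose approximations exist only up to
-- double negation therefore need not yield a real. This is why eigenvalues and square roots rest on
-- approximate dichotomies whose alternatives overlap. In the limit they leave only ε-null vectors;
-- `null-or-coercive` turns these into an exact one, in place of the compactness of the sphere. No
-- integral occurs: the orthogonality of a Legendre polynomial to lower powers appears as an
-- identity for iterated differences of quotients of factorials, of Chu-Vandermonde type. The norm
-- is a relation, so an arbitrary singular value decomposition of B must be compared with its
-- spectral decomposition; the bound on tr(W X) does this as well.

infixl 1 _>>=_

_>>=_ : {A B : Set} → ¬ ¬ A → (A → ¬ ¬ B) → ¬ ¬ B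
(m >>= f) k = m λ a → f a k

return : {A : Set} → A → ¬ ¬ A
return a k = k a

lem : {A : Set} → ¬ ¬ (A ⊎ ¬ A)
lem k = k (inj₂ (k ∘ inj₁))

-- The double-negation shift, provable here because the index set is finite. It gathers the signs of
-- all eigenvalues into one classical fact.
finite-choice : ∀ {n} {P : Fin n → Set} → (∀ i → ¬ ¬ P i) → ¬ ¬ (∀ i → P i)
finite-choice {zero} p = return λ ()
finite-choice {suc n} p = p zero >>= λ p₀ → finite-choice (p ∘ suc) >>= λ p₊ →
  return λ { zero → p₀ ; (suc i) → p₊ i }

-- Rational arithmetic

half-pos : ∀ {ε} → 0ℚ ℚ.< ε → 0ℚ ℚ.< ½ ℚ.* ε
half-pos {ε} ε>0 = ≡.subst (ℚ._< ½ ℚ.* ε) (ℚₚ.*-zeroʳ ½) (ℚₚ.*-monoʳ-<-pos ½ ε>0)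

*-pos : ∀ {p q} → 0ℚ ℚ.< p → 0ℚ ℚ.< q → 0ℚ ℚ.< p ℚ.* q
*-pos {p} {q} p>0 q>0 = ℚₚ.positive⁻¹ (p ℚ.* q)
  {{ℚₚ.pos*pos⇒pos p {{ℚ.positive p>0}} q {{ℚ.positive q>0}}}}

ℚ-ring : AlmostCommutativeRing 0ℓ 0ℓ
ℚ-ring = fromCommutativeRing ℚₚ.+-*-commutativeRing λ q → dec⇒maybe (0ℚ ℚₚ.≟ q)

ℚ-<⇒0<- : ∀ {p q} → p ℚ.< q → 0ℚ ℚ.< q ℚ.- p
ℚ-<⇒0<- {p} {q} p<q = ≡.subst (ℚ._< q ℚ.- p) (ℚₚ.+-inverseʳ p) (ℚₚ.+-monoˡ-< (ℚ.- p) p<q)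

ℚ-≤⇒0≤- : ∀ {p q} → p ℚ.≤ q → 0ℚ ℚ.≤ q ℚ.- p
ℚ-≤⇒0≤- {p} {q} p≤q = ≡.subst (ℚ._≤ q ℚ.- p) (ℚₚ.+-inverseʳ p) (ℚₚ.+-monoˡ-≤ (ℚ.- p) p≤q)

-- Linear consequences are drawn by writing the difference of the two sides
-- as a positive expression.
ℚ-0<-⇒< : ∀ {p q d} → 0ℚ ℚ.< d → d ≡ q ℚ.- p → p ℚ.< q
ℚ-0<-⇒< {p} {q} 0<d ≡.refl = ≡.subst₂ ℚ._<_ (ℚₚ.+-identityˡ p) (cancel p q) (ℚₚ.+-monoˡ-< p 0<d)
  where
  cancel : ∀ p q → q ℚ.- p ℚ.+ p ≡ q
  cancel = solve-∀ ℚ-ring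

ℚ-0≤-⇒≤ : ∀ {p q d} → 0ℚ ℚ.≤ d → d ≡ q ℚ.- p → p ℚ.≤ q
ℚ-0≤-⇒≤ {p} {q} 0≤d ≡.refl = ≡.subst₂ ℚ._≤_ (ℚₚ.+-identityˡ p) (cancel p q) (ℚₚ.+-monoˡ-≤ p 0≤d)
  where
  cancel : ∀ p q → q ℚ.- p ℚ.+ p ≡ q
  cancel = solve-∀ ℚ-ring

infixr 6 _⊕_ _⊕≤_
_⊕_ : ∀ {p q} → 0ℚ ℚ.< p → 0ℚ ℚ.< q → 0ℚ ℚ.< p ℚ.+ q
_⊕_ {p} {q} 0<p 0<q = ≡.subst (ℚ._< p ℚ.+ q) (ℚₚ.+-identityˡ 0ℚ) (ℚₚ.+-mono-< 0<p 0<q)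

_⊕≤_ : ∀ {p q} → 0ℚ ℚ.< p → 0ℚ ℚ.≤ q → 0ℚ ℚ.< p ℚ.+ q
_⊕≤_ {p} {q} 0<p 0≤q = ≡.subst (ℚ._< p ℚ.+ q) (ℚₚ.+-identityˡ 0ℚ) (ℚₚ.+-mono-<-≤ 0<p 0≤q)

ℚ-*-nonNeg : ∀ {p q} → 0ℚ ℚ.≤ p → 0ℚ ℚ.≤ q → 0ℚ ℚ.≤ p ℚ.* q
ℚ-*-nonNeg {p} {q} 0≤p 0≤q = ℚₚ.nonNegative⁻¹ (p ℚ.* q)
  {{ℚₚ.nonNeg*nonNeg⇒nonNeg p {{ℚ.nonNegative 0≤p}} q {{ℚ.nonNegative 0≤q}}}}

p≤∣p∣ : ∀ p → p ℚ.≤ ∣ p ∣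
p≤∣p∣ p = [ (λ 0≤p → ℚₚ.≤-reflexive (≡.sym (ℚₚ.0≤p⇒∣p∣≡p 0≤p)))
          , (λ p≤0 → ℚₚ.≤-trans p≤0 (ℚₚ.0≤∣p∣ p)) ]′ (ℚₚ.≤-total 0ℚ p)

abs<⇒< : ∀ {p q ε} → ∣ p ℚ.- q ∣ ℚ.< ε → p ℚ.< q ℚ.+ ε
abs<⇒< {p} {q} {ε} lt = ℚ-0<-⇒< (ℚ-<⇒0<- (ℚₚ.≤-<-trans (p≤∣p∣ (p ℚ.- q)) lt)) (eq p q ε)
  where
  eq : ∀ p q e → e ℚ.- (p ℚ.- q) ≡ (q ℚ.+ e) ℚ.- p
  eq = solve-∀ ℚ-ring

abs-swap : ∀ p q → ∣ p ℚ.- q ∣ ≡ ∣ q ℚ.- p ∣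
abs-swap p q = ≡.trans (≡.sym (ℚₚ.∣-p∣≡∣p∣ (p ℚ.- q))) (≡.cong ∣_∣ (eq p q))
  where
  eq : ∀ p q → ℚ.- (p ℚ.- q) ≡ q ℚ.- p
  eq = solve-∀ ℚ-ring

abs<⇒<′ : ∀ {p q ε} → ∣ p ℚ.- q ∣ ℚ.< ε → q ℚ.< p ℚ.+ ε
abs<⇒<′ {p} {q} {ε} lt = abs<⇒< (≡.subst (ℚ._< ε) (abs-swap p q) lt)

abs-bound : ∀ {p ε} → p ℚ.< ε → ℚ.- p ℚ.< ε → ∣ p ∣ ℚ.< ε
abs-bound {p} {ε} p<ε -p<ε = [ (λ e → ≡.subst (ℚ._< ε) (≡.sym e) p<ε)
  , (λ e → ≡.subst (ℚ._< ε) (≡.sym e) -p<ε) ]′ (ℚₚ.∣p∣≡p∨∣p∣≡-p p)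

<⇒abs< : ∀ {p q ε} → p ℚ.< q ℚ.+ ε → q ℚ.< p ℚ.+ ε → ∣ p ℚ.- q ∣ ℚ.< ε
<⇒abs< {p} {q} {ε} lt gt = abs-bound (ℚ-0<-⇒< (ℚ-<⇒0<- lt) (eq₁ p q ε)) (ℚ-0<-⇒< (ℚ-<⇒0<- gt) (eq₂ p q ε))
  where
  eq₁ : ∀ p q e → (q ℚ.+ e) ℚ.- p ≡ e ℚ.- (p ℚ.- q)
  eq₁ = solve-∀ ℚ-ring
  eq₂ : ∀ p q e → (p ℚ.+ e) ℚ.- q ≡ e ℚ.- (ℚ.- (p ℚ.- q))
  eq₂ = solve-∀ ℚ-ring

≤-of-< : ∀ {p q} → (∀ ε → 0ℚ ℚ.< ε → p ℚ.< q ℚ.+ ε) → p ℚ.≤ q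
≤-of-< {p} {q} close = ℚₚ.≮⇒≥ λ q<p → ℚₚ.<-irrefl (eq p q) (close (p ℚ.- q) (ℚ-<⇒0<- q<p))
  where
  eq : ∀ p q → p ≡ q ℚ.+ (p ℚ.- q)
  eq = solve-∀ ℚ-ring

half-sum : ∀ ε → ½ ℚ.* ε ℚ.+ ½ ℚ.* ε ≡ ε
half-sum ε = ≡.trans (≡.sym (ℚₚ.*-distribʳ-+ ε ½ ½)) (ℚₚ.*-identityˡ ε)

-- Made total by the value 0 at 0, so that a Cauchy sequence can be inverted termwise although some
-- early terms may vanish.
inv : ℚ → ℚ
inv q with q ℚₚ.≟ 0ℚ
... | yes _   = 0ℚ
... | no q≢0 = ℚ.1/_ q {{ℚ.≢-nonZero q≢0}}

*-inv : ∀ {q} → 0ℚ ℚ.< q → q ℚ.* inv q ≡ 1ℚ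
*-inv {q} 0<q with q ℚₚ.≟ 0ℚ
... | yes q≡0 = contradiction (≡.sym q≡0) (ℚₚ.<⇒≢ 0<q)
... | no q≢0 = ℚₚ.*-inverseʳ q {{ℚ.≢-nonZero q≢0}}

inv-pos : ∀ {q} → 0ℚ ℚ.< q → 0ℚ ℚ.< inv q
inv-pos {q} 0<q = ℚₚ.*-cancelˡ-<-nonNeg q {{ℚ.nonNegative (ℚₚ.<⇒≤ 0<q)}}
  (≡.subst₂ ℚ._<_ (≡.sym (ℚₚ.*-zeroʳ q)) (≡.sym (*-inv 0<q)) (ℚₚ.positive⁻¹ 1ℚ))

divide : ∀ {p q} → 0ℚ ℚ.< p → 0ℚ ℚ.< q → ∃[ r ] (0ℚ ℚ.< r × q ℚ.* r ≡ p)
divide {p} {q} 0<p 0<q = inv q ℚ.* p , *-pos (inv-pos 0<q) 0<p ,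
  ≡.trans (≡.sym (ℚₚ.*-assoc q (inv q) p)) (≡.trans (≡.cong (ℚ._* p) (*-inv 0<q)) (ℚₚ.*-identityˡ p))

-- Given in lowest terms directly: `_/_` normalises by a gcd, which does not compute on a variable.
natural : ℕ → ℚ
natural N = mkℚ (+ N) 0 (Coprimality.sym (Coprimality.1-coprimeTo N))

natural-suc : ∀ N → natural (suc N) ≡ natural N ℚ.+ 1ℚ
natural-suc N = ≡.sym (ℚₚ.toℚᵘ-injective (ℚᵘₚ.≃-trans (ℚₚ.toℚᵘ-homo-+ (natural N) 1ℚ) (*≡*
  (≡.cong (ℤ._* ℤ.1ℤ) (≡.trans (≡.cong (ℤ._+ ℤ.1ℤ) (ℤₚ.*-identityʳ (+ N))) (≡.cong +_ (ℕₚ.+-comm N 1)))))))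

open SemiringSum (CommutativeRing.semiring ℚₚ.+-*-commutativeRing)
  using ()
  renaming (sum to sumℚ; sum-cong-≋ to sumℚ-cong; ∑-distrib-+ to sumℚ-+;
            *-distribˡ-sum to *-distribˡ-sumℚ; sum-replicate-zero to sumℚ-zeros)

-- Legendre polynomials and the beta matrix

natural-+ : ∀ m n → natural (m ℕ.+ n) ≡ natural m ℚ.+ natural n
natural-+ zero n = ≡.sym (ℚₚ.+-identityˡ (natural n))
natural-+ (suc m) n = ≡.trans (natural-suc (m ℕ.+ n)) (≡.trans (≡.cong (ℚ._+ 1ℚ) (natural-+ m n))
  (≡.trans (eq (natural m) (natural n)) (≡.cong (ℚ._+ natural n) (≡.sym (natural-suc m)))))
  where
  eq : ∀ a b → a ℚ.+ b ℚ.+ 1ℚ ≡ a ℚ.+ 1ℚ ℚ.+ b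
  eq = solve-∀ ℚ-ring

natural-* : ∀ m n → natural (m ℕ.* n) ≡ natural m ℚ.* natural n
natural-* zero n = ≡.sym (ℚₚ.*-zeroˡ (natural n))
natural-* (suc m) n = ≡.trans (natural-+ n (m ℕ.* n)) (≡.trans (≡.cong (natural n ℚ.+_) (natural-* m n))
  (≡.trans (eq (natural m) (natural n)) (≡.cong (ℚ._* natural n) (≡.sym (natural-suc m)))))
  where
  eq : ∀ a b → b ℚ.+ a ℚ.* b ≡ (a ℚ.+ 1ℚ) ℚ.* b
  eq = solve-∀ ℚ-ring

natural-pos : ∀ n .{{_ : ℕ.NonZero n}} → 0ℚ ℚ.< natural n
natural-pos (suc n) = ℚₚ.positive⁻¹ (natural (suc n))

-- `_/_` cancels common factors, so the comparison is made after clearing the denominator, in the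
-- unnormalised rationals.
fraction : ∀ m n .{{_ : ℕ.NonZero n}} → + m ℚ./ n ≡ natural m ℚ.* inv (natural n)
fraction m n@(suc n-1) = begin
  + m ℚ./ n                                       ≡⟨ ℚₚ.*-identityʳ (+ m ℚ./ n) ⟨
  + m ℚ./ n ℚ.* 1ℚ                                ≡⟨ ≡.cong (+ m ℚ./ n ℚ.*_) (*-inv (natural-pos n)) ⟨
  + m ℚ./ n ℚ.* (natural n ℚ.* inv (natural n))   ≡⟨ ℚₚ.*-assoc (+ m ℚ./ n) (natural n) (inv (natural n)) ⟨
  + m ℚ./ n ℚ.* natural n ℚ.* inv (natural n)     ≡⟨ ≡.cong (ℚ._* inv (natural n)) cleared ⟩
  natural m ℚ.* inv (natural n)                   ∎
  where
  open ≡.≡-Reasoning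
  cleared : + m ℚ./ n ℚ.* natural n ≡ natural m
  cleared = ℚₚ.toℚᵘ-injective (ℚᵘₚ.≃-trans (ℚₚ.toℚᵘ-homo-* (+ m ℚ./ n) (natural n))
    (ℚᵘₚ.≃-trans (ℚᵘₚ.*-congʳ {ℚ.toℚᵘ (natural n)} (ℚₚ.toℚᵘ-fromℚᵘ (ℚᵘ.mkℚᵘ (+ m) n-1)))
      (*≡* (≡.trans (ℤₚ.*-assoc (+ m) (+ n) ℤ.1ℤ) (≡.cong (+ m ℤ.*_)
        (≡.trans (ℤₚ.*-identityʳ (+ n)) (≡.sym (≡.cong +_ (ℕₚ.*-identityʳ n)))))))))

factorial inverse-factorial : ℕ → ℚ
factorial n = natural (n !)
inverse-factorial n = inv (factorial n)

factorial-suc : ∀ n → factorial (suc n) ≡ natural (suc n) ℚ.* factorial n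
factorial-suc n = natural-* (suc n) (n !)

factorial-pos : ∀ n → 0ℚ ℚ.< factorial n
factorial-pos n = natural-pos (n !) {{ℕₚ._!≢0 n}}

factorial-inverse : ∀ n → factorial n ℚ.* inverse-factorial n ≡ 1ℚ
factorial-inverse n = *-inv (factorial-pos n)

inverse-factorial-suc : ∀ n → inverse-factorial n ≡ natural (suc n) ℚ.* inverse-factorial (suc n)
inverse-factorial-suc n = begin
  i                                   ≡⟨ ℚₚ.*-identityʳ i ⟨
  i ℚ.* 1ℚ                            ≡⟨ ≡.cong (i ℚ.*_) (factorial-inverse (suc n)) ⟨
  i ℚ.* (factorial (suc n) ℚ.* j)     ≡⟨ ≡.cong (λ f → i ℚ.* (f ℚ.* j)) (factorial-suc n) ⟩
  i ℚ.* (N ℚ.* factorial n ℚ.* j)     ≡⟨ eq i N (factorial n) j ⟩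
  factorial n ℚ.* i ℚ.* (N ℚ.* j)     ≡⟨ ≡.cong (ℚ._* (N ℚ.* j)) (factorial-inverse n) ⟩
  1ℚ ℚ.* (N ℚ.* j)                    ≡⟨ ℚₚ.*-identityˡ (N ℚ.* j) ⟩
  N ℚ.* j                             ∎
  where
  open ≡.≡-Reasoning
  N = natural (suc n)
  i = inverse-factorial n
  j = inverse-factorial (suc n)
  eq : ∀ i N f j → i ℚ.* (N ℚ.* f ℚ.* j) ≡ f ℚ.* i ℚ.* (N ℚ.* j)
  eq = solve-∀ ℚ-ring

beta-factorials : ∀ i j → Defs.β (suc i) (suc j) ≡ factorial i ℚ.* factorial j ℚ.* inverse-factorial (i ℕ.+ suc j)
beta-factorials i j = ≡.trans (fraction (i ! ℕ.* j !) ((i ℕ.+ suc j) !) {{ℕₚ._!≢0 (i ℕ.+ suc j)}})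
  (≡.cong (ℚ._* inverse-factorial (i ℕ.+ suc j)) (natural-* (i !) (j !)))

factorial-ratio : ℕ → ℕ → ℚ
factorial-ratio a c = factorial a ℚ.* inverse-factorial c

-- Over the common denominator (c+1)! the numerators are a! times c + 1 and a! times a + 1.
-- Quotients of factorials are thus stable under differencing, up to a scalar.
factorial-ratio-difference : ∀ a c →
  factorial-ratio a c ℚ.- factorial-ratio (suc a) (suc c) ≡ (natural c ℚ.- natural a) ℚ.* factorial-ratio a (suc c)
factorial-ratio-difference a c = begin
  f ℚ.* inverse-factorial c ℚ.- factorial (suc a) ℚ.* i
    ≡⟨ ≡.cong₂ (λ u v → f ℚ.* u ℚ.- v ℚ.* i)
         (≡.trans (inverse-factorial-suc c) (≡.cong (ℚ._* i) (natural-suc c)))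
         (≡.trans (factorial-suc a) (≡.cong (ℚ._* f) (natural-suc a))) ⟩
  f ℚ.* ((natural c ℚ.+ 1ℚ) ℚ.* i) ℚ.- (natural a ℚ.+ 1ℚ) ℚ.* f ℚ.* i
    ≡⟨ eq f i (natural a) (natural c) ⟩
  (natural c ℚ.- natural a) ℚ.* (f ℚ.* i) ∎
  where
  open ≡.≡-Reasoning
  f = factorial a
  i = inverse-factorial (suc c)
  eq : ∀ f i a c → f ℚ.* ((c ℚ.+ 1ℚ) ℚ.* i) ℚ.- (a ℚ.+ 1ℚ) ℚ.* f ℚ.* i ≡ (c ℚ.- a) ℚ.* (f ℚ.* i)
  eq = solve-∀ ℚ-ring

-- signed-binomial m k = (-1)ᵏ (m choose k), the coefficients of the m-th
-- power of the difference operator g ↦ g(k) − g(k+1).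
signed-binomial : ℕ → ℕ → ℚ
signed-binomial zero    zero    = 1ℚ
signed-binomial zero    (suc k) = 0ℚ
signed-binomial (suc m) zero    = signed-binomial m zero
signed-binomial (suc m) (suc k) = signed-binomial m (suc k) ℚ.- signed-binomial m k

signed-binomial-above : ∀ {m k} → m ℕ.< k → signed-binomial m k ≡ 0ℚ
signed-binomial-above {zero} {suc k} _ = ≡.refl
signed-binomial-above {suc m} {suc k} (ℕ.s≤s m<k) =
  ≡.cong₂ ℚ._-_ (signed-binomial-above {m} {suc k} (ℕₚ.m<n⇒m<1+n m<k)) (signed-binomial-above {m} {k} m<k)

parity-sign : ℕ → ℚ
parity-sign zero    = 1ℚ
parity-sign (suc m) = ℚ.- parity-sign m

parity-sign² : ∀ m → parity-sign m ℚ.* parity-sign m ≡ 1ℚ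
parity-sign² zero = ≡.refl
parity-sign² (suc m) = ≡.trans (eq (parity-sign m)) (parity-sign² m)
  where
  eq : ∀ s → ℚ.- s ℚ.* ℚ.- s ≡ s ℚ.* s
  eq = solve-∀ ℚ-ring

signed-binomial-diagonal : ∀ m → signed-binomial m m ≡ parity-sign m
signed-binomial-diagonal zero = ≡.refl
signed-binomial-diagonal (suc m) = ≡.trans
  (≡.cong₂ ℚ._-_ (signed-binomial-above {m} (ℕₚ.n<1+n m)) (signed-binomial-diagonal m))
  (ℚₚ.+-identityˡ (ℚ.- parity-sign m))

-- The length n is kept apart from the order m because a row of a matrix product always has n terms;
-- the coefficients beyond m vanish.
difference : ℕ → ℕ → (ℕ → ℚ) → ℚ
difference m n g = sumℚ {n} λ k → signed-binomial m (toℕ k) ℚ.* g (toℕ k)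

-- Pascal's rule. The shifted copy is one term shorter, which is why the length varies in the
-- induction of `chu-vandermonde`.
difference-suc : ∀ m n g → difference (suc m) (suc n) g ≡ difference m (suc n) g ℚ.- difference m n (g ∘ suc)
difference-suc m n g = begin
  s₀ ℚ.* g 0 ℚ.+ sumℚ (λ k → (s′ k ℚ.- s k) ℚ.* g′ k)
    ≡⟨ ≡.cong (s₀ ℚ.* g 0 ℚ.+_) (≡.trans
        (sumℚ-cong λ k → eq₁ (s′ k) (s k) (g′ k))
        (≡.trans (sumℚ-+ (λ k → s′ k ℚ.* g′ k) (λ k → ℚ.- 1ℚ ℚ.* (s k ℚ.* g′ k)))
          (≡.cong (S′ ℚ.+_) (≡.sym (*-distribˡ-sumℚ (ℚ.- 1ℚ) (λ k → s k ℚ.* g′ k)))))) ⟩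
  s₀ ℚ.* g 0 ℚ.+ (S′ ℚ.+ ℚ.- 1ℚ ℚ.* S)
    ≡⟨ eq₂ (s₀ ℚ.* g 0) S′ S ⟩
  s₀ ℚ.* g 0 ℚ.+ S′ ℚ.- S ∎
  where
  open ≡.≡-Reasoning
  s₀ = signed-binomial m 0
  s s′ g′ : Fin n → ℚ
  s k = signed-binomial m (toℕ k)
  s′ k = signed-binomial m (suc (toℕ k))
  g′ k = g (suc (toℕ k))
  S = sumℚ λ k → s k ℚ.* g′ k
  S′ = sumℚ λ k → s′ k ℚ.* g′ k
  eq₁ : ∀ s′ s g → (s′ ℚ.- s) ℚ.* g ≡ s′ ℚ.* g ℚ.+ ℚ.- 1ℚ ℚ.* (s ℚ.* g)
  eq₁ = solve-∀ ℚ-ring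
  eq₂ : ∀ a b c → a ℚ.+ (b ℚ.+ ℚ.- 1ℚ ℚ.* c) ≡ a ℚ.+ b ℚ.- c
  eq₂ = solve-∀ ℚ-ring

difference-cong : ∀ m n {g h} → (∀ k → g k ≡ h k) → difference m n g ≡ difference m n h
difference-cong m n g≡h = sumℚ-cong {n} λ k → ≡.cong (signed-binomial m (toℕ k) ℚ.*_) (g≡h (toℕ k))

-- The Pochhammer symbol z(z+1)⋯(z+m-1). The argument is rational since it will be a difference that
-- may be negative, and orthogonality comes from the factor that then vanishes.
rising : ℚ → ℕ → ℚ
rising z zero    = 1ℚ
rising z (suc m) = rising z m ℚ.* (z ℚ.+ natural m)

rising-zero : ∀ {z i m} → i ℕ.< m → z ℚ.+ natural i ≡ 0ℚ → rising z m ≡ 0ℚ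
rising-zero {z} {i} {suc m} (ℕ.s≤s i≤m) z+i≡0 = case ℕₚ.m≤n⇒m<n∨m≡n i≤m of λ where
  (inj₁ i<m) → ≡.trans (≡.cong (ℚ._* (z ℚ.+ natural m)) (rising-zero i<m z+i≡0)) (ℚₚ.*-zeroˡ (z ℚ.+ natural m))
  (inj₂ ≡.refl) → ≡.trans (≡.cong (rising z m ℚ.*_) z+i≡0) (ℚₚ.*-zeroʳ (rising z m))

rising-pos : ∀ {z} m → 0ℚ ℚ.< z → 0ℚ ℚ.< rising z m
rising-pos zero z>0 = ℚₚ.positive⁻¹ 1ℚ
rising-pos (suc m) z>0 = *-pos (rising-pos m z>0) (z>0 ⊕≤ ℚₚ.nonNegative⁻¹ (natural m))

-- Shifting k raises a and c together and leaves c - a alone, so both halves of `difference-suc`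
-- share the factor `R`. What remains is a single difference of factorial quotients, and it supplies
-- the next factor c - a + m.
chu-vandermonde : ∀ m n a c → m ℕ.< n →
  difference m n (λ k → factorial-ratio (k ℕ.+ a) (k ℕ.+ c)) ≡ rising (natural c ℚ.- natural a) m ℚ.* factorial-ratio a (m ℕ.+ c)
chu-vandermonde zero (suc n) a c _ = ≡.trans (≡.cong (1ℚ ℚ.* factorial-ratio a c ℚ.+_)
  (≡.trans (sumℚ-cong {n} λ k → ℚₚ.*-zeroˡ (factorial-ratio (suc (toℕ k) ℕ.+ a) (suc (toℕ k) ℕ.+ c))) (sumℚ-zeros n)))
  (ℚₚ.+-identityʳ (1ℚ ℚ.* factorial-ratio a c))
chu-vandermonde (suc m) (suc n) a c (ℕ.s≤s m<n) = begin
  difference (suc m) (suc n) g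
    ≡⟨ difference-suc m n g ⟩
  difference m (suc n) g ℚ.- difference m n (g ∘ suc)
    ≡⟨ ≡.cong₂ ℚ._-_ (chu-vandermonde m (suc n) a c (ℕₚ.m<n⇒m<1+n m<n))
        (≡.trans (difference-cong m n λ k → ≡.cong₂ factorial-ratio (≡.sym (ℕₚ.+-suc k a)) (≡.sym (ℕₚ.+-suc k c)))
          (≡.trans (chu-vandermonde m n (suc a) (suc c) m<n)
            (≡.cong₂ (λ z c′ → rising z m ℚ.* factorial-ratio (suc a) c′) shift (ℕₚ.+-suc m c)))) ⟩
  R ℚ.* factorial-ratio a (m ℕ.+ c) ℚ.- R ℚ.* factorial-ratio (suc a) (suc (m ℕ.+ c))
    ≡⟨ eq₁ R (factorial-ratio a (m ℕ.+ c)) (factorial-ratio (suc a) (suc (m ℕ.+ c))) ⟩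
  R ℚ.* (factorial-ratio a (m ℕ.+ c) ℚ.- factorial-ratio (suc a) (suc (m ℕ.+ c)))
    ≡⟨ ≡.cong (R ℚ.*_) (factorial-ratio-difference a (m ℕ.+ c)) ⟩
  R ℚ.* ((natural (m ℕ.+ c) ℚ.- natural a) ℚ.* factorial-ratio a (suc (m ℕ.+ c)))
    ≡⟨ ≡.cong (λ x → R ℚ.* ((x ℚ.- natural a) ℚ.* factorial-ratio a (suc (m ℕ.+ c)))) (natural-+ m c) ⟩
  R ℚ.* ((natural m ℚ.+ natural c ℚ.- natural a) ℚ.* factorial-ratio a (suc (m ℕ.+ c)))
    ≡⟨ eq₂ R (natural m) (natural c) (natural a) (factorial-ratio a (suc (m ℕ.+ c))) ⟩
  R ℚ.* (natural c ℚ.- natural a ℚ.+ natural m) ℚ.* factorial-ratio a (suc (m ℕ.+ c)) ∎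
  where
  open ≡.≡-Reasoning
  g : ℕ → ℚ
  g k = factorial-ratio (k ℕ.+ a) (k ℕ.+ c)
  R = rising (natural c ℚ.- natural a) m
  shift : natural (suc c) ℚ.- natural (suc a) ≡ natural c ℚ.- natural a
  shift = ≡.trans (≡.cong₂ ℚ._-_ (natural-suc c) (natural-suc a)) (eq (natural c) (natural a))
    where
    eq : ∀ c a → c ℚ.+ 1ℚ ℚ.- (a ℚ.+ 1ℚ) ≡ c ℚ.- a
    eq = solve-∀ ℚ-ring
  eq₁ : ∀ R x y → R ℚ.* x ℚ.- R ℚ.* y ≡ R ℚ.* (x ℚ.- y)
  eq₁ = solve-∀ ℚ-ring
  eq₂ : ∀ R m c a f → R ℚ.* ((m ℚ.+ c ℚ.- a) ℚ.* f) ≡ R ℚ.* (c ℚ.- a ℚ.+ m) ℚ.* f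
  eq₂ = solve-∀ ℚ-ring

-- The coefficients (-1)ᵏ (m choose k) (m+k choose k) of the shifted Legendre
-- polynomials, up to the factor m!.
legendre : ℕ → ℕ → ℚ
legendre m k = signed-binomial m k ℚ.* (factorial (k ℕ.+ m) ℚ.* inverse-factorial k)

-- Up to the factor m!, this is the integral of the m-th shifted Legendre polynomial against
-- (1-x)^j. The k! of the beta value cancels the 1/k! of the coefficient, and the m-th difference of
-- (k+m)!/(k+j+1)! is left.
legendre-beta : ∀ m j n → m ℕ.< n →
  sumℚ {n} (λ k → legendre m (toℕ k) ℚ.* Defs.β (suc (toℕ k)) (suc j)) ≡
  factorial j ℚ.* (rising (natural (suc j) ℚ.- natural m) m ℚ.* factorial-ratio m (m ℕ.+ suc j))
legendre-beta m j n m<n = begin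
  sumℚ {n} (λ k → legendre m (toℕ k) ℚ.* Defs.β (suc (toℕ k)) (suc j))
    ≡⟨ sumℚ-cong {n} (λ k → term (toℕ k)) ⟩
  sumℚ {n} (λ k → factorial j ℚ.* (signed-binomial m (toℕ k) ℚ.* factorial-ratio (toℕ k ℕ.+ m) (toℕ k ℕ.+ suc j)))
    ≡⟨ *-distribˡ-sumℚ {n} (factorial j) (λ k → signed-binomial m (toℕ k) ℚ.* factorial-ratio (toℕ k ℕ.+ m) (toℕ k ℕ.+ suc j)) ⟨
  factorial j ℚ.* difference m n (λ k → factorial-ratio (k ℕ.+ m) (k ℕ.+ suc j))
    ≡⟨ ≡.cong (factorial j ℚ.*_) (chu-vandermonde m n m (suc j) m<n) ⟩
  factorial j ℚ.* (rising (natural (suc j) ℚ.- natural m) m ℚ.* factorial-ratio m (m ℕ.+ suc j)) ∎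
  where
  open ≡.≡-Reasoning
  eq : ∀ s f i fk fj d → s ℚ.* (f ℚ.* i) ℚ.* (fk ℚ.* fj ℚ.* d) ≡ fk ℚ.* i ℚ.* (fj ℚ.* (s ℚ.* (f ℚ.* d)))
  eq = solve-∀ ℚ-ring
  term : ∀ k → legendre m k ℚ.* Defs.β (suc k) (suc j) ≡ factorial j ℚ.* (signed-binomial m k ℚ.* factorial-ratio (k ℕ.+ m) (k ℕ.+ suc j))
  term k = ≡.trans (≡.cong (legendre m k ℚ.*_) (beta-factorials k j))
    (≡.trans (eq (signed-binomial m k) (factorial (k ℕ.+ m)) (inverse-factorial k) (factorial k) (factorial j) (inverse-factorial (k ℕ.+ suc j)))
      (≡.trans (≡.cong (ℚ._* X) (factorial-inverse k)) (ℚₚ.*-identityˡ X)))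
    where X = factorial j ℚ.* (signed-binomial m k ℚ.* factorial-ratio (k ℕ.+ m) (k ℕ.+ suc j))

-- For j < m the argument j + 1 - m of `rising` is an integer between 1 - m and 0, so the factor
-- with index m - (j+1) is zero.
legendre-orthogonal : ∀ {m j} n → m ℕ.< n → j ℕ.< m →
  sumℚ {n} (λ k → legendre m (toℕ k) ℚ.* Defs.β (suc (toℕ k)) (suc j)) ≡ 0ℚ
legendre-orthogonal {m} {j} n m<n j<m = ≡.trans (legendre-beta m j n m<n)
  (≡.trans (≡.cong (λ x → factorial j ℚ.* (x ℚ.* f)) (rising-zero {i = m ℕ.∸ suc j} i<m root)) (eq (factorial j) f))
  where
  f = factorial-ratio m (m ℕ.+ suc j)
  i<m : m ℕ.∸ suc j ℕ.< m
  i<m = ℕₚ.∸-monoʳ-< {o = 0} (ℕ.s≤s ℕ.z≤n) j<m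
  root : natural (suc j) ℚ.- natural m ℚ.+ natural (m ℕ.∸ suc j) ≡ 0ℚ
  root = ≡.trans (eq₀ (natural (suc j)) (natural m) (natural (m ℕ.∸ suc j)))
    (≡.trans (≡.cong (ℚ._- natural m) (≡.trans (≡.sym (natural-+ (suc j) (m ℕ.∸ suc j))) (≡.cong natural (ℕₚ.m+[n∸m]≡n j<m))))
      (ℚₚ.+-inverseʳ (natural m)))
    where
    eq₀ : ∀ a b c → a ℚ.- b ℚ.+ c ≡ a ℚ.+ c ℚ.- b
    eq₀ = solve-∀ ℚ-ring
  eq : ∀ a f → a ℚ.* (0ℚ ℚ.* f) ≡ 0ℚ
  eq = solve-∀ ℚ-ring

-- For j = m the argument of `rising` is 1 and every factor is positive; the alternating sign of the
-- diagonal comes from `legendre m m` alone.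
legendre-norm-pos : ∀ m n → m ℕ.< n →
  0ℚ ℚ.< sumℚ {n} (λ k → legendre m (toℕ k) ℚ.* Defs.β (suc (toℕ k)) (suc m))
legendre-norm-pos m n m<n = ≡.subst (0ℚ ℚ.<_) (≡.sym (legendre-beta m m n m<n))
  (*-pos (factorial-pos m) (*-pos (rising-pos m z>0) (*-pos (factorial-pos m) (inv-pos (factorial-pos (m ℕ.+ suc m))))))
  where
  z>0 : 0ℚ ℚ.< natural (suc m) ℚ.- natural m
  z>0 = ≡.subst (0ℚ ℚ.<_) (≡.trans (eq (natural m)) (≡.cong (ℚ._- natural m) (≡.sym (natural-suc m)))) (ℚₚ.positive⁻¹ 1ℚ)
    where
    eq : ∀ a → 1ℚ ≡ a ℚ.+ 1ℚ ℚ.- a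
    eq = solve-∀ ℚ-ring

legendre-diagonal-sign : ∀ m → 0ℚ ℚ.< parity-sign m ℚ.* legendre m m
legendre-diagonal-sign m = ≡.subst (0ℚ ℚ.<_)
  (≡.sym (≡.trans (≡.cong (λ s → parity-sign m ℚ.* (s ℚ.* f)) (signed-binomial-diagonal m))
    (≡.trans (≡.sym (ℚₚ.*-assoc (parity-sign m) (parity-sign m) f)) (≡.trans (≡.cong (ℚ._* f) (parity-sign² m)) (ℚₚ.*-identityˡ f)))))
  (*-pos (factorial-pos (m ℕ.+ m)) (inv-pos (factorial-pos m)))
  where f = factorial (m ℕ.+ m) ℚ.* inverse-factorial m

-- Counting

count : ∀ {n} → (Fin n → Bool) → ℕ
count {zero} p = 0
count {suc n} p = if p zero then suc (count (p ∘ suc)) else count (p ∘ suc)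

count-not : ∀ {n} (p : Fin n → Bool) → count p ℕ.+ count (not ∘ p) ≡ n
count-not {zero} p = ≡.refl
count-not {suc n} p with p zero
... | true  = ≡.cong suc (count-not (p ∘ suc))
... | false = ≡.trans (ℕₚ.+-suc _ _) (≡.cong suc (count-not (p ∘ suc)))

count-mono : ∀ {n} (p q : Fin n → Bool) → (∀ i → p i ≡ true → q i ≡ true) → count p ℕ.≤ count q
count-mono {zero} p q p⇒q = ℕ.z≤n
count-mono {suc n} p q p⇒q with p zero | q zero | p⇒q zero
... | true  | true  | _ = ℕ.s≤s (count-mono (p ∘ suc) (q ∘ suc) (p⇒q ∘ suc))
... | true  | false | f = case f ≡.refl of λ ()
... | false | true  | _ = ℕₚ.m≤n⇒m≤1+n (count-mono (p ∘ suc) (q ∘ suc) (p⇒q ∘ suc))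
... | false | false | _ = count-mono (p ∘ suc) (q ∘ suc) (p⇒q ∘ suc)

-- In `signature`, p will mark the positive eigenvalues and q those that are not negative, so
-- tightness excludes the eigenvalue zero.
count-tight : ∀ {n} (p q : Fin n → Bool) → (∀ i → p i ≡ true → q i ≡ true) →
  count q ℕ.≤ count p → ∀ i → q i ≡ true → p i ≡ true
count-tight {suc n} p q p⇒q q≤p i qᵢ with p zero in eqp | q zero in eqq | p⇒q zero
count-tight p q p⇒q q≤p zero qᵢ | true | _ | _ = eqp
count-tight p q p⇒q q≤p (suc i) qᵢ | true | true | _ =
  count-tight (p ∘ suc) (q ∘ suc) (p⇒q ∘ suc) (ℕ.s≤s⁻¹ q≤p) i qᵢ
count-tight p q p⇒q q≤p i qᵢ | true | false | f = case f ≡.refl of λ ()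
count-tight p q p⇒q q≤p i qᵢ | false | true | _ =
  contradiction (count-mono (p ∘ suc) (q ∘ suc) (p⇒q ∘ suc)) (ℕₚ.<⇒≱ q≤p)
count-tight p q p⇒q q≤p zero qᵢ | false | false | _ = case ≡.trans (≡.sym eqq) qᵢ of λ ()
count-tight p q p⇒q q≤p (suc i) qᵢ | false | false | _ =
  count-tight (p ∘ suc) (q ∘ suc) (p⇒q ∘ suc) q≤p i qᵢ

select : ∀ {n} {A : Set} → (Fin n → Bool) → (Fin n → A) → List A
select {zero} p f = []
select {suc n} p f = if p zero then f zero ∷ select (p ∘ suc) (f ∘ suc) else select (p ∘ suc) (f ∘ suc)

length-select : ∀ {n} {A : Set} (p : Fin n → Bool) (f : Fin n → A) → length (select p f) ≡ count p
length-select {zero} p f = ≡.refl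
length-select {suc n} p f with p zero
... | true  = ≡.cong suc (length-select (p ∘ suc) (f ∘ suc))
... | false = length-select (p ∘ suc) (f ∘ suc)

All-select : ∀ {n} {A : Set} {P : A → Set} (p : Fin n → Bool) (f : Fin n → A) →
  All P (select p f) → ∀ i → p i ≡ true → P (f i)
All-select {suc n} p f all i pᵢ with p zero in eq
All-select p f (px ∷ _) zero pᵢ | true = px
All-select p f (_ ∷ all) (suc i) pᵢ | true = All-select (p ∘ suc) (f ∘ suc) all i pᵢ
All-select p f all zero pᵢ | false = case ≡.trans (≡.sym eq) pᵢ of λ ()
All-select p f all (suc i) pᵢ | false = All-select (p ∘ suc) (f ∘ suc) all i pᵢ

alternating : ∀ {n} → Fin n → Bool
alternating zero = true
alternating (suc i) = not (alternating i)

-- Linear algebra over the reals, described axiomatically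

-- Constructively, the order of the reals is total only up to double negation;
-- the fields that produce data are small-or-positive and complete.
record RealStructure : Set₁ where
  infix  4 _≈_ _≤_
  infixl 6 _+_
  infixl 7 _*_
  infix  8 -_
  field
    Carrier : Set
    _≈_ _≤_ : Carrier → Carrier → Set
    _+_ _*_ : Carrier → Carrier → Carrier
    -_      : Carrier → Carrier
    ι       : ℚ → Carrier
    isCommutativeRing : IsCommutativeRing _≈_ _+_ _*_ -_ (ι 0ℚ) (ι 1ℚ)
    ι-+ : ∀ p q → ι (p ℚ.+ q) ≈ ι p + ι q
    ι-* : ∀ p q → ι (p ℚ.* q) ≈ ι p * ι q
    ι-neg : ∀ p → ι (ℚ.- p) ≈ - ι p
    ι-mono : ∀ {p q} → p ℚ.≤ q → ι p ≤ ι q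
    1≰0 : ¬ ι 1ℚ ≤ ι 0ℚ
    ≤-reflexive : ∀ {x y} → x ≈ y → x ≤ y
    ≤-trans : ∀ {x y z} → x ≤ y → y ≤ z → x ≤ z
    ≤-antisym : ∀ {x y} → x ≤ y → y ≤ x → x ≈ y
    ≤-stable : ∀ {x y} → ¬ ¬ x ≤ y → x ≤ y
    ≰⇒≥ : ∀ {x y} → ¬ x ≤ y → y ≤ x
    +-monoˡ-≤ : ∀ z {x y} → x ≤ y → x + z ≤ y + z
    *-nonNeg : ∀ {x y} → ι 0ℚ ≤ x → ι 0ℚ ≤ y → ι 0ℚ ≤ x * y

  -- Positivity carries the inverse as data, so that a pivot found positive can be divided by at
  -- once.
  Pos : Carrier → Set
  Pos x = ∃[ y ] (ι 0ℚ ≤ y × x * y ≈ ι 1ℚ)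

  field
    small-or-positive : ∀ ε → 0ℚ ℚ.< ε → ∀ x → x ≤ ι ε ⊎ Pos x
    archimedean : ∀ {x y} c → (∀ ε → 0ℚ ℚ.< ε → x ≤ y + ι ε * c) → x ≤ y
    -- A cut located up to ε: U r says that r lies above it, L ε r that r lies at
    -- most ε above it.
    complete : (U : Carrier → Set) (L : ℚ → Carrier → Set) →
      (∀ ε → 0ℚ ℚ.< ε → ∀ r → U (ι r) ⊎ L ε (ι r)) →
      (∀ {ε x y} → L ε x → U y → x ≤ y + ι ε) →
      (∃[ l ] (∀ x → U x → l ≤ x)) → (∃[ u ] (∀ x → u ≤ x → U x)) →
      ∃[ c ] (∀ ε → 0ℚ ℚ.< ε →
        (∃[ r ] (U (ι r) × ι r ≤ c + ι ε)) ×
        (∃₂ λ δ r → δ ℚ.≤ ε × L δ (ι r) × c ≤ ι r + ι ε))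

  commutativeRing : CommutativeRing 0ℓ 0ℓ
  commutativeRing = record { isCommutativeRing = isCommutativeRing }

  open CommutativeRing commutativeRing public
    hiding (Carrier; _≈_; _+_; _*_; -_; isCommutativeRing; zero)

-- BirkhoffJamesOrthogonal with every operation a parameter: deciding that two
-- different matrix expressions over the concrete reals agree would unfold their
-- Cauchy proofs, whereas the operations can be exchanged one at a time.
module OverOperations {A : Set} {n : ℕ} (_≈_ _≤_ : A → A → Set) (0# : A) (∑ : (Fin n → A) → A)
  (_≋_ : (Fin n → Fin n → A) → (Fin n → Fin n → A) → Set)
  (_⊞_ _⊠_ : (Fin n → Fin n → A) → (Fin n → Fin n → A) → Fin n → Fin n → A)
  (_⊡_ : A → (Fin n → Fin n → A) → Fin n → Fin n → A)
  (_ᵀ : (Fin n → Fin n → A) → Fin n → Fin n → A)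
  (diag : (Fin n → A) → Fin n → Fin n → A) (𝐈 : Fin n → Fin n → A) where

  Orthogonal : (Fin n → Fin n → A) → Set
  Orthogonal U = (((U ᵀ) ⊠ U) ≋ 𝐈) × ((U ⊠ (U ᵀ)) ≋ 𝐈)

  SingularValues : (Fin n → Fin n → A) → (Fin n → A) → Set
  SingularValues X σ =
    (∀ i → 0# ≤ σ i) ×
    ∃[ U ] ∃[ V ] (Orthogonal U × Orthogonal V × X ≋ ((U ⊠ diag σ) ⊠ (V ᵀ)))

  TraceNorm : (Fin n → Fin n → A) → A → Set
  TraceNorm X r = ∃[ σ ] (SingularValues X σ × r ≈ ∑ σ)

  BirkhoffJamesOrthogonal : (Fin n → Fin n → A) → (Fin n → Fin n → A) → Set
  BirkhoffJamesOrthogonal X Y =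
    ∀ t p q → TraceNorm X p → TraceNorm (X ⊞ (t ⊡ Y)) q → p ≤ q

module LinearAlgebra (F : RealStructure) where
  open RealStructure F public

  private variable
    n : ℕ

  -- Gives the ring solver rational coefficients, whose equality is decidable, so that identities
  -- involving ½ and numerals are solved over the reals.
  ι-morphism : ℚ.+-*-rawRing SolverRing.-Raw-AlmostCommutative⟶ SolverRing.fromCommutativeRing commutativeRing
  ι-morphism = record
    { ⟦_⟧ = ι ; +-homo = ι-+ ; *-homo = ι-* ; -‿homo = ι-neg ; 0-homo = refl ; 1-homo = refl }

  ι-cong? : ∀ p q → Maybe.Maybe (ι p ≈ ι q)
  ι-cong? p q = Maybe.map (λ p≡q → reflexive (≡.cong ι p≡q)) (dec⇒maybe (p ℚₚ.≟ q))

  open RingSolver ℚ.+-*-rawRing (SolverRing.fromCommutativeRing commutativeRing) ι-morphism ι-cong?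
    public using (solve; _:=_; _:+_; _:*_; _:-_; :-_; con)

  -- Order, signs and classical case distinctions

  ≤-refl : ∀ {x} → x ≤ x
  ≤-refl = ≤-reflexive refl

  ≤-poset : Poset 0ℓ 0ℓ 0ℓ
  ≤-poset = record
    { _≤_ = _≤_
    ; isPartialOrder = record
      { isPreorder = record
        { isEquivalence = isEquivalence ; reflexive = ≤-reflexive ; trans = ≤-trans }
      ; antisym = ≤-antisym } }

  open import Relation.Binary.Reasoning.PartialOrder ≤-poset public

  +-mono-≤ : ∀ {x y u v} → x ≤ y → u ≤ v → x + u ≤ y + v
  +-mono-≤ {x} {y} {u} {v} x≤y u≤v = begin
    x + u ≤⟨ +-monoˡ-≤ u x≤y ⟩
    y + u ≈⟨ +-comm y u ⟩
    u + y ≤⟨ +-monoˡ-≤ y u≤v ⟩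
    v + y ≈⟨ +-comm v y ⟩
    y + v ∎

  +-nonNeg : ∀ {x y} → 0# ≤ x → 0# ≤ y → 0# ≤ x + y
  +-nonNeg 0≤x 0≤y = ≤-trans (≤-reflexive (sym (+-identityˡ 0#))) (+-mono-≤ 0≤x 0≤y)

  ≤⇒0≤- : ∀ {x y} → x ≤ y → 0# ≤ y - x
  ≤⇒0≤- {x} x≤y = ≤-trans (≤-reflexive (sym (-‿inverseʳ x))) (+-monoˡ-≤ (- x) x≤y)

  0≤-⇒≤ : ∀ {x y} → 0# ≤ y - x → x ≤ y
  0≤-⇒≤ {x} {y} 0≤y-x = begin
    x           ≈⟨ +-identityˡ x ⟨
    0# + x      ≤⟨ +-monoˡ-≤ x 0≤y-x ⟩
    y - x + x   ≈⟨ solve 2 (λ x y → y :- x :+ x := y) refl x y ⟩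
    y           ∎

  neg-antimono-≤ : ∀ {x y} → x ≤ y → - y ≤ - x
  neg-antimono-≤ {x} {y} x≤y = 0≤-⇒≤ (≤-trans (≤⇒0≤- x≤y) (≤-reflexive
    (solve 2 (λ x y → y :- x := :- x :- :- y) refl x y)))

  ≤0⇒0≤- : ∀ {x} → x ≤ 0# → 0# ≤ - x
  ≤0⇒0≤- {x} x≤0 = ≤-trans (≤⇒0≤- x≤0) (≤-reflexive (+-identityˡ (- x)))

  0≤⇒-≤0 : ∀ {x} → 0# ≤ x → - x ≤ 0#
  0≤⇒-≤0 {x} 0≤x = ≤-trans (neg-antimono-≤ 0≤x) (≤-reflexive (solve 0 (:- con 0ℚ := con 0ℚ) refl))

  *-monoˡ-≤ : ∀ {z} → 0# ≤ z → ∀ {x y} → x ≤ y → z * x ≤ z * y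
  *-monoˡ-≤ {z} 0≤z {x} {y} x≤y = 0≤-⇒≤ (≤-trans (*-nonNeg 0≤z (≤⇒0≤- x≤y)) (≤-reflexive
    (solve 3 (λ x y z → z :* (y :- x) := z :* y :- z :* x) refl x y z)))

  *-monoʳ-≤ : ∀ {z} → 0# ≤ z → ∀ {x y} → x ≤ y → x * z ≤ y * z
  *-monoʳ-≤ {z} 0≤z {x} {y} x≤y = begin
    x * z ≈⟨ *-comm x z ⟩
    z * x ≤⟨ *-monoˡ-≤ 0≤z x≤y ⟩
    z * y ≈⟨ *-comm z y ⟩
    y * z ∎

  ≤-total : ∀ x y → ¬ ¬ (x ≤ y ⊎ y ≤ x)
  ≤-total x y = lem >>= λ where
    (inj₁ x≤y) → return (inj₁ x≤y)
    (inj₂ x≰y) → return (inj₂ (≰⇒≥ x≰y))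

  ≈-stable : ∀ {x y} → ¬ ¬ x ≈ y → x ≈ y
  ≈-stable ¬¬x≈y = ≤-antisym
    (≤-stable (¬¬x≈y >>= λ e → return (≤-reflexive e)))
    (≤-stable (¬¬x≈y >>= λ e → return (≤-reflexive (sym e))))

  square-nonNeg : ∀ x → 0# ≤ x * x
  square-nonNeg x = ≤-stable (≤-total 0# x >>= λ where
    (inj₁ 0≤x) → return (*-nonNeg 0≤x 0≤x)
    (inj₂ x≤0) → return (≤-trans (*-nonNeg (≤0⇒0≤- x≤0) (≤0⇒0≤- x≤0)) (≤-reflexive
      (solve 1 (λ x → :- x :* :- x := x :* x) refl x))))

  0≤1 : 0# ≤ 1#
  0≤1 = ≰⇒≥ 1≰0

  Pos-1 : Pos 1#
  Pos-1 = 1# , 0≤1 , *-identityˡ 1#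

  Pos-cong : ∀ {x y} → x ≈ y → Pos x → Pos y
  Pos-cong x≈y (z , 0≤z , xz≈1) = z , 0≤z , trans (*-congʳ (sym x≈y)) xz≈1

  Pos⇒≰0 : ∀ {x} → Pos x → ¬ x ≤ 0#
  Pos⇒≰0 {x} (y , 0≤y , xy≈1) x≤0 = 1≰0 (begin
    1#     ≈⟨ xy≈1 ⟨
    x * y  ≤⟨ *-monoʳ-≤ 0≤y x≤0 ⟩
    0# * y ≈⟨ zeroˡ y ⟩
    0#     ∎)

  Pos⇒nonNeg : ∀ {x} → Pos x → 0# ≤ x
  Pos⇒nonNeg x-pos = ≰⇒≥ (Pos⇒≰0 x-pos)

  -- If `x` were not positive, `small-or-positive` would put it below every ε, and the Archimedean
  -- property below 0.
  ≰0⇒Pos : ∀ {x} → ¬ x ≤ 0# → ¬ ¬ Pos x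
  ≰0⇒Pos {x} x≰0 ¬pos = x≰0 (archimedean 1# λ ε ε>0 → case small-or-positive ε ε>0 x of λ where
    (inj₁ x≤ε) → ≤-trans x≤ε (≤-reflexive (solve 1 (λ e → e := con 0ℚ :+ e :* con 1ℚ) refl (ι ε)))
    (inj₂ pos) → contradiction pos ¬pos)

  sign : ∀ x → ¬ ¬ (Pos x ⊎ x ≈ 0# ⊎ Pos (- x))
  sign x = lem >>= λ where
    (inj₂ x≰0) → ≰0⇒Pos x≰0 >>= λ p → return (inj₁ p)
    (inj₁ x≤0) → lem >>= λ where
      (inj₂ -x≰0) → ≰0⇒Pos -x≰0 >>= λ p → return (inj₂ (inj₂ p))
      (inj₁ -x≤0) → return (inj₂ (inj₁ (≤-antisym x≤0 (≤-trans (≤0⇒0≤- -x≤0) (≤-reflexive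
        (solve 1 (λ x → :- :- x := x) refl x))))))

  invertible : ∀ {x} → ¬ x ≈ 0# → ¬ ¬ (∃[ y ] x * y ≈ 1#)
  invertible {x} x≉0 = sign x >>= λ where
    (inj₁ (y , _ , xy≈1)) → return (y , xy≈1)
    (inj₂ (inj₁ x≈0)) → contradiction x≈0 x≉0
    (inj₂ (inj₂ (y , _ , -xy≈1))) → return (- y , trans
      (solve 2 (λ x y → x :* :- y := :- x :* y) refl x y) -xy≈1)

  Pos-cancel-zero : ∀ {a x} → Pos a → a * x ≈ 0# → x ≈ 0#
  Pos-cancel-zero {a} {x} (b , _ , ab≈1) ax≈0 = begin-equality
    x           ≈⟨ *-identityˡ x ⟨
    1# * x      ≈⟨ *-congʳ ab≈1 ⟨
    a * b * x   ≈⟨ solve 3 (λ a b x → a :* b :* x := b :* (a :* x)) refl a b x ⟩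
    b * (a * x) ≈⟨ *-congˡ ax≈0 ⟩
    b * 0#      ≈⟨ zeroʳ b ⟩
    0#          ∎

  square≤0⇒≈0 : ∀ {x} → x * x ≤ 0# → x ≈ 0#
  square≤0⇒≈0 {x} xx≤0 = ≈-stable (lem >>= λ where
    (inj₁ x≈0) → return x≈0
    (inj₂ x≉0) → invertible x≉0 >>= λ (y , xy≈1) → ⊥-elim (1≰0 (begin
      1#              ≈⟨ solve 0 (con 1ℚ := con 1ℚ :* con 1ℚ) refl ⟩
      1# * 1#         ≈⟨ *-cong xy≈1 xy≈1 ⟨
      x * y * (x * y) ≈⟨ solve 2 (λ x y → x :* y :* (x :* y) := y :* y :* (x :* x)) refl x y ⟩
      y * y * (x * x) ≤⟨ *-monoˡ-≤ (square-nonNeg y) xx≤0 ⟩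
      y * y * 0#      ≈⟨ zeroʳ (y * y) ⟩
      0#              ∎)))

  -- Finite sums, vectors and quadratic forms

  open SemiringSum semiring public
    using (sum; ∑-distrib-+; ∑-comm; *-distribˡ-sum; *-distribʳ-sum; sum-remove; sum-replicate-zero)
    renaming (sum-cong-≋ to sum-cong)

  Vec : ℕ → Set
  Vec n = Fin n → Carrier

  Mat : ℕ → Set
  Mat n = Fin n → Fin n → Carrier

  sum-zero : {x : Vec n} → (∀ i → x i ≈ 0#) → sum x ≈ 0#
  sum-zero {n} x≈0 = trans (sum-cong x≈0) (sum-replicate-zero n)

  sum-neg : (x : Vec n) → sum (λ i → - x i) ≈ - sum x
  sum-neg {n} x = begin-equality
    sum (λ i → - x i)       ≈⟨ sum-cong (λ i → solve 1 (λ x → :- x := :- con 1ℚ :* x) refl (x i)) ⟩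
    sum (λ i → - 1# * x i)  ≈⟨ *-distribˡ-sum (- 1#) x ⟨
    - 1# * sum x            ≈⟨ solve 1 (λ x → :- con 1ℚ :* x := :- x) refl (sum x) ⟩
    - sum x                 ∎

  sum-mono-≤ : {x y : Vec n} → (∀ i → x i ≤ y i) → sum x ≤ sum y
  sum-mono-≤ {zero} x≤y = ≤-refl
  sum-mono-≤ {suc n} x≤y = +-mono-≤ (x≤y zero) (sum-mono-≤ (x≤y ∘ suc))

  sum-nonNeg : {x : Vec n} → (∀ i → 0# ≤ x i) → 0# ≤ sum x
  sum-nonNeg {n} {x} 0≤x = ≤-trans (≤-reflexive (sym (sum-zero {n} λ _ → refl))) (sum-mono-≤ {n} {λ _ → 0#} {x} 0≤x)

  term≤sum : {x : Vec n} → (∀ i → 0# ≤ x i) → ∀ i → x i ≤ sum x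
  term≤sum {n} {x} 0≤x zero = begin
    x zero                  ≈⟨ +-identityʳ (x zero) ⟨
    x zero + 0#             ≤⟨ +-mono-≤ ≤-refl (sum-nonNeg (0≤x ∘ suc)) ⟩
    x zero + sum (x ∘ suc)  ∎
  term≤sum {n} {x} 0≤x (suc i) = begin
    x (suc i)               ≈⟨ +-identityˡ (x (suc i)) ⟨
    0# + x (suc i)          ≤⟨ +-mono-≤ (0≤x zero) (term≤sum (0≤x ∘ suc) i) ⟩
    x zero + sum (x ∘ suc)  ∎

  dot : Vec n → Vec n → Carrier
  dot x y = sum λ i → x i * y i

  infixr 8 _·_
  _·_ : Mat n → Vec n → Vec n
  (M · x) i = dot (M i) x

  form : Mat n → Vec n → Carrier
  form M x = dot x (M · x)

  Symmetric : Mat n → Set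
  Symmetric M = ∀ i j → M i j ≈ M j i

  dot-cong : {x y u v : Vec n} → (∀ i → x i ≈ y i) → (∀ i → u i ≈ v i) → dot x u ≈ dot y v
  dot-cong x≈y u≈v = sum-cong λ i → *-cong (x≈y i) (u≈v i)

  dot-comm : (x y : Vec n) → dot x y ≈ dot y x
  dot-comm x y = sum-cong λ i → *-comm (x i) (y i)

  dot-combine : ∀ (x u v : Vec n) c → dot x (λ i → u i + c * v i) ≈ dot x u + c * dot x v
  dot-combine x u v c = begin-equality
    dot x (λ i → u i + c * v i)
      ≈⟨ sum-cong (λ i → solve 4 (λ x u v c → x :* (u :+ c :* v) := x :* u :+ c :* (x :* v)) refl (x i) (u i) (v i) c) ⟩
    sum (λ i → x i * u i + c * (x i * v i))
      ≈⟨ ∑-distrib-+ (λ i → x i * u i) (λ i → c * (x i * v i)) ⟩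
    dot x u + sum (λ i → c * (x i * v i))
      ≈⟨ +-congˡ (*-distribˡ-sum c (λ i → x i * v i)) ⟨
    dot x u + c * dot x v ∎

  dot-combineˡ : ∀ (x u v : Vec n) c → dot (λ i → u i + c * v i) x ≈ dot u x + c * dot v x
  dot-combineˡ x u v c = begin-equality
    dot (λ i → u i + c * v i) x  ≈⟨ dot-comm (λ i → u i + c * v i) x ⟩
    dot x (λ i → u i + c * v i)  ≈⟨ dot-combine x u v c ⟩
    dot x u + c * dot x v        ≈⟨ +-cong (dot-comm x u) (*-congˡ (dot-comm x v)) ⟩
    dot u x + c * dot v x        ∎

  dot-scaleʳ : ∀ (x v : Vec n) c → dot x (λ i → c * v i) ≈ c * dot x v
  dot-scaleʳ x v c = begin-equality
    dot x (λ i → c * v i)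
      ≈⟨ sum-cong (λ i → solve 3 (λ x v c → x :* (c :* v) := c :* (x :* v)) refl (x i) (v i) c) ⟩
    sum (λ i → c * (x i * v i))
      ≈⟨ *-distribˡ-sum c (λ i → x i * v i) ⟨
    c * dot x v ∎

  dot-zeroʳ : ∀ (x : Vec n) {y} → (∀ i → y i ≈ 0#) → dot x y ≈ 0#
  dot-zeroʳ x y≈0 = sum-zero λ i → trans (*-congˡ (y≈0 i)) (zeroʳ (x i))

  dot-nonNeg : (x : Vec n) → 0# ≤ dot x x
  dot-nonNeg x = sum-nonNeg λ i → square-nonNeg (x i)

  1≤dot : (x : Vec n) (i : Fin n) → x i ≈ 1# → 1# ≤ dot x x
  1≤dot x i xᵢ≈1 = begin
    1#        ≈⟨ *-identityˡ 1# ⟨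
    1# * 1#   ≈⟨ *-cong xᵢ≈1 xᵢ≈1 ⟨
    x i * x i ≤⟨ term≤sum (λ j → square-nonNeg (x j)) i ⟩
    dot x x   ∎

  -- Symmetric Gaussian elimination

  module Split {n} (M : Mat (suc n)) (sym-M : Symmetric M) where
    a : Carrier
    a = M zero zero

    b : Vec n
    b j = M zero (suc j)

    minor : Mat n
    minor i j = M (suc i) (suc j)

    tail-· : ∀ x i → (M · x) (suc i) ≈ (minor · (x ∘ suc)) i + x zero * b i
    tail-· x i = trans (+-comm _ _) (+-congˡ (trans (*-comm _ _) (*-congˡ (sym-M (suc i) zero))))

    form-split : ∀ x → let β = dot b (x ∘ suc) in
      form M x ≈ x zero * (a * x zero + β) + (form minor (x ∘ suc) + x zero * β)
    form-split x = +-congˡ (begin-equality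
      dot x′ (λ i → (M · x) (suc i))
        ≈⟨ dot-cong {x = x′} (λ _ → refl) (tail-· x) ⟩
      dot x′ (λ i → (minor · x′) i + x zero * b i)
        ≈⟨ dot-combine x′ (minor · x′) b (x zero) ⟩
      form minor x′ + x zero * dot x′ b
        ≈⟨ +-congˡ (*-congˡ (dot-comm x′ b)) ⟩
      form minor x′ + x zero * dot b x′ ∎)
      where x′ = x ∘ suc

  module Pivot {n} (M : Mat (suc n)) (sym-M : Symmetric M)
               (y : Carrier) (ay≈1 : M zero zero * y ≈ 1#) where
    open Split M sym-M public

    schur : Mat n
    schur i j = minor i j + - y * b i * b j

    schur-symmetric : Symmetric schur
    schur-symmetric i j = +-cong (sym-M (suc i) (suc j))
      (solve 3 (λ y u v → :- y :* u :* v := :- y :* v :* u) refl y (b i) (b j))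

    schur-· : ∀ x i → (schur · x) i ≈ (minor · x) i + - y * dot b x * b i
    schur-· x i = trans (dot-combineˡ x (minor i) b (- y * b i))
      (+-congˡ (solve 3 (λ y u v → :- y :* u :* v := :- y :* v :* u) refl y (b i) (dot b x)))

    form-schur : ∀ x → form schur x ≈ form minor x + - y * dot b x * dot b x
    form-schur x = begin-equality
      form schur x
        ≈⟨ dot-cong {x = x} (λ _ → refl) (schur-· x) ⟩
      dot x (λ i → (minor · x) i + - y * dot b x * b i)
        ≈⟨ dot-combine x (minor · x) b (- y * dot b x) ⟩
      form minor x + - y * dot b x * dot x b
        ≈⟨ +-congˡ (*-congˡ (dot-comm x b)) ⟩
      form minor x + - y * dot b x * dot b x ∎

    complete-square : ∀ x → let z = x zero + y * dot b (x ∘ suc) in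
      form M x ≈ a * (z * z) + form schur (x ∘ suc)
    complete-square x = begin-equality
      form M x
        ≈⟨ form-split x ⟩
      x₀ * (a * x₀ + β) + (form minor x′ + x₀ * β)
        -- The solver does not know that a y = 1, so the error term with the factor 1 - a y is
        -- written out and removed in the next step.
        ≈⟨ solve 5 (λ x₀ a β m y →
             x₀ :* (a :* x₀ :+ β) :+ (m :+ x₀ :* β) :=
             a :* ((x₀ :+ y :* β) :* (x₀ :+ y :* β)) :+ (m :+ :- y :* β :* β)
               :+ (con 1ℚ :- a :* y) :* (x₀ :* β :+ x₀ :* β :+ y :* β :* β))
             refl x₀ a β (form minor x′) y ⟩
      a * (z * z) + (form minor x′ + - y * β * β) + (1# - a * y) * (x₀ * β + x₀ * β + y * β * β)
        ≈⟨ +-cong (+-congˡ (sym (form-schur x′))) (trans (*-congʳ (trans (+-congˡ (-‿cong ay≈1)) (-‿inverseʳ 1#))) (zeroˡ _)) ⟩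
      a * (z * z) + form schur x′ + 0#
        ≈⟨ +-identityʳ _ ⟩
      a * (z * z) + form schur x′ ∎
      where
      x₀ = x zero
      x′ = x ∘ suc
      β = dot b x′
      z = x₀ + y * β

    -- The first coordinate is the one that annihilates the square in `complete-square`.
    extend : Vec n → Vec (suc n)
    extend x = - (y * dot b x) ◂ x

    form-extend : ∀ x → form M (extend x) ≈ form schur x
    form-extend x = trans (complete-square (extend x)) (solve 3
      (λ a c s → a :* ((:- c :+ c) :* (:- c :+ c)) :+ s := s) refl a (y * dot b x) (form schur x))

    null-extend : ∀ x → (∀ i → (schur · x) i ≈ 0#) → ∀ i → (M · extend x) i ≈ 0#
    null-extend x Sx≈0 zero = begin-equality
      a * - (y * β) + β    ≈⟨ solve 3 (λ a y β → a :* :- (y :* β) :+ β := (con 1ℚ :- a :* y) :* β) refl a y β ⟩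
      (1# - a * y) * β     ≈⟨ *-congʳ (trans (+-congˡ (-‿cong ay≈1)) (-‿inverseʳ 1#)) ⟩
      0# * β               ≈⟨ zeroˡ β ⟩
      0#                   ∎
      where β = dot b x
    null-extend x Sx≈0 (suc i) = begin-equality
      (M · extend x) (suc i)                    ≈⟨ tail-· (extend x) i ⟩
      (minor · x) i + - (y * dot b x) * b i     ≈⟨ +-congˡ (solve 3 (λ y β b → :- (y :* β) :* b := :- y :* β :* b) refl y (dot b x) (b i)) ⟩
      (minor · x) i + - y * dot b x * b i       ≈⟨ schur-· x i ⟨
      (schur · x) i                             ≈⟨ Sx≈0 i ⟩
      0#                                        ∎

  e₀ : Vec (suc n)
  e₀ = 1# ◂ λ _ → 0#

  dot-e₀ : (x : Vec (suc n)) → dot x e₀ ≈ x zero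
  dot-e₀ x = trans (+-cong (*-identityʳ (x zero)) (dot-zeroʳ (x ∘ suc) λ _ → refl)) (+-identityʳ (x zero))

  form-e₀ : (M : Mat (suc n)) → form M e₀ ≈ M zero zero
  form-e₀ M = trans (dot-comm e₀ (M · e₀)) (trans (dot-e₀ (M · e₀)) (dot-e₀ (M zero)))

  -- Gaussian elimination: as soon as a pivot is small, it exhibits an
  -- (almost) null direction; otherwise the form is a sum of squares.
  nonNeg-or-small : ∀ ε → 0ℚ ℚ.< ε → (M : Mat n) → Symmetric M →
    (∀ x → 0# ≤ form M x) ⊎ (∃₂ λ x i → x i ≈ 1# × form M x ≤ ι ε * dot x x)
  nonNeg-or-small {zero} ε ε>0 M sym-M = inj₁ λ _ → ≤-refl
  nonNeg-or-small {suc n} ε ε>0 M sym-M = case small-or-positive ε ε>0 (M zero zero) of λ where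
    (inj₁ a≤ε) → inj₂ (e₀ {n} , zero , refl , (begin
      form M e₀         ≈⟨ form-e₀ M ⟩
      M zero zero       ≤⟨ a≤ε ⟩
      ι ε               ≈⟨ *-identityʳ (ι ε) ⟨
      ι ε * 1#          ≈⟨ *-congˡ (dot-e₀ {n} e₀) ⟨
      ι ε * dot (e₀ {n}) e₀   ∎))
    (inj₂ (y , 0≤y , ay≈1)) → let open Pivot M sym-M y ay≈1 in
      case nonNeg-or-small ε ε>0 schur schur-symmetric of λ where
        (inj₁ 0≤S) → inj₁ λ x → ≤-trans
          (+-nonNeg (*-nonNeg (Pos⇒nonNeg (y , 0≤y , ay≈1)) (square-nonNeg _)) (0≤S (x ∘ suc)))
          (≤-reflexive (sym (complete-square x)))
        (inj₂ (x , i , xᵢ≈1 , small)) → inj₂ (extend x , suc i , xᵢ≈1 , (begin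
          form M (extend x)   ≈⟨ form-extend x ⟩
          form schur x        ≤⟨ small ⟩
          ι ε * dot x x       ≤⟨ *-monoˡ-≤ (ι-mono (ℚₚ.<⇒≤ ε>0)) (begin
            dot x x                   ≈⟨ +-identityˡ (dot x x) ⟨
            0# + dot x x              ≤⟨ +-monoˡ-≤ (dot x x) (square-nonNeg (extend x zero)) ⟩
            dot (extend x) (extend x) ∎) ⟩
          ι ε * dot (extend x) (extend x) ∎))

  -- The largest eigenvalue and its eigenvector

  diag : Vec n → Mat n
  diag d i j = if does (i Finₚ.≟ j) then d i else 0#

  diag-· : (d x : Vec n) → ∀ i → (diag d · x) i ≈ d i * x i
  diag-· d x zero = trans (+-congˡ (sum-zero λ j → zeroˡ (x (suc j)))) (+-identityʳ _)
  diag-· d x (suc i) = trans (+-cong (zeroˡ (x zero)) (diag-· (d ∘ suc) (x ∘ suc) i)) (+-identityˡ _)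

  diag-symmetric : (d : Vec n) → Symmetric (diag d)
  diag-symmetric d zero zero = refl
  diag-symmetric d zero (suc j) = refl
  diag-symmetric d (suc i) zero = refl
  diag-symmetric d (suc i) (suc j) = diag-symmetric (d ∘ suc) i j

  shifted : Carrier → Mat n → Mat n
  shifted c A i j = diag (λ _ → c) i j + - 1# * A i j

  shifted-symmetric : ∀ c {A : Mat n} → Symmetric A → Symmetric (shifted c A)
  shifted-symmetric c sym-A i j = +-cong (diag-symmetric (λ _ → c) i j) (*-congˡ (sym-A i j))

  shifted-· : ∀ c (A : Mat n) x i → (shifted c A · x) i ≈ c * x i + - 1# * (A · x) i
  shifted-· c A x i = trans (dot-combineˡ x (diag (λ _ → c) i) (A i) (- 1#)) (+-congʳ (diag-· (λ _ → c) x i))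

  form-shifted : ∀ c (A : Mat n) x → form (shifted c A) x ≈ c * dot x x - form A x
  form-shifted c A x = begin-equality
    form (shifted c A) x
      ≈⟨ dot-cong {x = x} (λ _ → refl) (shifted-· c A x) ⟩
    dot x (λ i → c * x i + - 1# * (A · x) i)
      ≈⟨ dot-combine x (λ i → c * x i) (A · x) (- 1#) ⟩
    dot x (λ i → c * x i) + - 1# * form A x
      ≈⟨ +-cong (dot-scaleʳ x x c) (solve 1 (λ f → :- con 1ℚ :* f := :- f) refl (form A x)) ⟩
    c * dot x x - form A x ∎

  -- Entrywise u a v ≤ a²u² + v², because the difference is half a sum of squares; both squares are
  -- at most |x|². No absolute value is needed.
  form-bounded : (A : Mat n) → ∃[ R ] (0# ≤ R × ∀ x → form A x ≤ R * dot x x)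
  form-bounded {n} A = sum (λ i → sum (λ j → bound i j))
    , sum-nonNeg (λ i → sum-nonNeg (λ j → +-nonNeg (square-nonNeg (A i j)) 0≤1))
    , λ x → begin
    form A x
      ≈⟨ sum-cong (λ i → *-distribˡ-sum (x i) (λ j → A i j * x j)) ⟩
    sum (λ i → sum λ j → x i * (A i j * x j))
      ≤⟨ sum-mono-≤ (λ i → sum-mono-≤ (entry x i)) ⟩
    sum (λ i → sum λ j → bound i j * dot x x)
      ≈⟨ sum-cong (λ i → *-distribʳ-sum (dot x x) (bound i)) ⟨
    sum (λ i → sum (bound i) * dot x x)
      ≈⟨ *-distribʳ-sum (dot x x) (λ i → sum (bound i)) ⟨
    sum (λ i → sum (bound i)) * dot x x ∎
    where
    bound : Mat n
    bound i j = A i j * A i j + 1#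
    entry : ∀ x i j → x i * (A i j * x j) ≤ bound i j * dot x x
    entry x i j = 0≤-⇒≤ (≤-trans
      (+-nonNeg (*-nonNeg (square-nonNeg (A i j)) (≤⇒0≤- (term≤sum (λ k → square-nonNeg (x k)) i)))
        (+-nonNeg (≤⇒0≤- (term≤sum (λ k → square-nonNeg (x k)) j))
          (*-nonNeg (ι-mono (ℚₚ.nonNegative⁻¹ ½))
            (+-nonNeg (square-nonNeg (x i * A i j - x j))
              (+-nonNeg (square-nonNeg (x i * A i j)) (square-nonNeg (x j)))))))
      (≤-reflexive (solve 4 (λ u a v D →
        a :* a :* (D :- u :* u) :+ (D :- v :* v :+ con ½ :* ((u :* a :- v) :* (u :* a :- v)
          :+ (u :* a :* (u :* a) :+ v :* v)))
        := (a :* a :+ con 1ℚ) :* D :- u :* (a :* v)) refl (x i) (A i j) (x j) (dot x x))))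

  -- The infimum of the `r` with `r` I - A positive semidefinite is the maximum of the Rayleigh
  -- quotient. The coordinate `x i ≈ 1` keeps the ε-null vector away from 0 without dividing by its
  -- length.
  top-eigenvalue : (A : Mat (suc n)) → Symmetric A →
    ∃[ c ] ((∀ x → 0# ≤ form (shifted c A) x) ×
      (∀ ε → 0ℚ ℚ.< ε → ∃₂ λ x i → x i ≈ 1# × form (shifted c A) x ≤ ι ε * dot x x))
  top-eigenvalue {n} A sym-A = c , upper , lower
    where
    U : Carrier → Set
    U c = ∀ x → 0# ≤ form (shifted c A) x
    L : ℚ → Carrier → Set
    L ε c = ∃₂ λ x i → x i ≈ 1# × form (shifted c A) x ≤ ι ε * dot x x

    -- Passing from d to c adds (c - d)|x|² to a nonnegative form, and the result is at most ε|x|²;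
    -- as |x|² ≥ 1, this forces c - d ≤ ε.
    separated : ∀ {ε c d} → L ε c → U d → c ≤ d + ι ε
    separated {ε} {c} {d} (x , i , xᵢ≈1 , small) 0≤D = ≤-stable (≤-total (c - (d + ι ε)) 0# >>= λ where
      (inj₁ ≤0) → return (0≤-⇒≤ (≤-trans (≤0⇒0≤- ≤0) (≤-reflexive
        (solve 2 (λ c d → :- (c :- d) := d :- c) refl c (d + ι ε)))))
      (inj₂ 0≤) → return (0≤-⇒≤ (≤-trans (≤0⇒0≤- (begin
        c - (d + ι ε)               ≈⟨ *-identityʳ _ ⟨
        (c - (d + ι ε)) * 1#        ≤⟨ *-monoˡ-≤ 0≤ (1≤dot x i xᵢ≈1) ⟩
        (c - (d + ι ε)) * dot x x   ≈⟨ solve 5 (λ c d e D f →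
          (c :- (d :+ e)) :* D := (c :* D :- f) :- e :* D :- (d :* D :- f)) refl c d (ι ε) (dot x x) (form A x) ⟩
        (c * dot x x - form A x) - ι ε * dot x x - (d * dot x x - form A x)
          ≈⟨ +-cong (+-congʳ (form-shifted c A x)) (-‿cong (form-shifted d A x)) ⟨
        form (shifted c A) x - ι ε * dot x x - form (shifted d A) x
          ≤⟨ +-mono-≤ (+-monoˡ-≤ _ small) (0≤⇒-≤0 (0≤D x)) ⟩
        ι ε * dot x x - ι ε * dot x x + 0# ≈⟨ solve 1 (λ e → e :- e :+ con 0ℚ := con 0ℚ) refl (ι ε * dot x x) ⟩
        0# ∎)) (≤-reflexive (solve 2 (λ c d → :- (c :- d) := d :- c) refl c (d + ι ε))))))

    located = complete U L
      (λ ε ε>0 r → nonNeg-or-small ε ε>0 (shifted (ι r) A) (shifted-symmetric (ι r) sym-A))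
      (λ {ε} {c} {d} → separated {ε} {c} {d})
      (A zero zero , λ c 0≤ → 0≤-⇒≤ (begin
        0#                                        ≤⟨ 0≤ e₀ ⟩
        form (shifted c A) e₀                     ≈⟨ form-e₀ (shifted c A) ⟩
        c + - 1# * A zero zero                    ≈⟨ solve 2 (λ c a → c :+ :- con 1ℚ :* a := c :- a) refl c (A zero zero) ⟩
        c - A zero zero                           ∎))
      (let (R , _ , bound) = form-bounded A in R , λ c R≤c x → begin
        0#                       ≤⟨ ≤⇒0≤- (≤-trans (bound x) (*-monoʳ-≤ (dot-nonNeg x) R≤c)) ⟩
        c * dot x x - form A x   ≈⟨ form-shifted c A x ⟨
        form (shifted c A) x     ∎)

    c = proj₁ located

    upper : U c
    upper x = begin
      0#                       ≤⟨ ≤⇒0≤- (archimedean (dot x x) λ ε ε>0 →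
        let (r , 0≤r , r≤c) = proj₁ (proj₂ located ε ε>0) in begin
          form A x                       ≤⟨ 0≤-⇒≤ (≤-trans (0≤r x) (≤-reflexive (form-shifted (ι r) A x))) ⟩
          ι r * dot x x                  ≤⟨ *-monoʳ-≤ (dot-nonNeg x) r≤c ⟩
          (c + ι ε) * dot x x            ≈⟨ distribʳ (dot x x) c (ι ε) ⟩
          c * dot x x + ι ε * dot x x    ∎) ⟩
      c * dot x x - form A x   ≈⟨ form-shifted c A x ⟨
      form (shifted c A) x     ∎

    lower : ∀ ε → 0ℚ ℚ.< ε → L ε c
    lower ε ε>0 = x , i , xᵢ≈1 , (begin
      form (shifted c A) x               ≈⟨ form-shifted c A x ⟩
      c * dot x x - form A x             ≤⟨ +-monoˡ-≤ _ (*-monoʳ-≤ (dot-nonNeg x) c≤) ⟩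
      (ι r + ι η) * dot x x - form A x   ≈⟨ solve 4 (λ r e D f → (r :+ e) :* D :- f := (r :* D :- f) :+ e :* D) refl (ι r) (ι η) (dot x x) (form A x) ⟩
      (ι r * dot x x - form A x) + ι η * dot x x ≈⟨ +-congʳ (form-shifted (ι r) A x) ⟨
      form (shifted (ι r) A) x + ι η * dot x x   ≤⟨ +-monoˡ-≤ _ (≤-trans small (*-monoʳ-≤ (dot-nonNeg x) (ι-mono δ≤η))) ⟩
      ι η * dot x x + ι η * dot x x      ≈⟨ distribʳ (dot x x) (ι η) (ι η) ⟨
      (ι η + ι η) * dot x x              ≈⟨ *-congʳ (trans (+-cong (ι-* ½ ε) (ι-* ½ ε))
                                            (solve 1 (λ e → con ½ :* e :+ con ½ :* e := e) refl (ι ε))) ⟩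
      ι ε * dot x x                      ∎)
      where
      -- One half of ε pays for the distance from r to c, the other for the defect of the form at r.
      η = ½ ℚ.* ε
      found = proj₂ (proj₂ located η (half-pos ε>0))
      δ = proj₁ found
      r = proj₁ (proj₂ found)
      δ≤η = proj₁ (proj₂ (proj₂ found))
      small-r = proj₁ (proj₂ (proj₂ (proj₂ found)))
      c≤ = proj₂ (proj₂ (proj₂ (proj₂ found)))
      x = proj₁ small-r
      i = proj₁ (proj₂ small-r)
      xᵢ≈1 = proj₁ (proj₂ (proj₂ small-r))
      small = proj₂ (proj₂ (proj₂ small-r))

  -- With a zero corner, x ↦ form M (t ◂ b) is affine in t, so it can only
  -- stay nonnegative if b vanishes.
  zero-corner : (M : Mat (suc n)) → Symmetric M → (∀ x → 0# ≤ form M x) →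
    M zero zero ≈ 0# → ∀ i → (M · e₀) i ≈ 0#
  zero-corner M sym-M 0≤M a≈0 zero = trans (dot-e₀ (M zero)) a≈0
  zero-corner {n} M sym-M 0≤M a≈0 (suc i) = trans (dot-e₀ (M (suc i))) (trans (sym-M (suc i) zero)
    (square≤0⇒≈0 (≤-trans (term≤sum (λ j → square-nonNeg (b j)) i) |b|²≤0)))
    where
    open Split M sym-M
    β = dot b b
    f = form minor b
    affine : ∀ t → 0# ≤ (t + t) * β + f
    affine t = begin
      0#                                ≤⟨ 0≤M (t ◂ b) ⟩
      form M (t ◂ b)                    ≈⟨ form-split (t ◂ b) ⟩
      t * (a * t + β) + (f + t * β)     ≈⟨ +-congʳ (*-congˡ (+-congʳ (*-congʳ a≈0))) ⟩
      t * (0# * t + β) + (f + t * β)    ≈⟨ solve 3 (λ t β f → t :* (con 0ℚ :* t :+ β) :+ (f :+ t :* β) := (t :+ t) :* β :+ f) refl t β f ⟩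
      (t + t) * β + f                   ∎
    |b|²≤0 : β ≤ 0#
    |b|²≤0 = ≤-stable (lem >>= λ where
      (inj₁ β≤0) → return β≤0
      (inj₂ β≰0) → ≰0⇒Pos β≰0 >>= λ (y , _ , βy≈1) → ⊥-elim (1≰0 (begin
        1#                     ≤⟨ 0≤-⇒≤ (begin
          -- At t = -(f + 1)/β the affine function equals -f - 2, and at 0 it equals f; the two
          -- values add up to -2.
          0#                   ≤⟨ +-nonNeg (affine 0#) (affine (- (f + 1#) * y)) ⟩
          (0# + 0#) * β + f + ((- (f + 1#) * y + - (f + 1#) * y) * β + f)
            ≈⟨ solve 3 (λ β f y →
               (con 0ℚ :+ con 0ℚ) :* β :+ f :+ ((:- (f :+ con 1ℚ) :* y :+ :- (f :+ con 1ℚ) :* y) :* β :+ f)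
               := (con 1ℚ :- β :* y) :* (con 1ℚ :+ con 1ℚ) :* (f :+ con 1ℚ) :+ (:- con 1ℚ :- con 1ℚ)) refl β f y ⟩
          (1# - β * y) * (1# + 1#) * (f + 1#) + (- 1# - 1#)
            ≈⟨ +-congʳ (trans (*-congʳ (trans (*-congʳ (trans (+-congˡ (-‿cong βy≈1)) (-‿inverseʳ 1#))) (zeroˡ _))) (zeroˡ _)) ⟩
          0# + (- 1# - 1#)      ≈⟨ +-identityˡ _ ⟩
          - 1# - 1#            ∎) ⟩
        - 1#                   ≤⟨ 0≤⇒-≤0 0≤1 ⟩
        0#                     ∎)))

  -- Replaces compactness: a positive semidefinite form without a null vector is bounded below on
  -- the sphere. A zero corner gives a null vector outright; otherwise either alternative lifts from
  -- the Schur complement.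
  null-or-coercive : (M : Mat n) → Symmetric M → (∀ x → 0# ≤ form M x) →
    ¬ ¬ ((∃₂ λ x i → x i ≈ 1# × (∀ j → (M · x) j ≈ 0#)) ⊎
         (∃[ C ] (0# ≤ C × ∀ x → dot x x ≤ C * form M x)))
  null-or-coercive {zero} M sym-M 0≤M = return (inj₂ (0# , ≤-refl , λ _ → ≤-reflexive (sym (zeroˡ 0#))))
  null-or-coercive {suc n} M sym-M 0≤M = lem >>= λ where
    (inj₁ a≤0) → return (inj₁ (e₀ {n} , zero , refl , zero-corner M sym-M 0≤M (≤-antisym a≤0
      (≤-trans (0≤M e₀) (≤-reflexive (form-e₀ M))))))
    (inj₂ a≰0) → ≰0⇒Pos a≰0 >>= λ (y , 0≤y , ay≈1) →
      let open Pivot M sym-M y ay≈1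
          0≤schur : ∀ x → 0# ≤ form schur x
          0≤schur x = ≤-trans (0≤M (extend x)) (≤-reflexive (form-extend x))
      in null-or-coercive schur schur-symmetric 0≤schur >>= λ where
        (inj₁ (x , i , xᵢ≈1 , Sx≈0)) → return (inj₁ (extend x , suc i , xᵢ≈1 , null-extend x Sx≈0))
        (inj₂ (C , 0≤C , coercive)) →
          -- From x₀ = z - y β follows x₀² ≤ 2z² + 2y²β², and β² ≤ R|x′|²; together with |x′|² this
          -- gives the factor `K`. The z² part costs 2y, since y (a z²) = z².
          let (R , 0≤R , bound) = form-bounded (λ i j → b i * b j)
              K = (1# + 1#) * (y * y) * R + 1#
              0≤2 = +-nonNeg 0≤1 0≤1
              0≤K : 0# ≤ K
              0≤K = +-nonNeg (*-nonNeg (*-nonNeg 0≤2 (square-nonNeg y)) 0≤R) 0≤1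
          in return (inj₂ ((1# + 1#) * y + K * C , +-nonNeg (*-nonNeg 0≤2 0≤y) (*-nonNeg 0≤K 0≤C) , λ x →
          let x₀ = x zero
              x′ = x ∘ suc
              β = dot b x′
              z = x₀ + y * β
              s = form schur x′
              D = dot x′ x′
              form-outer : form (λ i j → b i * b j) x′ ≈ β * β
              form-outer = begin-equality
                dot x′ (λ i → sum λ j → b i * b j * x′ j)
                  ≈⟨ dot-cong {x = x′} (λ _ → refl) (λ i → trans
                       (sum-cong λ j → *-assoc (b i) (b j) (x′ j))
                       (trans (sym (*-distribˡ-sum (b i) (λ j → b j * x′ j))) (*-comm (b i) β))) ⟩
                dot x′ (λ i → β * b i)   ≈⟨ dot-scaleʳ x′ b β ⟩
                β * dot x′ b             ≈⟨ *-congˡ (dot-comm x′ b) ⟩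
                β * β                    ∎
              ββ≤RD : β * β ≤ R * D
              ββ≤RD = ≤-trans (≤-reflexive (sym form-outer)) (bound x′)
          in begin
            x₀ * x₀ + D
              ≤⟨ 0≤-⇒≤ (≤-trans (+-nonNeg (square-nonNeg (z + y * β))
                   (*-nonNeg (*-nonNeg 0≤2 (square-nonNeg y)) (≤⇒0≤- ββ≤RD)))
                 (≤-reflexive (solve 5 (λ x₀ y β R D →
                   (x₀ :+ y :* β :+ y :* β) :* (x₀ :+ y :* β :+ y :* β)
                     :+ (con 1ℚ :+ con 1ℚ) :* (y :* y) :* (R :* D :- β :* β)
                   := (con 1ℚ :+ con 1ℚ) :* ((x₀ :+ y :* β) :* (x₀ :+ y :* β))
                      :+ ((con 1ℚ :+ con 1ℚ) :* (y :* y) :* R :+ con 1ℚ) :* D :- (x₀ :* x₀ :+ D))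
                   refl x₀ y β R D))) ⟩
            (1# + 1#) * (z * z) + K * D
              ≤⟨ +-mono-≤ ≤-refl (*-monoˡ-≤ 0≤K (coercive x′)) ⟩
            (1# + 1#) * (z * z) + K * (C * s)
              ≤⟨ 0≤-⇒≤ (≤-trans (+-nonNeg (*-nonNeg (*-nonNeg 0≤2 0≤y) (0≤schur x′))
                   (*-nonNeg (*-nonNeg 0≤K 0≤C) (*-nonNeg (Pos⇒nonNeg (y , 0≤y , ay≈1)) (square-nonNeg z))))
                 (≤-reflexive (trans
                   (solve 6 (λ y s K C a z² →
                   (con 1ℚ :+ con 1ℚ) :* y :* s :+ K :* C :* (a :* z²)
                   := ((con 1ℚ :+ con 1ℚ) :* y :+ K :* C) :* (a :* z² :+ s)
                      :- ((con 1ℚ :+ con 1ℚ) :* (a :* y :* z²) :+ K :* (C :* s)))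
                   refl y s K C a (z * z))
                   (+-congˡ (-‿cong (+-congʳ (*-congˡ (trans (*-congʳ ay≈1) (*-identityˡ (z * z)))))))))) ⟩
            ((1# + 1#) * y + K * C) * (a * (z * z) + s)
              ≈⟨ *-congˡ (complete-square x) ⟨
            ((1# + 1#) * y + K * C) * form M x ∎))

  -- At the top of the spectrum coercivity is impossible: applied to the ε-null vectors it would
  -- give 1 ≤ C ε for every ε. Hence there is an exact null vector of c I - A.
  eigenvector : (A : Mat (suc n)) → Symmetric A →
    ¬ ¬ (∃[ c ] ∃₂ λ x i → x i ≈ 1# × (∀ j → (A · x) j ≈ c * x j))
  eigenvector A sym-A =
    let (c , upper , lower) = top-eigenvalue A sym-A in
    null-or-coercive (shifted c A) (shifted-symmetric c sym-A) upper >>= λ where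
    (inj₁ (x , i , xᵢ≈1 , Sx≈0)) → return (c , x , i , xᵢ≈1 , λ j → begin-equality
      (A · x) j                                  ≈⟨ solve 2 (λ l r → r := l :- (l :+ :- con 1ℚ :* r)) refl (c * x j) ((A · x) j) ⟩
      c * x j - (c * x j + - 1# * (A · x) j)     ≈⟨ +-congˡ (-‿cong (trans (sym (shifted-· c A x j)) (Sx≈0 j))) ⟩
      c * x j - 0#                               ≈⟨ solve 1 (λ l → l :- con 0ℚ := l) refl (c * x j) ⟩
      c * x j                                    ∎)
    (inj₂ (C , 0≤C , coercive)) → ⊥-elim (1≰0 (archimedean C λ ε ε>0 →
      let (x , i , xᵢ≈1 , small) = lower ε ε>0
          d = 1# - C * ι ε
          d≤0 : d ≤ 0#
          d≤0 = ≤-stable (≤-total d 0# >>= λ where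
            (inj₁ d≤0) → return d≤0
            (inj₂ 0≤d) → return (begin
              d                                   ≈⟨ *-identityʳ d ⟨
              d * 1#                              ≤⟨ *-monoˡ-≤ 0≤d (1≤dot x i xᵢ≈1) ⟩
              d * dot x x                         ≈⟨ solve 3 (λ C e D → (con 1ℚ :- C :* e) :* D := D :- C :* (e :* D)) refl C (ι ε) (dot x x) ⟩
              dot x x - C * (ι ε * dot x x)       ≤⟨ +-mono-≤ (≤-trans (coercive x) (*-monoˡ-≤ 0≤C small)) ≤-refl ⟩
              C * (ι ε * dot x x) - C * (ι ε * dot x x)  ≈⟨ -‿inverseʳ _ ⟩
              0#                                  ∎))
      in 0≤-⇒≤ (≤-trans (≤0⇒0≤- d≤0) (≤-reflexive
           (solve 2 (λ C e → :- (con 1ℚ :- C :* e) := con 0ℚ :+ e :* C :- con 1ℚ) refl C (ι ε))))))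

  -- Square roots and unit vectors

  square-cancel-≤ : ∀ {u v} → 0# ≤ v → u * u ≤ v * v → u ≤ v
  square-cancel-≤ {u} {v} 0≤v uu≤vv = ≤-stable (≤-total u v >>= λ where
    (inj₁ u≤v) → return u≤v
    (inj₂ v≤u) → return (0≤-⇒≤ (≤-reflexive (sym (begin-equality
      v - u      ≈⟨ solve 2 (λ u v → v :- u := :- (u :- v)) refl u v ⟩
      - (u - v)  ≈⟨ -‿cong (square≤0⇒≈0 (begin
        (u - v) * (u - v) ≤⟨ *-monoˡ-≤ (≤⇒0≤- v≤u) (0≤-⇒≤ (≤-trans (+-nonNeg 0≤v 0≤v)
          (≤-reflexive (solve 2 (λ u v → v :+ v := u :+ v :- (u :- v)) refl u v)))) ⟩
        (u - v) * (u + v) ≈⟨ solve 2 (λ u v → (u :- v) :* (u :+ v) := u :* u :- v :* v) refl u v ⟩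
        u * u - v * v     ≤⟨ +-monoˡ-≤ (- (v * v)) uu≤vv ⟩
        v * v - v * v     ≈⟨ -‿inverseʳ (v * v) ⟩
        0#                ∎)) ⟩
      - 0#       ≈⟨ solve 0 (:- con 0ℚ := con 0ℚ) refl ⟩
      0#         ∎)))))

  square-mono-≤ : ∀ {u v} → 0# ≤ u → u ≤ v → u * u ≤ v * v
  square-mono-≤ {u} {v} 0≤u u≤v = ≤-trans (*-monoˡ-≤ 0≤u u≤v) (*-monoʳ-≤ (≤-trans 0≤u u≤v) u≤v)

  sqrt : ∀ x → 0# ≤ x → ∃[ c ] (0# ≤ c × c * c ≈ x)
  sqrt x 0≤x = c , 0≤c , ≤-antisym cc≤x x≤cc
    where
    U : Carrier → Set
    U r = 0# ≤ r × x ≤ r * r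
    L : ℚ → Carrier → Set
    -- The slack ε² is what separation allows: r² ≤ d² + ε² ≤ (d + ε)². The alternative r ≤ ε takes
    -- the r that are not known to be positive.
    L ε r = 0# ≤ ι ε × (r ≤ ι ε ⊎ r * r ≤ x + ι ε * ι ε)

    located = complete U L
      (λ ε ε>0 r → case small-or-positive ε ε>0 (ι r) of λ where
        (inj₁ r≤ε) → inj₂ (ι-mono (ℚₚ.<⇒≤ ε>0) , inj₁ r≤ε)
        (inj₂ r-pos) → case small-or-positive (ε ℚ.* ε) (*-pos ε>0 ε>0) (ι r * ι r - x) of λ where
          (inj₁ ≤εε) → inj₂ (ι-mono (ℚₚ.<⇒≤ ε>0) , inj₂ (begin
            ι r * ι r               ≈⟨ solve 2 (λ r x → r :* r := x :+ (r :* r :- x)) refl (ι r) x ⟩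
            x + (ι r * ι r - x)     ≤⟨ +-mono-≤ ≤-refl ≤εε ⟩
            x + ι (ε ℚ.* ε)         ≈⟨ +-congˡ (ι-* ε ε) ⟩
            x + ι ε * ι ε           ∎))
          (inj₂ pos) → inj₁ (Pos⇒nonNeg r-pos , 0≤-⇒≤ (Pos⇒nonNeg pos)))
      (λ { {ε} {c} {d} (0≤ε , inj₁ c≤ε) (0≤d , x≤dd) → begin
             c          ≈⟨ +-identityˡ c ⟨
             0# + c     ≤⟨ +-mono-≤ 0≤d c≤ε ⟩
             d + ι ε    ∎
         ; {ε} {c} {d} (0≤ε , inj₂ cc≤) (0≤d , x≤dd) → square-cancel-≤ (+-nonNeg 0≤d 0≤ε) (begin
             c * c                   ≤⟨ cc≤ ⟩
             x + ι ε * ι ε           ≤⟨ +-monoˡ-≤ (ι ε * ι ε) x≤dd ⟩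
             d * d + ι ε * ι ε       ≤⟨ 0≤-⇒≤ (≤-trans (+-nonNeg (*-nonNeg 0≤d 0≤ε) (*-nonNeg 0≤d 0≤ε))
                 (≤-reflexive (solve 2 (λ d e → d :* e :+ d :* e := (d :+ e) :* (d :+ e) :- (d :* d :+ e :* e)) refl d (ι ε)))) ⟩
             (d + ι ε) * (d + ι ε)   ∎) })
      (0# , λ _ → proj₁)
      (x + 1# , λ t x+1≤t → ≤-trans (+-nonNeg 0≤x 0≤1) x+1≤t , (begin
        x                     ≤⟨ 0≤-⇒≤ (≤-trans (+-nonNeg (+-nonNeg (*-nonNeg 0≤x 0≤x) 0≤x) 0≤1)
             (≤-reflexive (solve 1 (λ x → x :* x :+ x :+ con 1ℚ := (x :+ con 1ℚ) :* (x :+ con 1ℚ) :- x) refl x))) ⟩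
        (x + 1#) * (x + 1#)   ≤⟨ square-mono-≤ (+-nonNeg 0≤x 0≤1) x+1≤t ⟩
        t * t                 ∎))

    c = proj₁ located

    0≤c : 0# ≤ c
    0≤c = archimedean 1# λ ε ε>0 →
      let (r , (0≤r , _) , r≤c+ε) = proj₁ (proj₂ located ε ε>0) in
      ≤-trans 0≤r (≤-trans r≤c+ε (≤-reflexive (+-congˡ (sym (*-identityʳ (ι ε))))))

    0≤c+c = +-nonNeg 0≤c 0≤c

    x≤cc : x ≤ c * c
    x≤cc = archimedean (c + c + 1#) λ ε ε>0 →
      -- Capping at 1 turns the quadratic error 2cη + η² into the linear bound ε(2c + 1).
      let η = ε ℚ.⊓ 1ℚ
          η>0 = [ (λ η≡ε → ≡.subst (0ℚ ℚ.<_) (≡.sym η≡ε) ε>0)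
              , (λ η≡1 → ≡.subst (0ℚ ℚ.<_) (≡.sym η≡1) (ℚₚ.positive⁻¹ 1ℚ)) ]′ (ℚₚ.⊓-sel ε 1ℚ)
          0≤η = ι-mono (ℚₚ.<⇒≤ η>0)
          (r , (0≤r , x≤rr) , r≤) = proj₁ (proj₂ located η η>0) in begin
      x                                       ≤⟨ x≤rr ⟩
      ι r * ι r                               ≤⟨ square-mono-≤ 0≤r r≤ ⟩
      (c + ι η) * (c + ι η)                   ≈⟨ solve 2 (λ c e → (c :+ e) :* (c :+ e) := c :* c :+ e :* (c :+ c :+ e)) refl c (ι η) ⟩
      c * c + ι η * (c + c + ι η)             ≤⟨ +-mono-≤ ≤-refl (*-monoˡ-≤ 0≤η (+-mono-≤ ≤-refl (ι-mono (ℚₚ.p⊓q≤q ε 1ℚ)))) ⟩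
      c * c + ι η * (c + c + 1#)              ≤⟨ +-mono-≤ ≤-refl (*-monoʳ-≤ (+-nonNeg 0≤c+c 0≤1) (ι-mono (ℚₚ.p⊓q≤p ε 1ℚ))) ⟩
      c * c + ι ε * (c + c + 1#)              ∎

    cc≤x : c * c ≤ x
    cc≤x = archimedean (c + c) λ ε ε>0 →
      let (δ , r , δ≤ε , (0≤δ , close) , c≤) = proj₂ (proj₂ located ε ε>0)
          0≤ε = ι-mono (ℚₚ.<⇒≤ ε>0)
          δ≤ = ι-mono δ≤ε
          near-zero : c ≤ ι ε + ι ε → c * c ≤ x + ι ε * (c + c)
          near-zero c≤2ε = begin
            c * c                   ≤⟨ *-monoˡ-≤ 0≤c c≤2ε ⟩
            c * (ι ε + ι ε)         ≈⟨ solve 2 (λ c e → c :* (e :+ e) := con 0ℚ :+ e :* (c :+ c)) refl c (ι ε) ⟩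
            0# + ι ε * (c + c)      ≤⟨ +-monoˡ-≤ _ 0≤x ⟩
            x + ι ε * (c + c)       ∎
      in case close of λ where
        (inj₁ r≤δ) → near-zero (≤-trans c≤ (+-monoˡ-≤ (ι ε) (≤-trans r≤δ δ≤)))
        -- Squaring c - ε ≤ r requires c - ε ≥ 0; in the other case c itself is small.
        (inj₂ rr≤) → ≤-stable (≤-total c (ι ε) >>= λ where
          (inj₁ c≤ε) → return (near-zero (≤-trans c≤ε (≤-trans (≤-reflexive (sym (+-identityʳ (ι ε)))) (+-mono-≤ ≤-refl 0≤ε))))
          (inj₂ ε≤c) → return (begin
            c * c                                         ≈⟨ solve 2 (λ c e → c :* c := (c :- e) :* (c :- e) :+ (e :* (c :+ c) :- e :* e)) refl c (ι ε) ⟩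
            (c - ι ε) * (c - ι ε) + (ι ε * (c + c) - ι ε * ι ε)
              ≤⟨ +-monoˡ-≤ _ (≤-trans (square-mono-≤ (≤⇒0≤- ε≤c) (0≤-⇒≤ (≤-trans (≤⇒0≤- c≤)
                   (≤-reflexive (solve 3 (λ r e c → r :+ e :- c := r :- (c :- e)) refl (ι r) (ι ε) c)))))
                   (≤-trans rr≤ (+-mono-≤ ≤-refl (square-mono-≤ 0≤δ δ≤)))) ⟩
            x + ι ε * ι ε + (ι ε * (c + c) - ι ε * ι ε)
              ≈⟨ solve 3 (λ x s t → x :+ s :+ (t :- s) := x :+ t) refl x (ι ε * ι ε) (ι ε * (c + c)) ⟩
            x + ι ε * (c + c) ∎))

  unit-eigenvector : (A : Mat (suc n)) → Symmetric A →
    ¬ ¬ (∃₂ λ c v → dot v v ≈ 1# × (∀ j → (A · v) j ≈ c * v j))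
  unit-eigenvector {n} A sym-A = eigenvector A sym-A >>= λ (c , x , i , xᵢ≈1 , Ax≈cx) →
    ≰0⇒Pos (λ D≤0 → 1≰0 (≤-trans (1≤dot x i xᵢ≈1) D≤0)) >>= λ (y , _ , Dy≈1) →
    let D = dot x x
        (s , _ , ss≈D) = sqrt D (dot-nonNeg x)
        -- This is √D / D, that is 1/√D, so only D has to be inverted.
        u = s * y
    in return (c , (λ j → u * x j) , (begin-equality
      dot (λ j → u * x j) (λ j → u * x j)   ≈⟨ dot-scaleʳ (λ j → u * x j) x u ⟩
      u * dot (λ j → u * x j) x             ≈⟨ *-congˡ (trans (dot-comm (λ j → u * x j) x) (dot-scaleʳ x x u)) ⟩
      u * (u * D)                           ≈⟨ solve 3 (λ s y D → s :* y :* (s :* y :* D) := s :* s :* y :* (D :* y)) refl s y D ⟩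
      s * s * y * (D * y)                   ≈⟨ *-cong (*-congʳ ss≈D) Dy≈1 ⟩
      D * y * 1#                            ≈⟨ trans (*-identityʳ _) Dy≈1 ⟩
      1#                                    ∎)
    , λ j → begin-equality
      (A · (λ j → u * x j)) j               ≈⟨ dot-scaleʳ (A j) x u ⟩
      u * (A · x) j                         ≈⟨ *-congˡ (Ax≈cx j) ⟩
      u * (c * x j)                         ≈⟨ solve 3 (λ u c x → u :* (c :* x) := c :* (u :* x)) refl u c (x j) ⟩
      c * (u * x j)                         ∎)

  -- Orthogonal matrices and the spectral theorem

  infix  4 _≋_
  infixl 7 _⊠_

  _≋_ : Mat n → Mat n → Set
  X ≋ Y = ∀ i j → X i j ≈ Y i j

  _⊠_ : Mat n → Mat n → Mat n
  (X ⊠ Y) i j = sum λ k → X i k * Y k j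

  _ᵀ : Mat n → Mat n
  (X ᵀ) i j = X j i

  𝐈 : Mat n
  𝐈 = diag λ _ → 1#

  Orthogonal : Mat n → Set
  Orthogonal U = (U ᵀ ⊠ U ≋ 𝐈) × (U ⊠ U ᵀ ≋ 𝐈)

  ≋-refl : {X : Mat n} → X ≋ X
  ≋-refl i j = refl

  ≋-sym : {X Y : Mat n} → X ≋ Y → Y ≋ X
  ≋-sym X≋Y i j = sym (X≋Y i j)

  ≋-trans : {X Y Z : Mat n} → X ≋ Y → Y ≋ Z → X ≋ Z
  ≋-trans X≋Y Y≋Z i j = trans (X≋Y i j) (Y≋Z i j)

  ⊠-cong : {X X′ Y Y′ : Mat n} → X ≋ X′ → Y ≋ Y′ → X ⊠ Y ≋ X′ ⊠ Y′
  ⊠-cong X≋X′ Y≋Y′ i j = sum-cong λ k → *-cong (X≋X′ i k) (Y≋Y′ k j)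

  ⊠-assoc : (X Y Z : Mat n) → X ⊠ Y ⊠ Z ≋ X ⊠ (Y ⊠ Z)
  ⊠-assoc X Y Z i j = begin-equality
    sum (λ k → sum (λ l → X i l * Y l k) * Z k j)
      ≈⟨ sum-cong (λ k → *-distribʳ-sum (Z k j) (λ l → X i l * Y l k)) ⟩
    sum (λ k → sum λ l → X i l * Y l k * Z k j)
      ≈⟨ ∑-comm (λ k l → X i l * Y l k * Z k j) ⟩
    sum (λ l → sum λ k → X i l * Y l k * Z k j)
      ≈⟨ sum-cong (λ l → sum-cong λ k → *-assoc (X i l) (Y l k) (Z k j)) ⟩
    sum (λ l → sum λ k → X i l * (Y l k * Z k j))
      ≈⟨ sum-cong (λ l → *-distribˡ-sum (X i l) (λ k → Y l k * Z k j)) ⟨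
    sum (λ l → X i l * sum (λ k → Y l k * Z k j)) ∎

  ⊠-ᵀ : (X Y : Mat n) → (X ⊠ Y) ᵀ ≋ Y ᵀ ⊠ X ᵀ
  ⊠-ᵀ X Y i j = sum-cong λ k → *-comm (X j k) (Y k i)

  diag-⊠ : (d : Vec n) (X : Mat n) → ∀ i j → (diag d ⊠ X) i j ≈ d i * X i j
  diag-⊠ d X i j = diag-· d (λ k → X k j) i

  ⊠-diag : (X : Mat n) (d : Vec n) → ∀ i j → (X ⊠ diag d) i j ≈ X i j * d j
  ⊠-diag X d i j = begin-equality
    dot (X i) (λ k → diag d k j)   ≈⟨ dot-cong {x = X i} (λ _ → refl) (λ k → diag-symmetric d k j) ⟩
    dot (X i) (diag d j)           ≈⟨ dot-comm (X i) (diag d j) ⟩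
    (diag d · X i) j               ≈⟨ diag-· d (X i) j ⟩
    d j * X i j                    ≈⟨ *-comm (d j) (X i j) ⟩
    X i j * d j                    ∎

  ⊠-identityˡ : (X : Mat n) → 𝐈 ⊠ X ≋ X
  ⊠-identityˡ X i j = trans (diag-⊠ (λ _ → 1#) X i j) (*-identityˡ (X i j))

  ⊠-identityʳ : (X : Mat n) → X ⊠ 𝐈 ≋ X
  ⊠-identityʳ X i j = trans (⊠-diag X (λ _ → 1#) i j) (*-identityʳ (X i j))

  cancel-middle : (X U V Y : Mat n) → U ⊠ V ≋ 𝐈 → X ⊠ U ⊠ (V ⊠ Y) ≋ X ⊠ Y
  cancel-middle X U V Y UV≋𝐈 =
    ≋-trans (≋-sym (⊠-assoc (X ⊠ U) V Y)) (⊠-cong {Y = Y}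
      (≋-trans (⊠-assoc X U V) (≋-trans (⊠-cong {X = X} ≋-refl UV≋𝐈) (⊠-identityʳ X))) ≋-refl)

  Orthogonal-ᵀ : {U : Mat n} → Orthogonal U → Orthogonal (U ᵀ)
  Orthogonal-ᵀ (UᵀU , UUᵀ) = UUᵀ , UᵀU

  Orthogonal-⊠ : {U V : Mat n} → Orthogonal U → Orthogonal V → Orthogonal (U ⊠ V)
  Orthogonal-⊠ {U = U} {V} (UᵀU , UUᵀ) (VᵀV , VVᵀ)
    = ≋-trans (⊠-cong {Y = U ⊠ V} (⊠-ᵀ U V) ≋-refl) (≋-trans (cancel-middle (V ᵀ) (U ᵀ) U V UᵀU) VᵀV)
    , ≋-trans (⊠-cong {X = U ⊠ V} ≋-refl (⊠-ᵀ U V)) (≋-trans (cancel-middle U V (V ᵀ) (U ᵀ) VVᵀ) UUᵀ)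

  conjugate-assoc : (H B Λ : Mat n) → H ⊠ (B ⊠ Λ ⊠ B ᵀ) ⊠ H ᵀ ≋ (H ⊠ B) ⊠ Λ ⊠ (H ⊠ B) ᵀ
  conjugate-assoc H B Λ =
    ≋-trans (⊠-cong {Y = H ᵀ} (≋-trans (≋-sym (⊠-assoc H (B ⊠ Λ) (B ᵀ)))
                      (⊠-cong {Y = B ᵀ} (≋-sym (⊠-assoc H B Λ)) ≋-refl)) ≋-refl)
    (≋-trans (⊠-assoc (H ⊠ B ⊠ Λ) (B ᵀ) (H ᵀ))
             (⊠-cong {X = H ⊠ B ⊠ Λ} ≋-refl (≋-sym (⊠-ᵀ H B))))

  block : Carrier → Mat n → Mat (suc n)
  block c X zero    zero    = c
  block c X zero    (suc j) = 0#
  block c X (suc i) zero    = 0#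
  block c X (suc i) (suc j) = X i j

  block-cong : ∀ {c d} {X Y : Mat n} → c ≈ d → X ≋ Y → block c X ≋ block d Y
  block-cong c≈d X≋Y zero    zero    = c≈d
  block-cong c≈d X≋Y zero    (suc j) = refl
  block-cong c≈d X≋Y (suc i) zero    = refl
  block-cong c≈d X≋Y (suc i) (suc j) = X≋Y i j

  block-⊠ : ∀ c d (X Y : Mat n) → block c X ⊠ block d Y ≋ block (c * d) (X ⊠ Y)
  block-⊠ {n} c d X Y zero zero   = trans (+-congˡ (sum-zero {n} λ k → zeroˡ 0#)) (+-identityʳ (c * d))
  block-⊠ c d X Y zero    (suc j) = trans (+-cong (zeroʳ c) (sum-zero λ k → zeroˡ (Y k j))) (+-identityʳ 0#)
  block-⊠ c d X Y (suc i) zero    = trans (+-cong (zeroˡ d) (sum-zero λ k → zeroʳ (X i k))) (+-identityʳ 0#)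
  block-⊠ c d X Y (suc i) (suc j) = trans (+-congʳ (zeroˡ 0#)) (+-identityˡ _)

  block-ᵀ : ∀ c (X : Mat n) → block c (X ᵀ) ≋ block c X ᵀ
  block-ᵀ c X zero    zero    = refl
  block-ᵀ c X zero    (suc j) = refl
  block-ᵀ c X (suc i) zero    = refl
  block-ᵀ c X (suc i) (suc j) = refl

  block-diag : ∀ c (d : Vec n) → block c (diag d) ≋ diag (c ◂ d)
  block-diag c d zero    zero    = refl
  block-diag c d zero    (suc j) = refl
  block-diag c d (suc i) zero    = refl
  block-diag c d (suc i) (suc j) = refl

  block-𝐈 : block 1# (𝐈 {n}) ≋ 𝐈
  block-𝐈 zero    zero    = refl
  block-𝐈 zero    (suc j) = refl
  block-𝐈 (suc i) zero    = refl
  block-𝐈 (suc i) (suc j) = refl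

  Orthogonal-block : {Q : Mat n} → Orthogonal Q → Orthogonal (block 1# Q)
  Orthogonal-block {Q = Q} (QᵀQ , QQᵀ)
    = ≋-trans (⊠-cong {Y = block 1# Q} (≋-sym (block-ᵀ 1# Q)) ≋-refl)
        (≋-trans (block-⊠ 1# 1# (Q ᵀ) Q) (≋-trans (block-cong (*-identityˡ 1#) QᵀQ) block-𝐈))
    , ≋-trans (⊠-cong {X = block 1# Q} ≋-refl (≋-sym (block-ᵀ 1# Q)))
        (≋-trans (block-⊠ 1# 1# Q (Q ᵀ)) (≋-trans (block-cong (*-identityˡ 1#) QQᵀ) block-𝐈))

  -- The reflection I - c w wᵀ along w = v - e₀, where |w|² = 2g makes the usual coefficient 2/|w|²
  -- equal to 1/g. When g = 0 the vector w vanishes and c = 0 yields the identity; the two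
  -- hypotheses of `reflection` cover both cases at once.
  householder : (v : Vec (suc n)) → dot v v ≈ 1# →
    ¬ ¬ (∃[ H ] (Symmetric H × H ⊠ H ≋ 𝐈 × (∀ i → H i zero ≈ v i)))
  householder {n} v |v|≈1 = lem >>= λ where
      (inj₁ g≈0) → return (reflection 0# (zeroˡ _) λ i → begin-equality
        w i             ≈⟨ square≤0⇒≈0 (≤-trans (term≤sum (λ j → square-nonNeg (w j)) i) (≤-reflexive (begin-equality
          dot w w         ≈⟨ ww≈2g ⟩
          g + g           ≈⟨ +-cong g≈0 g≈0 ⟩
          0# + 0#         ≈⟨ +-identityˡ 0# ⟩
          0#              ∎))) ⟩
        0#              ≈⟨ solve 2 (λ g w → con 0ℚ := con 0ℚ :* g :* w) refl g (w i) ⟩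
        0# * g * w i    ∎)
      (inj₂ g≉0) → invertible g≉0 >>= λ (c , gc≈1) →
        let cg≈1 = trans (*-comm c g) gc≈1 in return (reflection c
          (trans (*-congˡ (trans (+-congˡ (-‿cong cg≈1)) (-‿inverseʳ 1#))) (zeroʳ c))
          (λ i → sym (trans (*-congʳ cg≈1) (*-identityˡ (w i)))))
    where
    w : Vec (suc n)
    w i = v i + - 1# * e₀ i
    g = 1# - v zero

    ww≈2g : dot w w ≈ g + g
    ww≈2g = begin-equality
      dot w w                                   ≈⟨ dot-combine w v e₀ (- 1#) ⟩
      dot w v + - 1# * dot w e₀                 ≈⟨ +-cong (dot-combineˡ v v e₀ (- 1#)) (*-congˡ (dot-e₀ w)) ⟩
      dot v v + - 1# * dot e₀ v + - 1# * w zero ≈⟨ +-congʳ (+-cong |v|≈1 (*-congˡ (trans (dot-comm e₀ v) (dot-e₀ v)))) ⟩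
      1# + - 1# * v zero + - 1# * (v zero + - 1# * 1#)
        ≈⟨ solve 1 (λ v → con 1ℚ :+ :- con 1ℚ :* v :+ :- con 1ℚ :* (v :+ :- con 1ℚ :* con 1ℚ)
             := con 1ℚ :- v :+ (con 1ℚ :- v)) refl (v zero) ⟩
      g + g                                     ∎

    reflection : ∀ c → c * (1# - c * g) ≈ 0# → (∀ i → w i ≈ c * g * w i) →
      ∃[ H ] (Symmetric H × H ⊠ H ≋ 𝐈 × (∀ i → H i zero ≈ v i))
    reflection c involutive moves = H , sym-H , HH≋𝐈 , column
      where
      H : Mat (suc n)
      H i j = 𝐈 i j + - c * w i * w j

      sym-H : Symmetric H
      sym-H i j = +-cong (diag-symmetric (λ _ → 1#) i j)
        (solve 3 (λ c u v → :- c :* u :* v := :- c :* v :* u) refl c (w i) (w j))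

      𝐈-· : ∀ x i → (𝐈 · x) i ≈ x i
      𝐈-· x i = trans (diag-· (λ _ → 1#) x i) (*-identityˡ (x i))

      H-· : ∀ x i → (H · x) i ≈ x i + - c * w i * dot w x
      H-· x i = trans (dot-combineˡ x (𝐈 i) w (- c * w i)) (+-congʳ (𝐈-· x i))

      HH≋𝐈 : H ⊠ H ≋ 𝐈
      HH≋𝐈 i j = begin-equality
        dot (H i) (λ k → H k j)             ≈⟨ dot-cong {x = H i} (λ _ → refl) (λ k → sym-H k j) ⟩
        (H · H j) i                         ≈⟨ H-· (H j) i ⟩
        H j i + - c * w i * dot w (H j)     ≈⟨ +-congˡ (*-congˡ (trans (dot-comm w (H j)) (trans (H-· w j) (+-congˡ (*-congˡ ww≈2g))))) ⟩
        𝐈 j i + - c * w j * w i + - c * w i * (w j + - c * w j * (g + g))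
          ≈⟨ solve 5 (λ d c u v g → d :+ :- c :* v :* u :+ :- c :* u :* (v :+ :- c :* v :* (g :+ g))
               := d :+ c :* (con 1ℚ :- c :* g) :* (:- (con 1ℚ :+ con 1ℚ) :* u :* v))
               refl (𝐈 j i) c (w i) (w j) g ⟩
        𝐈 j i + c * (1# - c * g) * (- (1# + 1#) * w i * w j)
          ≈⟨ +-cong (diag-symmetric (λ _ → 1#) j i) (trans (*-congʳ involutive) (zeroˡ _)) ⟩
        𝐈 i j + 0#                          ≈⟨ +-identityʳ (𝐈 i j) ⟩
        𝐈 i j                               ∎

      column : ∀ i → H i zero ≈ v i
      column i = begin-equality
        H i zero                              ≈⟨ dot-e₀ (H i) ⟨
        (H · e₀) i                            ≈⟨ H-· e₀ i ⟩
        e₀ i + - c * w i * dot w e₀           ≈⟨ +-congˡ (*-congˡ (dot-e₀ w)) ⟩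
        e₀ i + - c * w i * (v zero + - 1# * 1#)
          ≈⟨ solve 4 (λ e c w v → e :+ :- c :* w :* (v :+ :- con 1ℚ :* con 1ℚ) := e :+ c :* (con 1ℚ :- v) :* w) refl (e₀ i) c (w i) (v zero) ⟩
        e₀ i + c * g * w i                    ≈⟨ +-congˡ (moves i) ⟨
        e₀ i + (v i + - 1# * e₀ i)            ≈⟨ solve 2 (λ e v → e :+ (v :+ :- con 1ℚ :* e) := v) refl (e₀ i) (v i) ⟩
        v i                                   ∎

  conjugate-symmetric : (H A : Mat n) → Symmetric A → Symmetric (H ⊠ A ⊠ H ᵀ)
  conjugate-symmetric H A sym-A = ≋-sym (≋-trans (⊠-ᵀ (H ⊠ A) (H ᵀ))
    (≋-trans (⊠-cong {X = H} ≋-refl (≋-trans (⊠-ᵀ H A) (⊠-cong {Y = H ᵀ} (≋-sym sym-A) ≋-refl)))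
             (≋-sym (⊠-assoc H A (H ᵀ)))))

  conjugate-inverse : (H A : Mat n) → H ᵀ ⊠ H ≋ 𝐈 → A ≋ H ᵀ ⊠ (H ⊠ A ⊠ H ᵀ) ⊠ H
  conjugate-inverse H A HᵀH≋𝐈 = ≋-sym (≋-trans (conjugate-assoc (H ᵀ) H A)
    (≋-trans (⊠-cong (⊠-cong {Y = A} HᵀH≋𝐈 ≋-refl) (λ i j → trans (HᵀH≋𝐈 j i) (diag-symmetric (λ _ → 1#) j i)))
    (≋-trans (⊠-identityʳ (𝐈 ⊠ A)) (⊠-identityˡ A))))

  -- Deflation: the reflection H takes e₀ to a unit eigenvector, so the first column of H A Hᵀ is c
  -- e₀, and by symmetry a 1 × 1 block splits off.
  spectral : (A : Mat n) → Symmetric A →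
    ¬ ¬ (∃₂ λ Q d → Orthogonal Q × A ≋ Q ⊠ diag d ⊠ Q ᵀ)
  spectral {zero} A sym-A = return (𝐈 , (λ ()) , ((λ ()) , λ ()) , λ ())
  spectral {suc n} A sym-A =
    unit-eigenvector A sym-A >>= λ (c , v , |v|≈1 , Av≈cv) →
    householder v |v|≈1 >>= λ (H , sym-H , HH≋𝐈 , He₀≈v) →
    let A′ = H ⊠ A ⊠ H ᵀ
        A″ : Mat n
        A″ i j = A′ (suc i) (suc j)

        sym-A′ : Symmetric A′
        sym-A′ = conjugate-symmetric H A sym-A

        HᵀH≋𝐈 : H ᵀ ⊠ H ≋ 𝐈
        HᵀH≋𝐈 = ≋-trans (⊠-cong {Y = H} (≋-sym sym-H) ≋-refl) HH≋𝐈

        HHᵀ≋𝐈 : H ⊠ H ᵀ ≋ 𝐈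
        HHᵀ≋𝐈 = ≋-trans (⊠-cong {X = H} ≋-refl (≋-sym sym-H)) HH≋𝐈

        row : ∀ k → H zero k ≈ v k
        row k = trans (sym-H zero k) (He₀≈v k)

        column : ∀ i → A′ i zero ≈ c * 𝐈 i zero
        column i = begin-equality
          A′ i zero                                     ≈⟨ ⊠-assoc H A (H ᵀ) i zero ⟩
          dot (H i) (λ k → dot (A k) (H zero))          ≈⟨ dot-cong {x = H i} (λ _ → refl) (λ k → begin-equality
            dot (A k) (H zero)                            ≈⟨ dot-cong {x = A k} (λ _ → refl) row ⟩
            (A · v) k                                     ≈⟨ Av≈cv k ⟩
            c * v k                                       ≈⟨ *-congˡ (row k) ⟨
            c * H zero k                                  ∎) ⟩
          dot (H i) (λ k → c * H zero k)                ≈⟨ dot-scaleʳ (H i) (H zero) c ⟩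
          c * dot (H i) (H zero)                        ≈⟨ *-congˡ (HHᵀ≋𝐈 i zero) ⟩
          c * 𝐈 i zero                                  ∎

        deflated : A′ ≋ block c A″
        deflated = λ where
          zero    zero    → trans (column zero) (*-identityʳ c)
          (suc i) zero    → trans (column (suc i)) (zeroʳ c)
          zero    (suc j) → trans (sym-A′ zero (suc j)) (trans (column (suc j)) (zeroʳ c))
          (suc i) (suc j) → refl
    in spectral A″ (λ i j → sym-A′ (suc i) (suc j)) >>= λ (Q , d , orth-Q , A″≋) →
    let B = block 1# Q
        A′≋ : A′ ≋ B ⊠ diag (c ◂ d) ⊠ B ᵀ
        A′≋ = ≋-trans deflated (≋-trans (block-cong (solve 1 (λ c → c := con 1ℚ :* c :* con 1ℚ) refl c) A″≋)
          (≋-trans (≋-sym (block-⊠ (1# * c) 1# (Q ⊠ diag d) (Q ᵀ)))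
            (⊠-cong (≋-trans (≋-sym (block-⊠ 1# c Q (diag d))) (⊠-cong {X = B} ≋-refl (block-diag c d))) (block-ᵀ 1# Q))))
    in return (H ᵀ ⊠ B , (c ◂ d) , Orthogonal-⊠ {U = H ᵀ} {B} (HHᵀ≋𝐈 , HᵀH≋𝐈) (Orthogonal-block orth-Q)
      , ≋-trans (conjugate-inverse H A HᵀH≋𝐈)
        (≋-trans (⊠-cong {Y = H} (⊠-cong {X = H ᵀ} ≋-refl A′≋) ≋-refl) (conjugate-assoc (H ᵀ) B (diag (c ◂ d)))))

  -- Underdetermined systems and the law of inertia

  homogeneous-system : ∀ {m} (rows : List (Vec n)) → length rows ≡ m → m ℕ.< n →
    ¬ ¬ (∃₂ λ x i → ¬ x i ≈ 0# × All (λ r → dot r x ≈ 0#) rows)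
  homogeneous-system {suc n} {zero} [] _ _ = return (e₀ {n} , zero , (λ 1≈0 → 1≰0 (≤-reflexive 1≈0)) , [])
  homogeneous-system {suc n} {suc m} (r ∷ rs) len (ℕ.s≤s m<n) = lem >>= λ where
    (inj₂ r≈0) → homogeneous-system rs (ℕₚ.suc-injective len) (ℕₚ.m<n⇒m<1+n m<n) >>= λ (x , i , xᵢ≉0 , rs·x≈0) →
      return (x , i , xᵢ≉0 ,
        trans (dot-comm r x) (dot-zeroʳ x (λ j → ≈-stable λ rⱼ≉0 → r≈0 (j , rⱼ≉0))) ∷ rs·x≈0)
    (inj₁ (j , rⱼ≉0)) → invertible rⱼ≉0 >>= λ (y , rⱼy≈1) →
      -- Uses the pivot `r j` to eliminate the unknown j from the other equations; its value is
      -- afterwards solved for from `r`.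
      let reduce : Vec (suc n) → Vec n
          reduce u k = u (punchIn j k) + - (u j * y) * r (punchIn j k)
      in homogeneous-system (List.map reduce rs) (≡.trans (Listₚ.length-map reduce rs) (ℕₚ.suc-injective len)) m<n >>= λ (x , i , xᵢ≉0 , rs·x≈0) →
      let β = dot (removeAt r j) x
          v = - (y * β)
          x⁺ = insertAt x j v
          x⁺-punchIn : ∀ k → x⁺ (punchIn j k) ≈ x k
          x⁺-punchIn k = reflexive (insertAt-punchIn x j v k)
          dot-x⁺ : ∀ u → dot u x⁺ ≈ u j * v + dot (removeAt u j) x
          dot-x⁺ u = trans (sum-remove {i = j} (λ k → u k * x⁺ k))
            (+-cong (*-congˡ (reflexive (insertAt-lookup x j v))) (sum-cong λ k → *-congˡ (x⁺-punchIn k)))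
      in return (x⁺ , punchIn j i , (λ x⁺≈0 → xᵢ≉0 (trans (sym (x⁺-punchIn i)) x⁺≈0)) ,
        (begin-equality
          dot r x⁺                  ≈⟨ dot-x⁺ r ⟩
          r j * - (y * β) + β       ≈⟨ solve 3 (λ r y β → r :* :- (y :* β) :+ β := (con 1ℚ :- r :* y) :* β) refl (r j) y β ⟩
          (1# - r j * y) * β        ≈⟨ *-congʳ (trans (+-congˡ (-‿cong rⱼy≈1)) (-‿inverseʳ 1#)) ⟩
          0# * β                    ≈⟨ zeroˡ β ⟩
          0#                        ∎) ∷
        All.map (λ {u} reduced → begin-equality
          dot u x⁺                              ≈⟨ dot-x⁺ u ⟩
          u j * - (y * β) + dot (removeAt u j) x
            ≈⟨ solve 4 (λ u y β d → u :* :- (y :* β) :+ d := d :+ :- (u :* y) :* β) refl (u j) y β (dot (removeAt u j) x) ⟩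
          dot (removeAt u j) x + - (u j * y) * β ≈⟨ dot-combineˡ x (removeAt u j) (removeAt r j) (- (u j * y)) ⟨
          dot (reduce u) x                      ≈⟨ reduced ⟩
          0#                                    ∎) (Allₚ.map⁻ rs·x≈0))

  -- If the count of e exceeded that of p, some y ≠ 0 supported on e would be
  -- orthogonal to every row K i with p i, and the form would be both positive
  -- and nonpositive at y.
  inertia-bound : (d l : Vec n) (K : Mat n) →
    (∀ y → sum (λ k → d k * (y k * y k)) ≈ sum (λ i → l i * (dot (K i) y * dot (K i) y))) →
    (e p : Fin n → Bool) → (∀ k → e k ≡ true → Pos (d k)) → (∀ i → p i ≡ false → l i ≤ 0#) →
    count e ℕ.≤ count p
  inertia-bound {n} d l K same e p e-pos p-nonPos = ℕₚ.≮⇒≥ λ p<e →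
    homogeneous-system rows rows-length (ℕₚ.<-≤-trans
        (ℕₚ.+-monoˡ-< (count (not ∘ e)) p<e) (ℕₚ.≤-reflexive (count-not e))) λ (y , k , yₖ≉0 , rows·y≈0) →
    let K·y≈0 : ∀ i → p i ≡ true → dot (K i) y ≈ 0#
        K·y≈0 = All-select p K (Allₚ.++⁻ˡ (select p K) rows·y≈0)
        y≈0 : ∀ k → e k ≡ false → y k ≈ 0#
        y≈0 k eₖ = trans (sym (trans (diag-· (λ _ → 1#) y k) (*-identityˡ (y k))))
          (All-select (not ∘ e) 𝐈 (Allₚ.++⁻ʳ (select p K) rows·y≈0) k (≡.cong not eₖ))
        0≤terms : ∀ k → 0# ≤ d k * (y k * y k)
        0≤terms k = nonNeg k (e k) ≡.refl (y≈0 k)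
        sum≤0 : sum (λ k → d k * (y k * y k)) ≤ 0#
        sum≤0 = begin
          sum (λ k → d k * (y k * y k))                     ≈⟨ same y ⟩
          sum (λ i → l i * (dot (K i) y * dot (K i) y))     ≤⟨ sum-mono-≤ (λ i → nonPos i (p i) ≡.refl (K·y≈0 i)) ⟩
          sum {n} (λ _ → 0#)                                ≈⟨ sum-zero {n} (λ _ → refl) ⟩
          0#                                                ∎
    in yₖ≉0 (vanishes k (e k) ≡.refl (y≈0 k) (≤-antisym (≤-trans (term≤sum 0≤terms k) sum≤0) (0≤terms k)))
    where
    rows : List (Vec n)
    rows = select p K List.++ select (not ∘ e) 𝐈

    rows-length : length rows ≡ count p ℕ.+ count (not ∘ e)
    rows-length = ≡.trans (Listₚ.length-++ (select p K))
      (≡.cong₂ ℕ._+_ (length-select p K) (length-select (not ∘ e) 𝐈))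

    nonNeg : ∀ {u} k b → e k ≡ b → (e k ≡ false → u ≈ 0#) → 0# ≤ d k * (u * u)
    nonNeg {u} k true eₖ _ = *-nonNeg (Pos⇒nonNeg (e-pos k eₖ)) (square-nonNeg u)
    nonNeg {u} k false eₖ u≈0 = ≤-reflexive (sym (trans (*-congˡ (trans (*-congˡ (u≈0 eₖ)) (zeroʳ u))) (zeroʳ (d k))))

    nonPos : ∀ {u} i b → p i ≡ b → (p i ≡ true → u ≈ 0#) → l i * (u * u) ≤ 0#
    nonPos {u} i true pᵢ u≈0 = ≤-reflexive (trans (*-congˡ (trans (*-congˡ (u≈0 pᵢ)) (zeroʳ u))) (zeroʳ (l i)))
    nonPos {u} i false pᵢ _ = begin
      l i * (u * u)  ≤⟨ *-monoʳ-≤ (square-nonNeg u) (p-nonPos i pᵢ) ⟩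
      0# * (u * u)   ≈⟨ zeroˡ (u * u) ⟩
      0#             ∎

    vanishes : ∀ {u} k b → e k ≡ b → (e k ≡ false → u ≈ 0#) → d k * (u * u) ≈ 0# → u ≈ 0#
    vanishes k false eₖ u≈0 _ = u≈0 eₖ
    vanishes k true eₖ _ duu≈0 = square≤0⇒≈0 (≤-reflexive (Pos-cancel-zero (e-pos k eₖ) duu≈0))

  -- The trace norm and its dual bound

  infixl 6 _⊞_
  infixl 7 _⊡_

  _⊞_ : Mat n → Mat n → Mat n
  (X ⊞ Y) i j = X i j + Y i j

  _⊡_ : Carrier → Mat n → Mat n
  (t ⊡ X) i j = t * X i j

  SingularValues : Mat n → Vec n → Set
  SingularValues X σ =
    (∀ i → 0# ≤ σ i) ×
    ∃[ U ] ∃[ V ] (Orthogonal U × Orthogonal V × X ≋ U ⊠ diag σ ⊠ V ᵀ)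

  ‖_‖₁≈_ : Mat n → Carrier → Set
  ‖ X ‖₁≈ r = ∃[ σ ] (SingularValues X σ × r ≈ sum σ)

  BirkhoffJamesOrthogonal : Mat n → Mat n → Set
  BirkhoffJamesOrthogonal X Y =
    ∀ t p q → ‖ X ‖₁≈ p → ‖ X ⊞ t ⊡ Y ‖₁≈ q → p ≤ q

  trace : Mat n → Carrier
  trace X = sum λ i → X i i

  trace-cong : {X Y : Mat n} → X ≋ Y → trace X ≈ trace Y
  trace-cong X≋Y = sum-cong λ i → X≋Y i i

  trace-comm : (X Y : Mat n) → trace (X ⊠ Y) ≈ trace (Y ⊠ X)
  trace-comm X Y = trans (∑-comm λ i k → X i k * Y k i)
    (sum-cong λ k → sum-cong λ i → *-comm (X i k) (Y k i))

  diag-diagonal : (d : Vec n) → ∀ i → diag d i i ≈ d i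
  diag-diagonal d zero    = refl
  diag-diagonal d (suc i) = diag-diagonal (d ∘ suc) i

  trace-⊠-diag : (Z : Mat n) (d : Vec n) → trace (Z ⊠ diag d) ≈ sum λ i → Z i i * d i
  trace-⊠-diag Z d = sum-cong λ i → ⊠-diag Z d i i

  orthogonal-diagonal-bound : {Z : Mat n} → Orthogonal Z → ∀ i → Z i i ≤ 1# × - Z i i ≤ 1#
  orthogonal-diagonal-bound {Z = Z} (_ , ZZᵀ≋𝐈) i =
    square-cancel-≤ 0≤1 square≤1 ,
    square-cancel-≤ 0≤1 (≤-trans (≤-reflexive (solve 1 (λ z → :- z :* :- z := z :* z) refl (Z i i))) square≤1)
    where
    square≤1 : Z i i * Z i i ≤ 1# * 1#
    square≤1 = begin
      Z i i * Z i i        ≤⟨ term≤sum (λ k → square-nonNeg (Z i k)) i ⟩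
      dot (Z i) (Z i)      ≈⟨ trans (ZZᵀ≋𝐈 i i) (diag-diagonal (λ _ → 1#) i) ⟩
      1#                   ≈⟨ *-identityˡ 1# ⟨
      1# * 1#              ∎

  -- By cyclicity the trace is that of Z diag(d) with Z = Vᵀ W U orthogonal, whose diagonal entries
  -- lie between -1 and 1. As d may have signs, the bound serves spectral as well as singular value
  -- decompositions.
  trace-bound : {W X U V : Mat n} {d e : Vec n} →
    Orthogonal W → Orthogonal U → Orthogonal V → X ≋ U ⊠ diag d ⊠ V ᵀ →
    (∀ i → d i ≤ e i × - d i ≤ e i) → trace (W ⊠ X) ≤ sum e
  trace-bound {W = W} {X} {U} {V} {d} {e} orth-W orth-U orth-V X≋ |d|≤e = begin
    trace (W ⊠ X)                         ≈⟨ trace-cong (⊠-cong {X = W} ≋-refl X≋) ⟩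
    trace (W ⊠ (U ⊠ diag d ⊠ V ᵀ))        ≈⟨ trace-cong (≋-sym (⊠-assoc W (U ⊠ diag d) (V ᵀ))) ⟩
    trace (W ⊠ (U ⊠ diag d) ⊠ V ᵀ)        ≈⟨ trace-comm (W ⊠ (U ⊠ diag d)) (V ᵀ) ⟩
    trace (V ᵀ ⊠ (W ⊠ (U ⊠ diag d)))      ≈⟨ trace-cong (≋-trans
      (⊠-cong {X = V ᵀ} ≋-refl (≋-sym (⊠-assoc W U (diag d)))) (≋-sym (⊠-assoc (V ᵀ) (W ⊠ U) (diag d)))) ⟩
    trace (Z ⊠ diag d)                    ≈⟨ trace-⊠-diag Z d ⟩
    sum (λ i → Z i i * d i)               ≤⟨ sum-mono-≤ (λ i → term (orthogonal-diagonal-bound orth-Z i) (|d|≤e i)) ⟩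
    sum e                                 ∎
    where
    Z = V ᵀ ⊠ (W ⊠ U)
    orth-Z : Orthogonal Z
    orth-Z = Orthogonal-⊠ {U = V ᵀ} {W ⊠ U} (Orthogonal-ᵀ {U = V} orth-V) (Orthogonal-⊠ {U = W} {U} orth-W orth-U)
    term : ∀ {z d e} → z ≤ 1# × - z ≤ 1# → d ≤ e × - d ≤ e → z * d ≤ e
    -- e - z d is the average of (1 + z)(e - d) and (1 - z)(e + d), so no distinction by signs is
    -- made.
    term {z} {d} {e} (z≤1 , -z≤1) (d≤e , -d≤e) = 0≤-⇒≤ (≤-trans
      (*-nonNeg (ι-mono (ℚₚ.nonNegative⁻¹ ½)) (+-nonNeg
        (*-nonNeg (≤⇒0≤- -z≤1) (≤⇒0≤- d≤e)) (*-nonNeg (≤⇒0≤- z≤1) (≤⇒0≤- -d≤e))))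
      (≤-reflexive (solve 3 (λ z d e → con ½ :* ((con 1ℚ :- :- z) :* (e :- d) :+ (con 1ℚ :- z) :* (e :- :- d))
        := e :- z :* d) refl z d e)))

  conj : Mat n → Vec n → Mat n
  conj Q d = Q ⊠ diag d ⊠ Q ᵀ

  conj-entry : (Q : Mat n) (d : Vec n) → ∀ i j → conj Q d i j ≈ sum λ k → Q i k * d k * Q j k
  conj-entry Q d i j = sum-cong λ k → *-congʳ (⊠-diag Q d i k)

  conj-cong : (Q : Mat n) {d e : Vec n} → (∀ i → d i ≈ e i) → conj Q d ≋ conj Q e
  conj-cong Q {d} {e} d≈e i j = trans (conj-entry Q d i j)
    (trans (sum-cong λ k → *-congʳ (*-congˡ (d≈e k))) (sym (conj-entry Q e i j)))

  diag-⊠-diag : (s d : Vec n) → diag s ⊠ diag d ≋ diag λ i → s i * d i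
  diag-⊠-diag s d i j = trans (diag-⊠ s (diag d) i j) (scale s d i j)
    where
    scale : ∀ {n} (s d : Vec n) → ∀ i j → s i * diag d i j ≈ diag (λ i → s i * d i) i j
    scale s d zero    zero    = refl
    scale s d zero    (suc j) = zeroʳ (s zero)
    scale s d (suc i) zero    = zeroʳ (s (suc i))
    scale s d (suc i) (suc j) = scale (s ∘ suc) (d ∘ suc) i j

  factor-diag : (Q R : Mat n) (s d : Vec n) →
    Q ⊠ diag s ⊠ (diag d ⊠ R) ≋ Q ⊠ diag (λ i → s i * d i) ⊠ R
  factor-diag Q R s d = ≋-trans (≋-sym (⊠-assoc (Q ⊠ diag s) (diag d) R))
    (⊠-cong {Y = R} (≋-trans (⊠-assoc Q (diag s) (diag d)) (⊠-cong {X = Q} ≋-refl (diag-⊠-diag s d))) ≋-refl)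

  conj-⊠ : {Q : Mat n} → Orthogonal Q → (s d : Vec n) →
    conj Q s ⊠ conj Q d ≋ conj Q λ i → s i * d i
  conj-⊠ {Q = Q} (QᵀQ , _) s d =
    ≋-trans (⊠-cong {X = conj Q s} ≋-refl (⊠-assoc Q (diag d) (Q ᵀ)))
    (≋-trans (cancel-middle (Q ⊠ diag s) (Q ᵀ) Q (diag d ⊠ Q ᵀ) QᵀQ) (factor-diag Q (Q ᵀ) s d))

  trace-conj : {Q : Mat n} → Orthogonal Q → (d : Vec n) → trace (conj Q d) ≈ sum d
  trace-conj {Q = Q} (QᵀQ , _) d = begin-equality
    trace (Q ⊠ diag d ⊠ Q ᵀ)       ≈⟨ trace-comm (Q ⊠ diag d) (Q ᵀ) ⟩
    trace (Q ᵀ ⊠ (Q ⊠ diag d))     ≈⟨ trace-cong (≋-trans (≋-sym (⊠-assoc (Q ᵀ) Q (diag d)))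
                                        (≋-trans (⊠-cong {Y = diag d} QᵀQ ≋-refl) (⊠-identityˡ (diag d)))) ⟩
    trace (diag d)                 ≈⟨ sum-cong (diag-diagonal d) ⟩
    sum d                          ∎

  conj-shift : {Q : Mat n} → Orthogonal Q → (d : Vec n) → ∀ t →
    conj Q d ⊞ t ⊡ 𝐈 ≋ conj Q λ i → d i + t
  conj-shift {Q = Q} (_ , QQᵀ) d t i j = begin-equality
    conj Q d i j + t * 𝐈 i j
      ≈⟨ +-cong (conj-entry Q d i j) (*-congˡ (sym (QQᵀ i j))) ⟩
    sum (λ k → Q i k * d k * Q j k) + t * sum (λ k → Q i k * Q j k)
      ≈⟨ +-congˡ (*-distribˡ-sum t (λ k → Q i k * Q j k)) ⟩
    sum (λ k → Q i k * d k * Q j k) + sum (λ k → t * (Q i k * Q j k))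
      ≈⟨ ∑-distrib-+ (λ k → Q i k * d k * Q j k) (λ k → t * (Q i k * Q j k)) ⟨
    sum (λ k → Q i k * d k * Q j k + t * (Q i k * Q j k))
      ≈⟨ sum-cong (λ k → solve 4 (λ u d v t → u :* d :* v :+ t :* (u :* v) := u :* (d :+ t) :* v) refl (Q i k) (d k) (Q j k) t) ⟩
    sum (λ k → Q i k * (d k + t) * Q j k)
      ≈⟨ conj-entry Q (λ k → d k + t) i j ⟨
    conj Q (λ k → d k + t) i j ∎

  conj-one : {Q : Mat n} → Orthogonal Q → conj Q (λ _ → 1#) ≋ 𝐈
  conj-one {Q = Q} (_ , QQᵀ) = ≋-trans (⊠-cong {Y = Q ᵀ} (⊠-identityʳ Q) ≋-refl) QQᵀ

  conj-orthogonal : {Q : Mat n} → Orthogonal Q → {s : Vec n} → (∀ i → s i * s i ≈ 1#) → Orthogonal (conj Q s)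
  conj-orthogonal {Q = Q} orth-Q {s} ss≈1 =
    ≋-trans (⊠-cong {Y = conj Q s} (≋-sym symmetric) ≋-refl) involutive ,
    ≋-trans (⊠-cong {X = conj Q s} ≋-refl (≋-sym symmetric)) involutive
    where
    symmetric : Symmetric (conj Q s)
    symmetric = conjugate-symmetric Q (diag s) (diag-symmetric s)
    involutive : conj Q s ⊠ conj Q s ≋ 𝐈
    involutive = ≋-trans (conj-⊠ orth-Q s s) (≋-trans (conj-cong Q ss≈1) (conj-one orth-Q))

  diag-sign-orthogonal : {s : Vec n} → (∀ i → s i * s i ≈ 1#) → Orthogonal (diag s)
  diag-sign-orthogonal {s = s} ss≈1 =
    ≋-trans (⊠-cong {Y = diag s} (λ i j → diag-symmetric s j i) ≋-refl) involutive ,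
    ≋-trans (⊠-cong {X = diag s} ≋-refl (λ i j → diag-symmetric s j i)) involutive
    where
    diag-cong : ∀ {n} {d e : Vec n} → (∀ i → d i ≈ e i) → diag d ≋ diag e
    diag-cong d≈e zero    zero    = d≈e zero
    diag-cong d≈e zero    (suc j) = refl
    diag-cong d≈e (suc i) zero    = refl
    diag-cong d≈e (suc i) (suc j) = diag-cong (d≈e ∘ suc) i j
    involutive : diag s ⊠ diag s ≋ 𝐈
    involutive = ≋-trans (diag-⊠-diag s s) (diag-cong ss≈1)

  -- The signs are absorbed into the left factor: X = (Q diag s) diag(s d) Qᵀ is a singular value
  -- decomposition.
  signed-norm : {X Q : Mat n} {s d : Vec n} → Orthogonal Q → (∀ i → s i * s i ≈ 1#) →
    (∀ i → 0# ≤ s i * d i) → X ≋ conj Q d → ‖ X ‖₁≈ sum (λ i → s i * d i)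
  signed-norm {Q = Q} {s} {d} orth-Q ss≈1 0≤sd X≋ =
    (λ i → s i * d i) ,
    (0≤sd , Q ⊠ diag s , Q , Orthogonal-⊠ {U = Q} {diag s} orth-Q (diag-sign-orthogonal ss≈1) , orth-Q
      , ≋-trans X≋ (≋-trans (conj-cong Q (λ i → begin-equality
          d i                   ≈⟨ *-identityˡ (d i) ⟨
          1# * d i              ≈⟨ *-congʳ (ss≈1 i) ⟨
          s i * s i * d i       ≈⟨ *-assoc (s i) (s i) (d i) ⟩
          s i * (s i * d i)     ∎))
        (≋-trans (≋-sym (factor-diag Q (Q ᵀ) s (λ i → s i * d i)))
          (≋-sym (⊠-assoc (Q ⊠ diag s) (diag λ i → s i * d i) (Q ᵀ)))))) ,
    refl

  ·-assoc : (X Y : Mat n) (z : Vec n) → ∀ i → ((X ⊠ Y) · z) i ≈ (X · Y · z) i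
  ·-assoc X Y z i = begin-equality
    sum (λ k → sum (λ l → X i l * Y l k) * z k)
      ≈⟨ sum-cong (λ k → *-distribʳ-sum (z k) (λ l → X i l * Y l k)) ⟩
    sum (λ k → sum λ l → X i l * Y l k * z k)
      ≈⟨ ∑-comm (λ k l → X i l * Y l k * z k) ⟩
    sum (λ l → sum λ k → X i l * Y l k * z k)
      ≈⟨ sum-cong (λ l → sum-cong λ k → *-assoc (X i l) (Y l k) (z k)) ⟩
    sum (λ l → sum λ k → X i l * (Y l k * z k))
      ≈⟨ sum-cong (λ l → *-distribˡ-sum (X i l) (λ k → Y l k * z k)) ⟨
    sum (λ l → X i l * dot (Y l) z) ∎

  adjoint : (X : Mat n) (y z : Vec n) → dot y (X · z) ≈ dot (X ᵀ · y) z
  adjoint X y z = begin-equality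
    sum (λ i → y i * sum (λ k → X i k * z k))   ≈⟨ sum-cong (λ i → *-distribˡ-sum (y i) (λ k → X i k * z k)) ⟩
    sum (λ i → sum λ k → y i * (X i k * z k))   ≈⟨ ∑-comm (λ i k → y i * (X i k * z k)) ⟩
    sum (λ k → sum λ i → y i * (X i k * z k))
      ≈⟨ sum-cong (λ k → sum-cong λ i → solve 3 (λ y x z → y :* (x :* z) := x :* y :* z) refl (y i) (X i k) (z k)) ⟩
    sum (λ k → sum λ i → X i k * y i * z k)     ≈⟨ sum-cong (λ k → *-distribʳ-sum (z k) (λ i → X i k * y i)) ⟨
    dot (X ᵀ · y) z                             ∎

  form-cong : {X Y : Mat n} → X ≋ Y → ∀ x → form X x ≈ form Y x
  form-cong X≋Y x = dot-cong {x = x} (λ _ → refl) (λ i → dot-cong {u = x} (X≋Y i) (λ _ → refl))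

  form-diag : (d x : Vec n) → form (diag d) x ≈ sum λ i → d i * (x i * x i)
  form-diag d x = sum-cong λ i → trans (*-congˡ (diag-· d x i))
    (solve 2 (λ d x → x :* (d :* x) := d :* (x :* x)) refl (d i) (x i))

  form-conj : (P : Mat n) (d y : Vec n) →
    form (conj P d) y ≈ sum λ i → d i * (dot ((P ᵀ) i) y * dot ((P ᵀ) i) y)
  form-conj P d y = begin-equality
    dot y ((P ⊠ diag d ⊠ P ᵀ) · y)      ≈⟨ dot-cong {x = y} (λ _ → refl) (λ i → trans (·-assoc (P ⊠ diag d) (P ᵀ) y i) (·-assoc P (diag d) u i)) ⟩
    dot y (P · diag d · u)              ≈⟨ adjoint P y (diag d · u) ⟩
    form (diag d) u                     ≈⟨ form-diag d u ⟩
    sum (λ i → d i * (u i * u i))       ∎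
    where u = P ᵀ · y

  -- Sign patterns and the signature

  value : Bool → Carrier
  value true  = 1#
  value false = - 1#

  value² : ∀ b → value b * value b ≈ 1#
  value² true  = *-identityˡ 1#
  value² false = solve 0 (:- con 1ℚ :* :- con 1ℚ := con 1ℚ) refl

  value-not : ∀ b → value (not b) ≈ - value b
  value-not true  = refl
  value-not false = solve 0 (con 1ℚ := :- :- con 1ℚ) refl

  value-bound : ∀ b {x} → 0# ≤ value b * x → x ≤ value b * x × - x ≤ value b * x
  value-bound true {x} 0≤x =
    ≤-reflexive (sym (*-identityˡ x)) ,
    ≤-trans (0≤⇒-≤0 (≤-trans 0≤x (≤-reflexive (*-identityˡ x)))) 0≤x
  value-bound false {x} 0≤-x =
    0≤-⇒≤ (≤-trans (+-nonNeg 0≤-x 0≤-x) (≤-reflexive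
      (solve 1 (λ x → :- con 1ℚ :* x :+ :- con 1ℚ :* x := :- con 1ℚ :* x :- x) refl x))) ,
    ≤-reflexive (solve 1 (λ x → :- x := :- con 1ℚ :* x) refl x)

  private
    multiple : ℕ → Carrier
    multiple zero    = 0#
    multiple (suc m) = 1# + multiple m

  -- A sum of signs is 2 `count p` - n, with n moved to the left. It makes the signature depend on
  -- the count alone.
  sum-value : (p : Fin n → Bool) → sum (value ∘ p) + multiple n ≈ multiple (count p) + multiple (count p)
  sum-value {zero} p = refl
  sum-value {suc n} p with p zero
  ... | true = begin-equality
    1# + S + (1# + multiple n)        ≈⟨ solve 3 (λ e S N → e :+ S :+ (e :+ N) := e :+ e :+ (S :+ N)) refl 1# S (multiple n) ⟩
    1# + 1# + (S + multiple n)        ≈⟨ +-congˡ (sum-value (p ∘ suc)) ⟩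
    1# + 1# + (c + c)                 ≈⟨ solve 2 (λ e c → e :+ e :+ (c :+ c) := e :+ c :+ (e :+ c)) refl 1# c ⟩
    1# + c + (1# + c)                 ∎
    where S = sum (value ∘ p ∘ suc)
          c = multiple (count (p ∘ suc))
  ... | false = trans
    (solve 3 (λ e S N → :- e :+ S :+ (e :+ N) := S :+ N) refl 1# (sum (value ∘ p ∘ suc)) (multiple n))
    (sum-value (p ∘ suc))

  sum-value-cong : (p q : Fin n → Bool) → count p ≡ count q → sum (value ∘ p) ≈ sum (value ∘ q)
  sum-value-cong {n} p q eq = begin-equality
    sum (value ∘ p)                               ≈⟨ solve 2 (λ s m → s := s :+ m :- m) refl (sum (value ∘ p)) (multiple n) ⟩
    sum (value ∘ p) + multiple n - multiple n     ≈⟨ +-congʳ (trans (sum-value p)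
      (trans (reflexive (≡.cong (λ c → multiple c + multiple c) eq)) (sym (sum-value q)))) ⟩
    sum (value ∘ q) + multiple n - multiple n     ≈⟨ solve 2 (λ s m → s :+ m :- m := s) refl (sum (value ∘ q)) (multiple n) ⟩
    sum (value ∘ q)                               ∎

  alternating-sum-suc : ∀ n → sum (value ∘ alternating {suc n}) ≈ 1# - sum (value ∘ alternating {n})
  alternating-sum-suc n = +-congˡ (trans (sum-cong {n} λ i → value-not (alternating i)) (sum-neg (value ∘ alternating {n})))

  alternating-sum-step : ∀ n → sum (value ∘ alternating {suc (suc n)}) ≈ sum (value ∘ alternating {n})
  alternating-sum-step n = trans (alternating-sum-suc (suc n)) (trans (+-congˡ (-‿cong (alternating-sum-suc n)))
    (solve 1 (λ s → con 1ℚ :- (con 1ℚ :- s) := s) refl (sum (value ∘ alternating {n}))))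

  -- Inertia bounds the number of positive eigenvalues below by the number of positive pivots and,
  -- applied to -D, does the same for the negative ones. The pivots already number n, so both bounds
  -- are attained and no eigenvalue is zero.
  signature : (B C : Mat n) (D : Vec n) → Symmetric B → C ⊠ B ⊠ C ᵀ ≋ diag D →
    (∀ k → Pos (value (alternating k) * D k)) →
    ¬ ¬ (∃[ Q ] ∃[ l ] ∃[ p ] (Orthogonal Q × B ≋ conj Q l × (∀ i → Pos (value (p i) * l i)) ×
      sum (value ∘ p) ≈ sum (value ∘ alternating {n})))
  signature {n} B C D sym-B CBCᵀ≋D D-signs =
    spectral B sym-B >>= λ (Q , l , orth-Q , B≋) →
    finite-choice (λ i → sign (l i)) >>= λ signs →
    let alt = alternating {n}
        pos : Fin n → Bool
        pos i = isPos (signs i)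
        neg : Fin n → Bool
        neg i = isNeg (signs i)
        K = (C ⊠ Q) ᵀ

        same : ∀ y → sum (λ k → D k * (y k * y k)) ≈ sum (λ i → l i * (dot (K i) y * dot (K i) y))
        same y = begin-equality
          sum (λ k → D k * (y k * y k))                       ≈⟨ form-diag D y ⟨
          form (diag D) y                                     ≈⟨ form-cong (≋-sym CBCᵀ≋D) y ⟩
          form (C ⊠ B ⊠ C ᵀ) y                                ≈⟨ form-cong (≋-trans (⊠-cong {Y = C ᵀ} (⊠-cong {X = C} ≋-refl B≋) ≋-refl) (conjugate-assoc C Q (diag l))) y ⟩
          form (conj (C ⊠ Q) l) y                             ≈⟨ form-conj (C ⊠ Q) l y ⟩
          sum (λ i → l i * (dot (K i) y * dot (K i) y))       ∎

        same-neg : ∀ y → sum (λ k → - D k * (y k * y k)) ≈ sum (λ i → - l i * (dot (K i) y * dot (K i) y))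
        same-neg y = trans (negated D (λ k → y k * y k)) (trans (-‿cong (same y))
          (sym (negated l (λ i → dot (K i) y * dot (K i) y))))

        alt≤pos : count alt ℕ.≤ count pos
        alt≤pos = inertia-bound D l K same alt pos
          (λ k eₖ → Pos-cong (*-identityˡ (D k)) (≡.subst (λ b → Pos (value b * D k)) eₖ (D-signs k)))
          (λ i → pos-false (l i) (signs i))

        ¬alt≤neg : count (not ∘ alt) ℕ.≤ count neg
        ¬alt≤neg = inertia-bound (λ k → - D k) (λ i → - l i) K same-neg (not ∘ alt) neg
          (λ k eₖ → Pos-cong (solve 1 (λ d → :- con 1ℚ :* d := :- d) refl (D k))
            (≡.subst (λ b → Pos (value b * D k)) (not-true (alt k) eₖ) (D-signs k)))
          (λ i → neg-false (l i) (signs i))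

        ¬neg≤alt : count (not ∘ neg) ℕ.≤ count alt
        ¬neg≤alt = ℕₚ.+-cancelˡ-≤ (count neg) _ _ (ℕₚ.≤-trans
          (ℕₚ.≤-reflexive (≡.trans (count-not neg) (≡.sym (count-not alt))))
          (ℕₚ.≤-trans (ℕₚ.+-monoʳ-≤ (count alt) ¬alt≤neg) (ℕₚ.≤-reflexive (ℕₚ.+-comm (count alt) (count neg)))))

        pos⇒¬neg : ∀ i → pos i ≡ true → not (neg i) ≡ true
        pos⇒¬neg i = pos-not-neg (l i) (signs i)

        pos-tight : ∀ i → not (neg i) ≡ true → pos i ≡ true
        pos-tight = count-tight pos (not ∘ neg) pos⇒¬neg (ℕₚ.≤-trans ¬neg≤alt alt≤pos)
    in return (Q , l , pos , orth-Q , B≋ , (λ i → nonzero (l i) (signs i) (pos-tight i))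
      , sum-value-cong pos alt (ℕₚ.≤-antisym
          (ℕₚ.≤-trans (count-mono pos (not ∘ neg) pos⇒¬neg) ¬neg≤alt) alt≤pos))
    where
    Sign : Carrier → Set
    Sign x = Pos x ⊎ x ≈ 0# ⊎ Pos (- x)

    isPos isNeg : ∀ {x} → Sign x → Bool
    isPos = [ (λ _ → true) , (λ _ → false) ]′
    isNeg = [ (λ _ → false) , [ (λ _ → false) , (λ _ → true) ]′ ]′

    negated : (d u : Vec n) → sum (λ k → - d k * u k) ≈ - sum (λ k → d k * u k)
    negated d u = trans (sum-cong λ k → solve 2 (λ d u → :- d :* u := :- (d :* u)) refl (d k) (u k))
      (sum-neg (λ k → d k * u k))

    not-true : ∀ b → not b ≡ true → b ≡ false
    not-true false _ = ≡.refl

    pos-false : ∀ x (s : Sign x) → isPos s ≡ false → x ≤ 0#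
    pos-false x (inj₂ (inj₁ x≈0)) _ = ≤-reflexive x≈0
    pos-false x (inj₂ (inj₂ -x-pos)) _ = 0≤-⇒≤ (≤-trans (Pos⇒nonNeg -x-pos) (≤-reflexive (sym (+-identityˡ (- x)))))

    neg-false : ∀ x (s : Sign x) → isNeg s ≡ false → - x ≤ 0#
    neg-false x (inj₁ x-pos) _ = 0≤⇒-≤0 (Pos⇒nonNeg x-pos)
    neg-false x (inj₂ (inj₁ x≈0)) _ = 0≤⇒-≤0 (≤-reflexive (sym x≈0))

    pos-not-neg : ∀ x (s : Sign x) → isPos s ≡ true →
      not (isNeg s) ≡ true
    pos-not-neg x (inj₁ _) _ = ≡.refl

    nonzero : ∀ x (s : Sign x) →
      (not (isNeg s) ≡ true → isPos s ≡ true) →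
      Pos (value (isPos s) * x)
    nonzero x (inj₁ x-pos) _ = Pos-cong (sym (*-identityˡ x)) x-pos
    nonzero x (inj₂ (inj₁ _)) tight = case tight ≡.refl of λ ()
    nonzero x (inj₂ (inj₂ -x-pos)) _ = Pos-cong (solve 1 (λ d → :- d := :- con 1ℚ :* d) refl x) -x-pos

  -- Shifts by multiples of the identity

  sum-shift : ∀ (s l : Vec n) t → sum (λ i → s i * (l i + t)) ≈ sum (λ i → s i * l i) + t * sum s
  sum-shift s l t = begin-equality
    sum (λ i → s i * (l i + t))            ≈⟨ sum-cong (λ i → solve 3 (λ s l t → s :* (l :+ t) := s :* l :+ t :* s) refl (s i) (l i) t) ⟩
    sum (λ i → s i * l i + t * s i)        ≈⟨ ∑-distrib-+ (λ i → s i * l i) (λ i → t * s i) ⟩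
    sum (λ i → s i * l i) + sum (λ i → t * s i)  ≈⟨ +-congˡ (*-distribˡ-sum t s) ⟨
    sum (λ i → s i * l i) + t * sum s      ∎

  shift-conj : {B Q : Mat n} {l : Vec n} → Orthogonal Q → B ≋ conj Q l → ∀ t →
    B ⊞ t ⊡ 𝐈 ≋ conj Q (λ i → l i + t)
  shift-conj {l = l} orth-Q B≋ t = ≋-trans (λ i j → +-congʳ (B≋ i j)) (conj-shift orth-Q l t)

  -- Since `u` comes from an arbitrary decomposition U σ Vᵀ of B, it is first compared with the
  -- eigenvalues: `u` = tr(V Uᵀ B), which `trace-bound` for the spectral decomposition limits to the
  -- sum of the s l. The second use of `trace-bound`, with the sign matrix as W, leads on to `v`.
  balanced⇒orthogonal : {B Q : Mat n} {l : Vec n} {p : Fin n → Bool} → Orthogonal Q → B ≋ conj Q l →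
    (∀ i → Pos (value (p i) * l i)) → sum (value ∘ p) ≈ 0# → BirkhoffJamesOrthogonal B 𝐈
  balanced⇒orthogonal {n} {B} {Q} {l} {p} orth-Q B≋ pl-pos Σp≈0 t u v
    (σ , (0≤σ , U , V , orth-U , orth-V , B≋UσV) , u≈) (τ , (0≤τ , U′ , V′ , orth-U′ , orth-V′ , X≋) , v≈) = begin
    u                                        ≈⟨ u≈ ⟩
    sum σ                                    ≈⟨ trace-conj orth-V σ ⟨
    trace (conj V σ)                         ≈⟨ trace-cong polar ⟨
    trace ((V ⊠ U ᵀ) ⊠ B)                    ≤⟨ trace-bound {W = V ⊠ U ᵀ} {B} {Q} {Q} (Orthogonal-⊠ {U = V} {U ᵀ} orth-V (Orthogonal-ᵀ {U = U} orth-U))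
                                                  orth-Q orth-Q B≋ (λ i → value-bound (p i) (Pos⇒nonNeg (pl-pos i))) ⟩
    sum (λ i → s i * l i)                    ≈⟨ solve 2 (λ S t → S := S :+ t :* con 0ℚ) refl _ t ⟩
    sum (λ i → s i * l i) + t * 0#           ≈⟨ +-congˡ (*-congˡ Σp≈0) ⟨
    sum (λ i → s i * l i) + t * sum s        ≈⟨ sum-shift s l t ⟨
    sum (λ i → s i * (l i + t))              ≈⟨ trace-conj orth-Q (λ i → s i * (l i + t)) ⟨
    trace (conj Q (λ i → s i * (l i + t)))   ≈⟨ trace-cong (conj-⊠ orth-Q s (λ i → l i + t)) ⟨
    trace (conj Q s ⊠ conj Q (λ i → l i + t)) ≈⟨ trace-cong (⊠-cong {X = conj Q s} ≋-refl (shift-conj orth-Q B≋ t)) ⟨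
    trace (conj Q s ⊠ (B ⊞ t ⊡ 𝐈))           ≤⟨ trace-bound {W = conj Q s} {B ⊞ t ⊡ 𝐈} {U′} {V′} (conj-orthogonal orth-Q (λ i → value² (p i)))
                                                  orth-U′ orth-V′ X≋ (λ i → ≤-refl , ≤-trans (0≤⇒-≤0 (0≤τ i)) (0≤τ i)) ⟩
    sum τ                                    ≈⟨ v≈ ⟨
    v                                        ∎
    where
    s = value ∘ p

    polar : (V ⊠ U ᵀ) ⊠ B ≋ conj V σ
    polar = ≋-trans (⊠-cong {X = V ⊠ U ᵀ} ≋-refl (≋-trans B≋UσV (⊠-assoc U (diag σ) (V ᵀ))))
      (≋-trans (cancel-middle V (U ᵀ) U (diag σ ⊠ V ᵀ) (proj₁ orth-U)) (≋-sym (⊠-assoc V (diag σ) (V ᵀ))))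

  Pos-lower-bound : (x : Vec n) → (∀ i → Pos (x i)) → ¬ ¬ (∃[ m ] (Pos m × ∀ i → m ≤ x i))
  Pos-lower-bound {zero} x x-pos = return (1# , Pos-1 , λ ())
  Pos-lower-bound {suc n} x x-pos = Pos-lower-bound (x ∘ suc) (x-pos ∘ suc) >>= λ (m , m-pos , m≤x) →
    ≤-total m (x zero) >>= λ where
      (inj₁ m≤x₀) → return (m , m-pos , λ { zero → m≤x₀ ; (suc i) → m≤x i })
      (inj₂ x₀≤m) → return (x zero , x-pos zero , λ { zero → ≤-refl ; (suc i) → ≤-trans x₀≤m (m≤x i) })

  -- Moving every eigenvalue by −m, with m too small to change a sign, changes
  -- the norm by −m times the signature.
  unbalanced⇒¬orthogonal : {B Q : Mat n} {l : Vec n} {p : Fin n → Bool} → Orthogonal Q → B ≋ conj Q l →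
    (∀ i → Pos (value (p i) * l i)) → sum (value ∘ p) ≈ 1# → ¬ BirkhoffJamesOrthogonal B 𝐈
  unbalanced⇒¬orthogonal {n} {B} {Q} {l} {p} orth-Q B≋ pl-pos Σp≈1 bj =
    Pos-lower-bound (λ i → s i * l i) pl-pos λ (m , m-pos , m≤sl) → Pos⇒≰0 m-pos (begin
      m                           ≈⟨ solve 2 (λ S m → m := S :- (S :+ :- m :* con 1ℚ)) refl S m ⟩
      S - (S + - m * 1#)          ≈⟨ +-congˡ (-‿cong (trans (sum-shift s l (- m)) (+-congˡ (*-congˡ Σp≈1)))) ⟨
      S - sum (λ i → s i * (l i + - m))
        ≤⟨ +-monoˡ-≤ _ (bj (- m) _ _
             (signed-norm {s = s} {l} orth-Q (λ i → value² (p i)) (λ i → Pos⇒nonNeg (pl-pos i)) B≋)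
             (signed-norm {s = s} {λ i → l i + - m} orth-Q (λ i → value² (p i)) (still-nonNeg m-pos m≤sl) (shift-conj orth-Q B≋ (- m)))) ⟩
      sum (λ i → s i * (l i + - m)) - sum (λ i → s i * (l i + - m))
        ≈⟨ -‿inverseʳ _ ⟩
      0#                          ∎)
    where
    s = value ∘ p
    S = sum (λ i → s i * l i)

    still-nonNeg : ∀ {m} → Pos m → (∀ i → m ≤ s i * l i) → ∀ i → 0# ≤ s i * (l i + - m)
    still-nonNeg {m} m-pos m≤sl i = begin
      0#                     ≤⟨ +-nonNeg (≤⇒0≤- (m≤sl i)) (0≤m-sm (p i)) ⟩
      s i * l i - m + (m - s i * m)   ≈⟨ solve 3 (λ s l m → s :* l :- m :+ (m :- s :* m) := s :* (l :+ :- m)) refl (s i) (l i) m ⟩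
      s i * (l i + - m)      ∎
      where
      0≤m-sm : ∀ b → 0# ≤ m - value b * m
      0≤m-sm true = ≤-reflexive (solve 1 (λ m → con 0ℚ := m :- con 1ℚ :* m) refl m)
      0≤m-sm false = ≤-trans (+-nonNeg (Pos⇒nonNeg m-pos) (Pos⇒nonNeg m-pos))
        (≤-reflexive (solve 1 (λ m → m :+ m := m :- :- con 1ℚ :* m) refl m))

  -- Diagonalising the beta matrix

  sum-single : (x : Vec n) (i : Fin n) → (∀ j → ¬ i ≡ j → x j ≈ 0#) → sum x ≈ x i
  sum-single x zero off = trans (+-congˡ (sum-zero λ j → off (suc j) λ ())) (+-identityʳ (x zero))
  sum-single x (suc i) off = trans (+-cong (off zero λ ())
    (sum-single (x ∘ suc) i λ j i≢j → off (suc j) (i≢j ∘ Finₚ.suc-injective))) (+-identityˡ (x (suc i)))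

  diag-off : (d : Vec n) {i j : Fin n} → ¬ i ≡ j → diag d i j ≈ 0#
  diag-off d {zero}  {zero}  i≢j = contradiction ≡.refl i≢j
  diag-off d {zero}  {suc j} i≢j = refl
  diag-off d {suc i} {zero}  i≢j = refl
  diag-off d {suc i} {suc j} i≢j = diag-off (d ∘ suc) (i≢j ∘ ≡.cong suc)

  -- In entry (i, j) of (C B) Cᵀ a nonzero term with index k needs i ≤ k ≤ j. This leaves nothing
  -- below the diagonal and one term on it; symmetry clears the part above.
  triangular-diagonalizes : (B C : Mat n) → Symmetric B →
    (∀ i j → toℕ i ℕ.< toℕ j → C i j ≈ 0#) → (∀ i j → toℕ j ℕ.< toℕ i → (C ⊠ B) i j ≈ 0#) →
    C ⊠ B ⊠ C ᵀ ≋ diag λ k → (C ⊠ B) k k * C k k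
  triangular-diagonalizes {n} B C sym-B C-lower CB-upper i j = case ℕₚ.<-cmp (toℕ i) (toℕ j) of λ where
      (tri> _ i≢j j<i) → trans (off-diagonal j<i) (sym (diag-off d (i≢j ∘ ≡.cong toℕ)))
      (tri< i<j i≢j _) → trans (conjugate-symmetric C B sym-B i j)
        (trans (off-diagonal i<j) (sym (diag-off d (i≢j ∘ ≡.cong toℕ))))
      (tri≈ _ i≡j _) → on-diagonal (Finₚ.toℕ-injective i≡j)
    where
    d : Vec n
    d k = (C ⊠ B) k k * C k k

    left-zero : ∀ {i j k} → toℕ k ℕ.< toℕ i → (C ⊠ B) i k * C j k ≈ 0#
    left-zero {i} {j} {k} k<i = trans (*-congʳ (CB-upper i k k<i)) (zeroˡ (C j k))

    right-zero : ∀ {i j k} → toℕ j ℕ.< toℕ k → (C ⊠ B) i k * C j k ≈ 0#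
    right-zero {i} {j} {k} j<k = trans (*-congˡ (C-lower j k j<k)) (zeroʳ ((C ⊠ B) i k))

    off-diagonal : ∀ {i j} → toℕ j ℕ.< toℕ i → (C ⊠ B ⊠ C ᵀ) i j ≈ 0#
    off-diagonal {i} {j} j<i = sum-zero λ k → [ left-zero {i} {j} , (λ i≤k → right-zero {i} {j} (ℕₚ.<-≤-trans j<i i≤k)) ]′
      (ℕₚ.<-≤-connex (toℕ k) (toℕ i))

    on-diagonal : ∀ {i j} → i ≡ j → (C ⊠ B ⊠ C ᵀ) i j ≈ diag d i j
    on-diagonal {i} ≡.refl = trans
      (sum-single (λ k → (C ⊠ B) i k * C i k) i λ k i≢k → case ℕₚ.<-cmp (toℕ k) (toℕ i) of λ where
        (tri< k<i _ _) → left-zero {i} {i} k<i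
        (tri≈ _ k≡i _) → contradiction (Finₚ.toℕ-injective (≡.sym k≡i)) i≢k
        (tri> _ _ i<k) → right-zero {i} {i} i<k)
      (sym (diag-diagonal d i))

  ι-pos : ∀ {q} → 0ℚ ℚ.< q → Pos (ι q)
  ι-pos {q} q>0 = ι (inv q) , ι-mono (ℚₚ.<⇒≤ (inv-pos q>0)) , trans (sym (ι-* q (inv q))) (reflexive (≡.cong ι (*-inv q>0)))

  ι-sum : ∀ {n} (f : Fin n → ℚ) → sum (ι ∘ f) ≈ ι (sumℚ f)
  ι-sum {zero} f = refl
  ι-sum {suc n} f = trans (+-congˡ (ι-sum (f ∘ suc))) (sym (ι-+ (f zero) (sumℚ (f ∘ suc))))

  ι-⊠ : ∀ {n} (X Y : Fin n → Fin n → ℚ) → (λ i j → ι (X i j)) ⊠ (λ i j → ι (Y i j)) ≋ λ i j → ι (sumℚ λ k → X i k ℚ.* Y k j)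
  ι-⊠ X Y i j = trans (sum-cong λ k → sym (ι-* (X i k) (Y k j))) (ι-sum λ k → X i k ℚ.* Y k j)

  value-alternating : ∀ {n} (k : Fin n) → value (alternating k) ≈ ι (parity-sign (toℕ k))
  value-alternating zero = refl
  value-alternating (suc k) = trans (value-not (alternating k))
    (trans (-‿cong (value-alternating k)) (sym (ι-neg (parity-sign (toℕ k)))))

  beta : ∀ n → Mat n
  beta n i j = ι (Defs.β (suc (toℕ i)) (suc (toℕ j)))

  beta-symmetric : ∀ n → Symmetric (beta n)
  beta-symmetric n i j = reflexive (≡.cong ι (β-comm (toℕ i) (toℕ j)))
    where
    β-comm : ∀ i j → Defs.β (suc i) (suc j) ≡ Defs.β (suc j) (suc i)
    β-comm i j = ≡.trans (beta-factorials i j) (≡.trans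
      (≡.cong₂ ℚ._*_ (ℚₚ.*-comm (factorial i) (factorial j))
        (≡.cong inverse-factorial (≡.trans (ℕₚ.+-suc i j) (≡.trans (≡.cong suc (ℕₚ.+-comm i j)) (≡.sym (ℕₚ.+-suc j i))))))
      (≡.sym (beta-factorials j i)))

  -- Row i of `C` is the i-th Legendre polynomial: lower triangular by degree, and `C` times the
  -- beta matrix is upper triangular by orthogonality to lower powers. In `D k` the first factor is
  -- positive and the second has the sign (-1)ᵏ.
  beta-signature : ∀ n → ¬ ¬ (∃[ Q ] ∃[ l ] ∃[ p ] (Orthogonal Q × beta n ≋ conj Q l ×
    (∀ i → Pos (value (p i) * l i)) × sum (value ∘ p) ≈ sum (value ∘ alternating {n})))
  beta-signature n = signature (beta n) C D (beta-symmetric n)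
    (triangular-diagonalizes (beta n) C (beta-symmetric n) C-lower CB-upper) D-signs
    where
    c b : Fin n → Fin n → ℚ
    c i j = legendre (toℕ i) (toℕ j)
    b i j = Defs.β (suc (toℕ i)) (suc (toℕ j))

    C : Mat n
    C i j = ι (c i j)

    D : Vec n
    D k = (C ⊠ beta n) k k * C k k

    C-lower : ∀ i j → toℕ i ℕ.< toℕ j → C i j ≈ 0#
    C-lower i j i<j = reflexive (≡.cong ι (≡.trans
      (≡.cong (ℚ._* f) (signed-binomial-above i<j)) (ℚₚ.*-zeroˡ f)))
      where f = factorial (toℕ j ℕ.+ toℕ i) ℚ.* inverse-factorial (toℕ j)

    CB-upper : ∀ i j → toℕ j ℕ.< toℕ i → (C ⊠ beta n) i j ≈ 0#
    CB-upper i j j<i = trans (ι-⊠ c b i j) (reflexive (≡.cong ι (legendre-orthogonal n (Finₚ.toℕ<n i) j<i)))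

    D-signs : ∀ k → Pos (value (alternating k) * D k)
    D-signs k = Pos-cong (begin-equality
      ι (norm ℚ.* (s ℚ.* c k k))        ≈⟨ trans (ι-* norm (s ℚ.* c k k)) (*-congˡ (ι-* s (c k k))) ⟩
      ι norm * (ι s * C k k)            ≈⟨ solve 3 (λ x s c → x :* (s :* c) := s :* (x :* c)) refl (ι norm) (ι s) (C k k) ⟩
      ι s * (ι norm * C k k)            ≈⟨ *-cong (value-alternating k) (*-congʳ (ι-⊠ c b k k)) ⟨
      value (alternating k) * D k       ∎)
      (ι-pos (*-pos (legendre-norm-pos (toℕ k) n (Finₚ.toℕ<n k)) (legendre-diagonal-sign (toℕ k))))
      where
      s = parity-sign (toℕ k)
      norm = sumℚ λ i → c k i ℚ.* b i k

  alternating-sum-even : ∀ m → sum (value ∘ alternating {m ℕ.* 2}) ≈ 0#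
  alternating-sum-even zero = refl
  alternating-sum-even (suc m) = trans (alternating-sum-step (m ℕ.* 2)) (alternating-sum-even m)

  even-or-unbalanced : ∀ n → 2 ∣ n ⊎ sum (value ∘ alternating {n}) ≈ 1#
  even-or-unbalanced zero = inj₁ (divides 0 ≡.refl)
  even-or-unbalanced (suc zero) = inj₂ (+-identityʳ 1#)
  even-or-unbalanced (suc (suc n)) = case even-or-unbalanced n of λ where
    (inj₁ (divides m n≡)) → inj₁ (divides (suc m) (≡.cong (λ k → suc (suc k)) n≡))
    (inj₂ Σ≈1) → inj₂ (trans (alternating-sum-step n) Σ≈1)

  beta-orthogonal⇔even : ∀ n → BirkhoffJamesOrthogonal (beta n) 𝐈 ⇔ (2 ∣ n)
  beta-orthogonal⇔even n = mk⇔ only-if if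
    where
    only-if : BirkhoffJamesOrthogonal (beta n) 𝐈 → 2 ∣ n
    -- Parity is decided first, so the signature serves only to refute the odd case, where its
    -- double negation is harmless.
    only-if orthogonal = case even-or-unbalanced n of λ where
      (inj₁ 2∣n) → 2∣n
      (inj₂ Σ≈1) → ⊥-elim (beta-signature n λ (Q , l , p , orth-Q , B≋ , pl-pos , Σp≈) →
        unbalanced⇒¬orthogonal {p = p} orth-Q B≋ pl-pos (trans Σp≈ Σ≈1) orthogonal)

    if : 2 ∣ n → BirkhoffJamesOrthogonal (beta n) 𝐈
    if (divides m ≡.refl) t u v ‖B‖ ‖B+t‖ = ≤-stable (beta-signature n >>= λ (Q , l , p , orth-Q , B≋ , pl-pos , Σp≈) →
      return (balanced⇒orthogonal {p = p} orth-Q B≋ pl-pos (trans Σp≈ (alternating-sum-even m)) t u v ‖B‖ ‖B+t‖))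

  beta-orthogonal⇔even-over : ∀ {n _≈′_ _≤′_ 0#′ ∑′ _≋′_ _⊞′_ _⊠′_ _⊡′_ _ᵀ′ diag′ 𝐈′ B′} →
    _≈′_ ≡ _≈_ → _≤′_ ≡ _≤_ → 0#′ ≡ 0# → ∑′ ≡ sum {n} → _≋′_ ≡ _≋_ {n} → _⊞′_ ≡ _⊞_ {n} → _⊠′_ ≡ _⊠_ {n} →
    _⊡′_ ≡ _⊡_ {n} → _ᵀ′ ≡ _ᵀ {n} → diag′ ≡ diag {n} → 𝐈′ ≡ 𝐈 {n} → B′ ≡ beta n →
    OverOperations.BirkhoffJamesOrthogonal _≈′_ _≤′_ 0#′ ∑′ _≋′_ _⊞′_ _⊠′_ _⊡′_ _ᵀ′ diag′ 𝐈′ B′ 𝐈′ ⇔ (2 ∣ n)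
  beta-orthogonal⇔even-over {n} ≡.refl ≡.refl ≡.refl ≡.refl ≡.refl ≡.refl ≡.refl ≡.refl ≡.refl ≡.refl ≡.refl ≡.refl =
    beta-orthogonal⇔even n

-- The Cauchy reals

open import Defs

Eventually : (ℕ → Set) → Set
Eventually P = ∃[ N ] (∀ n → N ℕ.≤ n → P n)

always : ∀ {P : ℕ → Set} → (∀ n → P n) → Eventually P
always p = 0 , λ n _ → p n

infixl 4 _<&>_
_<&>_ : ∀ {P Q : ℕ → Set} → Eventually P → (∀ {n} → P n → Q n) → Eventually Q
(N , p) <&> f = N , λ n n≥N → f (p n n≥N)

both : ∀ {P Q : ℕ → Set} → Eventually P → Eventually Q → Eventually λ n → P n × Q n
both (M , p) (N , q) = M ℕ.⊔ N , λ n n≥ → p n (ℕₚ.m⊔n≤o⇒m≤o M N n≥) , q n (ℕₚ.m⊔n≤o⇒n≤o M N n≥)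

never : Eventually (λ _ → ⊥) → ⊥
never (N , p) = p N ℕₚ.≤-refl

eventually-bounded : ∀ x → ∃[ B ] (0ℚ ℚ.< B × Eventually λ n → ∣ seq x n ∣ ℚ.≤ B)
eventually-bounded x =
  let (N , close) = cauchy x 1ℚ (ℚₚ.positive⁻¹ 1ℚ)
      B = 1ℚ ℚ.+ ∣ seq x N ∣
  in B , ℚₚ.positive⁻¹ 1ℚ ⊕≤ ℚₚ.0≤∣p∣ (seq x N) , N , λ n n≥N →
    let open ℚₚ.≤-Reasoning in begin
      ∣ seq x n ∣                             ≡⟨ ≡.cong ∣_∣ (split (seq x n) (seq x N)) ⟩
      ∣ (seq x n ℚ.- seq x N) ℚ.+ seq x N ∣   ≤⟨ ℚₚ.∣p+q∣≤∣p∣+∣q∣ (seq x n ℚ.- seq x N) (seq x N) ⟩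
      ∣ seq x n ℚ.- seq x N ∣ ℚ.+ ∣ seq x N ∣ ≤⟨ ℚₚ.+-monoˡ-≤ ∣ seq x N ∣ (ℚₚ.<⇒≤ (close n N n≥N ℕₚ.≤-refl)) ⟩
      B                                       ∎
  where
  split : ∀ a b → a ≡ (a ℚ.- b) ℚ.+ b
  split = solve-∀ ℚ-ring

neg : ℝ → ℝ
neg x = mkℝ (λ n → ℚ.- seq x n) λ ε ε>0 → let (N , close) = cauchy x ε ε>0 in
  N , λ m n m≥N n≥N → ≡.subst (ℚ._< ε)
    (≡.trans (≡.sym (ℚₚ.∣-p∣≡∣p∣ (seq x m ℚ.- seq x n))) (≡.cong ∣_∣ (eq (seq x m) (seq x n)))) (close m n m≥N n≥N)
  where
  eq : ∀ a b → ℚ.- (a ℚ.- b) ≡ ℚ.- a ℚ.- ℚ.- b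
  eq = solve-∀ ℚ-ring

-- The decision made at a single sufficiently late term.
compare : ∀ x ε → 0ℚ ℚ.< ε →
  Eventually (λ n → seq x n ℚ.< ε) ⊎ (∃[ δ ] (0ℚ ℚ.< δ × Eventually λ n → δ ℚ.< seq x n))
compare x ε ε>0 =
  -- With η = ε/4, a late term below ε/2 keeps all later ones below 3ε/4; otherwise all later ones
  -- exceed ε/4, which serves as δ.
  let η = ½ ℚ.* (½ ℚ.* ε)
      η>0 : 0ℚ ℚ.< η
      η>0 = half-pos (half-pos ε>0)
      (N , close) = cauchy x η η>0
  in case seq x N ℚₚ.<? ½ ℚ.* ε of λ where
    (yes <½ε) → inj₁ (N , λ n n≥N → ≡.subst (seq x n ℚ.<_) (half-sum ε) (ℚ-0<-⇒<
      (ℚ-<⇒0<- (abs<⇒< {seq x n} {seq x N} (close n N n≥N ℕₚ.≤-refl)) ⊕ ℚ-<⇒0<- <½ε ⊕ η>0)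
      (eq₁ (seq x n) (seq x N) (½ ℚ.* ε) η (half-sum (½ ℚ.* ε)))))
    (no ≮½ε) → inj₂ (η , η>0 , N , λ n n≥N → ℚ-0<-⇒<
      (ℚ-<⇒0<- (abs<⇒<′ {seq x n} {seq x N} (close n N n≥N ℕₚ.≤-refl)) ⊕≤ ℚ-≤⇒0≤- (ℚₚ.≮⇒≥ ≮½ε))
      (eq₂ (seq x n) (seq x N) (½ ℚ.* ε) η (half-sum (½ ℚ.* ε))))
  where
  eq₁ : ∀ a b h e → e ℚ.+ e ≡ h → (b ℚ.+ e ℚ.- a) ℚ.+ ((h ℚ.- b) ℚ.+ e) ≡ (h ℚ.+ h) ℚ.- a
  eq₁ a b h e ≡.refl = ring a b e
    where
    ring : ∀ a b e → (b ℚ.+ e ℚ.- a) ℚ.+ ((e ℚ.+ e ℚ.- b) ℚ.+ e) ≡ (e ℚ.+ e ℚ.+ (e ℚ.+ e)) ℚ.- a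
    ring = solve-∀ ℚ-ring
  eq₂ : ∀ a b h e → e ℚ.+ e ≡ h → (a ℚ.+ e ℚ.- b) ℚ.+ (b ℚ.- h) ≡ a ℚ.- e
  eq₂ a b h e ≡.refl = ring a b e
    where
    ring : ∀ a b e → (a ℚ.+ e ℚ.- b) ℚ.+ (b ℚ.- (e ℚ.+ e)) ≡ a ℚ.- e
    ring = solve-∀ ℚ-ring

-- The ordered ring of Cauchy reals

pointwise : ∀ {x y} → (∀ n → seq x n ≡ seq y n) → x ≈ y
pointwise {x} {y} x≡y ε ε>0 = always λ n → ≡.subst (λ q → ∣ q ∣ ℚ.< ε)
  (≡.sym (≡.trans (≡.cong (ℚ._- seq y n) (x≡y n)) (ℚₚ.+-inverseʳ (seq y n)))) ε>0

≈⇒≤ : ∀ {x y} → x ≈ y → x ≤ y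
≈⇒≤ {x} {y} x≈y ε ε>0 = x≈y ε ε>0 <&> λ {n} → abs<⇒< {seq x n} {seq y n}

≤-antisymmetric : ∀ {x y} → x ≤ y → y ≤ x → x ≈ y
≤-antisymmetric {x} {y} x≤y y≤x ε ε>0 = both (x≤y ε ε>0) (y≤x ε ε>0) <&> λ {n} (p , q) → <⇒abs< {seq x n} {seq y n} p q

≤-transitive : ∀ {x y z} → x ≤ y → y ≤ z → x ≤ z
≤-transitive {x} {y} {z} x≤y y≤z ε ε>0 = both (x≤y (½ ℚ.* ε) (half-pos ε>0)) (y≤z (½ ℚ.* ε) (half-pos ε>0)) <&> λ {n} (p , q) →
  ≡.subst (λ e → seq x n ℚ.< seq z n ℚ.+ e) (half-sum ε)
    (ℚ-0<-⇒< (ℚ-<⇒0<- p ⊕ ℚ-<⇒0<- q) (eq (seq x n) (seq y n) (seq z n) (½ ℚ.* ε)))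
  where
  eq : ∀ x y z h → (y ℚ.+ h ℚ.- x) ℚ.+ (z ℚ.+ h ℚ.- y) ≡ z ℚ.+ (h ℚ.+ h) ℚ.- x
  eq = solve-∀ ℚ-ring

≈-symmetric : ∀ {x y} → x ≈ y → y ≈ x
≈-symmetric {x} {y} x≈y ε ε>0 = x≈y ε ε>0 <&> λ {n} → ≡.subst (ℚ._< ε) (abs-swap (seq x n) (seq y n))

≈-transitive : ∀ {x y z} → x ≈ y → y ≈ z → x ≈ z
≈-transitive {x} {y} {z} x≈y y≈z = ≤-antisymmetric {x} {z}
  (≤-transitive {x} {y} {z} (≈⇒≤ {x} {y} x≈y) (≈⇒≤ {y} {z} y≈z))
  (≤-transitive {z} {y} {x} (≈⇒≤ {z} {y} (≈-symmetric {y} {z} y≈z)) (≈⇒≤ {y} {x} (≈-symmetric {x} {y} x≈y)))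

+-monotone : ∀ z {x y} → x ≤ y → x + z ≤ y + z
+-monotone z {x} {y} x≤y ε ε>0 = x≤y ε ε>0 <&> λ {n} p → ℚ-0<-⇒< (ℚ-<⇒0<- p) (eq (seq x n) (seq y n) (seq z n) ε)
  where
  eq : ∀ x y z e → y ℚ.+ e ℚ.- x ≡ y ℚ.+ z ℚ.+ e ℚ.- (x ℚ.+ z)
  eq = solve-∀ ℚ-ring

+-congruent : ∀ {x y u v} → x ≈ y → u ≈ v → x + u ≈ y + v
+-congruent {x} {y} {u} {v} x≈y u≈v = ≤-antisymmetric {x + u} {y + v}
  (mono {x} {y} {u} {v} (≈⇒≤ {x} {y} x≈y) (≈⇒≤ {u} {v} u≈v))
  (mono {y} {x} {v} {u} (≈⇒≤ {y} {x} (≈-symmetric {x} {y} x≈y)) (≈⇒≤ {v} {u} (≈-symmetric {u} {v} u≈v)))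
  where
  mono : ∀ {x y u v} → x ≤ y → u ≤ v → x + u ≤ y + v
  mono {x} {y} {u} {v} x≤y u≤v ε ε>0 = both (x≤y (½ ℚ.* ε) (half-pos ε>0)) (u≤v (½ ℚ.* ε) (half-pos ε>0)) <&> λ {n} (p , q) →
    ≡.subst (λ e → seq x n ℚ.+ seq u n ℚ.< seq y n ℚ.+ seq v n ℚ.+ e) (half-sum ε)
      (ℚ-0<-⇒< (ℚ-<⇒0<- p ⊕ ℚ-<⇒0<- q) (eq (seq x n) (seq y n) (seq u n) (seq v n) (½ ℚ.* ε)))
    where
    eq : ∀ x y u v h → (y ℚ.+ h ℚ.- x) ℚ.+ (v ℚ.+ h ℚ.- u) ≡ y ℚ.+ v ℚ.+ (h ℚ.+ h) ℚ.- (x ℚ.+ u)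
    eq = solve-∀ ℚ-ring

neg-congruent : ∀ {x y} → x ≈ y → neg x ≈ neg y
neg-congruent {x} {y} x≈y ε ε>0 = x≈y ε ε>0 <&> λ {n} → ≡.subst (ℚ._< ε)
  (≡.trans (≡.sym (ℚₚ.∣-p∣≡∣p∣ (seq x n ℚ.- seq y n))) (≡.cong ∣_∣ (eq (seq x n) (seq y n))))
  where
  eq : ∀ a b → ℚ.- (a ℚ.- b) ≡ ℚ.- a ℚ.- ℚ.- b
  eq = solve-∀ ℚ-ring

*-congruentʳ : ∀ z {x y} → x ≈ y → x * z ≈ y * z
*-congruentʳ z {x} {y} x≈y ε ε>0 =
  let (B , B>0 , bound) = eventually-bounded z
      (δ , δ>0 , Bδ≡ε) = divide {ε} {B} ε>0 B>0
  in both (x≈y δ δ>0) bound <&> λ {n} (close , z≤B) → let open ℚₚ.≤-Reasoning in begin-strict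
    ∣ seq x n ℚ.* seq z n ℚ.- seq y n ℚ.* seq z n ∣ ≡⟨ ≡.cong ∣_∣ (eq (seq x n) (seq y n) (seq z n)) ⟩
    ∣ (seq x n ℚ.- seq y n) ℚ.* seq z n ∣           ≡⟨ ℚₚ.∣p*q∣≡∣p∣*∣q∣ (seq x n ℚ.- seq y n) (seq z n) ⟩
    ∣ seq x n ℚ.- seq y n ∣ ℚ.* ∣ seq z n ∣         ≤⟨ ℚₚ.*-monoˡ-≤-nonNeg ∣ seq x n ℚ.- seq y n ∣ {{ℚ.nonNegative (ℚₚ.0≤∣p∣ (seq x n ℚ.- seq y n))}} z≤B ⟩
    ∣ seq x n ℚ.- seq y n ∣ ℚ.* B                   <⟨ ℚₚ.*-monoˡ-<-pos B {{ℚ.positive B>0}} close ⟩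
    δ ℚ.* B                                         ≡⟨ ℚₚ.*-comm δ B ⟩
    B ℚ.* δ                                         ≡⟨ Bδ≡ε ⟩
    ε                                               ∎
  where
  eq : ∀ x y z → x ℚ.* z ℚ.- y ℚ.* z ≡ (x ℚ.- y) ℚ.* z
  eq = solve-∀ ℚ-ring

*-commutative : ∀ x y → x * y ≈ y * x
*-commutative x y = pointwise {x * y} {y * x} λ n → ℚₚ.*-comm (seq x n) (seq y n)

*-congruent : ∀ {x y u v} → x ≈ y → u ≈ v → x * u ≈ y * v
*-congruent {x} {y} {u} {v} x≈y u≈v = ≈-transitive {x * u} {y * u} {y * v} (*-congruentʳ u {x} {y} x≈y)
  (≈-transitive {y * u} {u * y} {y * v} (*-commutative y u)
    (≈-transitive {u * y} {v * y} {y * v} (*-congruentʳ y {u} {v} u≈v) (*-commutative v y)))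

ℝ-isCommutativeRing : IsCommutativeRing _≈_ _+_ _*_ neg (fromℚ 0ℚ) (fromℚ 1ℚ)
ℝ-isCommutativeRing = record
  { isRing = record
    { +-isAbelianGroup = record
      { isGroup = record
        { isMonoid = record
          { isSemigroup = record
            { isMagma = record
              { isEquivalence = record
                { refl = λ {x} → pointwise {x} {x} λ _ → ≡.refl
                ; sym = λ {x} {y} → ≈-symmetric {x} {y}
                ; trans = λ {x} {y} {z} → ≈-transitive {x} {y} {z} }
              ; ∙-cong = λ {x} {y} {u} {v} → +-congruent {x} {y} {u} {v} }
            ; assoc = λ x y z → pointwise {x + y + z} {x + (y + z)} λ n → ℚₚ.+-assoc (seq x n) (seq y n) (seq z n) }
          ; identity = (λ x → pointwise {fromℚ 0ℚ + x} {x} λ n → ℚₚ.+-identityˡ (seq x n))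
                     , (λ x → pointwise {x + fromℚ 0ℚ} {x} λ n → ℚₚ.+-identityʳ (seq x n)) }
        ; inverse = (λ x → pointwise {neg x + x} {fromℚ 0ℚ} λ n → ℚₚ.+-inverseˡ (seq x n))
                  , (λ x → pointwise {x + neg x} {fromℚ 0ℚ} λ n → ℚₚ.+-inverseʳ (seq x n))
        ; ⁻¹-cong = λ {x} {y} → neg-congruent {x} {y} }
      ; comm = λ x y → pointwise {x + y} {y + x} λ n → ℚₚ.+-comm (seq x n) (seq y n) }
    ; *-cong = λ {x} {y} {u} {v} → *-congruent {x} {y} {u} {v}
    ; *-assoc = λ x y z → pointwise {x * y * z} {x * (y * z)} λ n → ℚₚ.*-assoc (seq x n) (seq y n) (seq z n)
    ; *-identity = (λ x → pointwise {fromℚ 1ℚ * x} {x} λ n → ℚₚ.*-identityˡ (seq x n))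
                 , (λ x → pointwise {x * fromℚ 1ℚ} {x} λ n → ℚₚ.*-identityʳ (seq x n))
    ; distrib = (λ x y z → pointwise {x * (y + z)} {x * y + x * z} λ n → ℚₚ.*-distribˡ-+ (seq x n) (seq y n) (seq z n))
              , (λ x y z → pointwise {(y + z) * x} {y * x + z * x} λ n → ℚₚ.*-distribʳ-+ (seq x n) (seq y n) (seq z n)) }
  ; *-comm = *-commutative }

-- For each ε, `compare` gives either the required bound on x - y or an eventual positive gap, and
-- the gap refutes x ≤ y.
stable : ∀ {x y} → ¬ ¬ x ≤ y → x ≤ y
stable {x} {y} ¬¬x≤y ε ε>0 = case compare (x + neg y) ε ε>0 of λ where
    (inj₁ small) → small <&> λ {n} p → ℚ-0<-⇒< (ℚ-<⇒0<- p) (eq₁ (seq x n) (seq y n) ε)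
    (inj₂ (δ , δ>0 , large)) → ⊥-elim (¬¬x≤y λ x≤y → never (both large (x≤y δ δ>0) <&> λ {n} (p , q) →
      ℚₚ.<-irrefl ≡.refl (≡.subst (0ℚ ℚ.<_) (eq₂ (seq x n) (seq y n) δ) (ℚ-<⇒0<- p ⊕ ℚ-<⇒0<- q))))
  where
  eq₁ : ∀ x y e → e ℚ.- (x ℚ.- y) ≡ y ℚ.+ e ℚ.- x
  eq₁ = solve-∀ ℚ-ring
  eq₂ : ∀ x y d → (x ℚ.- y ℚ.- d) ℚ.+ (y ℚ.+ d ℚ.- x) ≡ 0ℚ
  eq₂ = solve-∀ ℚ-ring

≰⇒≥-real : ∀ {x y} → ¬ x ≤ y → y ≤ x
≰⇒≥-real {x} {y} x≰y ε ε>0 = case compare (y + neg x) ε ε>0 of λ where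
    (inj₁ small) → small <&> λ {n} p → ℚ-0<-⇒< (ℚ-<⇒0<- p) (eq₁ (seq y n) (seq x n) ε)
    (inj₂ (δ , δ>0 , large)) → contradiction (λ η η>0 → large <&> λ {n} p →
      ℚ-0<-⇒< (ℚ-<⇒0<- p ⊕ δ>0 ⊕ η>0) (eq₂ (seq x n) (seq y n) δ η)) x≰y
  where
  eq₁ : ∀ x y e → e ℚ.- (x ℚ.- y) ≡ y ℚ.+ e ℚ.- x
  eq₁ = solve-∀ ℚ-ring
  eq₂ : ∀ x y d η → (y ℚ.- x ℚ.- d) ℚ.+ (d ℚ.+ η) ≡ y ℚ.+ η ℚ.- x
  eq₂ = solve-∀ ℚ-ring

*-nonNegative : ∀ {x y} → fromℚ 0ℚ ≤ x → fromℚ 0ℚ ≤ y → fromℚ 0ℚ ≤ x * y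
*-nonNegative {x} {y} 0≤x 0≤y ε ε>0 =
  let (B , B>0 , x-bound) = eventually-bounded x
      (C , C>0 , y-bound) = eventually-bounded y
      (δ , δ>0 , Bδ≡ε) = divide {ε} {B ℚ.+ C} ε>0 (B>0 ⊕ C>0)
  in both (both (0≤x δ δ>0) (0≤y δ δ>0)) (both x-bound y-bound) <&> λ {n} ((0<x+δ , 0<y+δ) , (x≤B , y≤C)) →
    ≡.subst (λ e → 0ℚ ℚ.< seq x n ℚ.* seq y n ℚ.+ e) Bδ≡ε
      (product (seq x n) (seq y n) B>0 C>0 δ>0 0<x+δ 0<y+δ
        (ℚₚ.≤-trans (p≤∣p∣ (seq x n)) x≤B) (ℚₚ.≤-trans (p≤∣p∣ (seq y n)) y≤C))
  where
  -- Both factors may be slightly negative. If y ≥ 0 then x y ≥ -δ y ≥ -C δ; if y ≤ 0 then x ≤ B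
  -- gives x y ≥ B y ≥ -B δ.
  product : ∀ x y {B C δ} → 0ℚ ℚ.< B → 0ℚ ℚ.< C → 0ℚ ℚ.< δ → 0ℚ ℚ.< x ℚ.+ δ → 0ℚ ℚ.< y ℚ.+ δ →
    x ℚ.≤ B → y ℚ.≤ C → 0ℚ ℚ.< x ℚ.* y ℚ.+ (B ℚ.+ C) ℚ.* δ
  product x y {B} {C} {δ} B>0 C>0 δ>0 0<x+δ 0<y+δ x≤B y≤C = [ y≥0-case , y≤0-case ]′ (ℚₚ.≤-total 0ℚ y)
    where
    eq₁ : ∀ x y B C d → B ℚ.* d ℚ.+ ((x ℚ.+ d) ℚ.* y ℚ.+ (C ℚ.- y) ℚ.* d) ≡ x ℚ.* y ℚ.+ (B ℚ.+ C) ℚ.* d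
    eq₁ = solve-∀ ℚ-ring
    eq₂ : ∀ x y B C d → C ℚ.* d ℚ.+ (B ℚ.* (y ℚ.+ d) ℚ.+ (B ℚ.- x) ℚ.* (0ℚ ℚ.- y)) ≡ x ℚ.* y ℚ.+ (B ℚ.+ C) ℚ.* d
    eq₂ = solve-∀ ℚ-ring
    y≥0-case : 0ℚ ℚ.≤ y → _
    y≥0-case 0≤y = ≡.subst (0ℚ ℚ.<_) (eq₁ x y B C δ) (*-pos B>0 δ>0 ⊕≤
      ℚₚ.+-mono-≤ (ℚ-*-nonNeg (ℚₚ.<⇒≤ 0<x+δ) 0≤y) (ℚ-*-nonNeg (ℚ-≤⇒0≤- y≤C) (ℚₚ.<⇒≤ δ>0)))
    y≤0-case : y ℚ.≤ 0ℚ → _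
    y≤0-case y≤0 = ≡.subst (0ℚ ℚ.<_) (eq₂ x y B C δ) (*-pos C>0 δ>0 ⊕≤
      ℚₚ.+-mono-≤ (ℚₚ.<⇒≤ (*-pos B>0 0<y+δ)) (ℚ-*-nonNeg (ℚ-≤⇒0≤- x≤B) (ℚ-≤⇒0≤- y≤0)))

archimedean-real : ∀ {x y} c → (∀ ε → 0ℚ ℚ.< ε → x ≤ y + fromℚ ε * c) → x ≤ y
archimedean-real {x} {y} c close ε ε>0 =
  let (B , B>0 , bound) = eventually-bounded c
      (δ , δ>0 , Bδ≡½ε) = divide {½ ℚ.* ε} {B} (half-pos ε>0) B>0
  in both (close δ δ>0 (½ ℚ.* ε) (half-pos ε>0)) bound <&> λ {n} (p , c≤B) →
    ≡.subst (λ e → seq x n ℚ.< seq y n ℚ.+ e) (half-sum ε)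
      (ℚ-0<-⇒< (ℚ-<⇒0<- p ⊕≤ ℚ-*-nonNeg (ℚₚ.<⇒≤ δ>0) (ℚ-≤⇒0≤- (ℚₚ.≤-trans (p≤∣p∣ (seq c n)) c≤B)))
        (eq (seq x n) (seq y n) (seq c n) δ B (½ ℚ.* ε) Bδ≡½ε))
  where
  eq : ∀ x y c d B h → B ℚ.* d ≡ h → (y ℚ.+ d ℚ.* c ℚ.+ h ℚ.- x) ℚ.+ d ℚ.* (B ℚ.- c) ≡ y ℚ.+ (h ℚ.+ h) ℚ.- x
  eq x y c d B h ≡.refl = ring x y c d B
    where
    ring : ∀ x y c d B → (y ℚ.+ d ℚ.* c ℚ.+ B ℚ.* d ℚ.- x) ℚ.+ d ℚ.* (B ℚ.- c) ≡ y ℚ.+ (B ℚ.* d ℚ.+ B ℚ.* d) ℚ.- x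
    ring = solve-∀ ℚ-ring

small-or-invertible : ∀ ε → 0ℚ ℚ.< ε → ∀ x →
  x ≤ fromℚ ε ⊎ (∃[ y ] (fromℚ 0ℚ ≤ y × x * y ≈ fromℚ 1ℚ))
small-or-invertible ε ε>0 x = case compare x ε ε>0 of λ where
    (inj₁ small) → inj₁ λ η η>0 → small <&> λ {n} p → ℚ-0<-⇒< (ℚ-<⇒0<- p ⊕ η>0) (eq (seq x n) ε η)
    (inj₂ (δ , δ>0 , N , large)) → inj₂
      ( mkℝ (λ n → inv (seq x n)) (λ η η>0 →
          -- Beyond δ the inverses satisfy |1/u - 1/v| ≤ |u - v|/δ², so precision δ²η suffices for
          -- η.
          let (M , close) = cauchy x (δ ℚ.* δ ℚ.* η) (*-pos (*-pos δ>0 δ>0) η>0) in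
          M ℕ.⊔ N , λ m n m≥ n≥ → inverse-close δ>0
            (large m (ℕₚ.m⊔n≤o⇒n≤o M N m≥)) (large n (ℕₚ.m⊔n≤o⇒n≤o M N n≥))
            (close m n (ℕₚ.m⊔n≤o⇒m≤o M N m≥) (ℕₚ.m⊔n≤o⇒m≤o M N n≥)))
      , (λ η η>0 → N , λ n n≥N → inv-pos (ℚₚ.<-trans δ>0 (large n n≥N)) ⊕ η>0)
      , (λ η η>0 → N , λ n n≥N → ≡.subst (λ q → ∣ q ℚ.- 1ℚ ∣ ℚ.< η) (≡.sym (*-inv (ℚₚ.<-trans δ>0 (large n n≥N)))) η>0))
  where
  eq : ∀ x e h → (e ℚ.- x) ℚ.+ h ≡ e ℚ.+ h ℚ.- x
  eq = solve-∀ ℚ-ring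

  inverse-close : ∀ {u v δ η} → 0ℚ ℚ.< δ → δ ℚ.< u → δ ℚ.< v → ∣ u ℚ.- v ∣ ℚ.< δ ℚ.* δ ℚ.* η → ∣ inv u ℚ.- inv v ∣ ℚ.< η
  inverse-close {u} {v} {δ} {η} δ>0 δ<u δ<v close = ℚₚ.*-cancelˡ-<-nonNeg (δ ℚ.* δ) {{ℚ.nonNegative (ℚₚ.<⇒≤ (*-pos δ>0 δ>0))}} (begin-strict
    δ ℚ.* δ ℚ.* D             ≤⟨ ℚₚ.*-monoʳ-≤-nonNeg D {{ℚ.nonNegative 0≤D}} (ℚ-0≤-⇒≤ {δ ℚ.* δ} {u ℚ.* v}
                                   (ℚₚ.+-mono-≤ (ℚ-*-nonNeg (ℚₚ.<⇒≤ (ℚ-<⇒0<- δ<u)) (ℚₚ.<⇒≤ v>0)) (ℚ-*-nonNeg (ℚₚ.<⇒≤ δ>0) (ℚₚ.<⇒≤ (ℚ-<⇒0<- δ<v)))) (eq₁ u v δ)) ⟩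
    u ℚ.* v ℚ.* D             ≡⟨ ≡.cong (ℚ._* D) (≡.sym (ℚₚ.0≤p⇒∣p∣≡p (ℚₚ.<⇒≤ (*-pos u>0 v>0)))) ⟩
    ∣ u ℚ.* v ∣ ℚ.* D         ≡⟨ ≡.sym (ℚₚ.∣p*q∣≡∣p∣*∣q∣ (u ℚ.* v) (inv u ℚ.- inv v)) ⟩
    ∣ u ℚ.* v ℚ.* (inv u ℚ.- inv v) ∣ ≡⟨ ≡.cong ∣_∣ (≡.trans (eq₂ u v (inv u) (inv v)) (≡.cong₂ (λ a b → a ℚ.* v ℚ.- b ℚ.* u) (*-inv u>0) (*-inv v>0))) ⟩
    ∣ 1ℚ ℚ.* v ℚ.- 1ℚ ℚ.* u ∣ ≡⟨ ≡.cong ∣_∣ (≡.cong₂ ℚ._-_ (ℚₚ.*-identityˡ v) (ℚₚ.*-identityˡ u)) ⟩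
    ∣ v ℚ.- u ∣               ≡⟨ abs-swap v u ⟩
    ∣ u ℚ.- v ∣               <⟨ close ⟩
    δ ℚ.* δ ℚ.* η             ∎)
    where
    open ℚₚ.≤-Reasoning
    D = ∣ inv u ℚ.- inv v ∣
    0≤D : 0ℚ ℚ.≤ D
    0≤D = ℚₚ.0≤∣p∣ (inv u ℚ.- inv v)
    u>0 : 0ℚ ℚ.< u
    u>0 = ℚₚ.<-trans δ>0 δ<u
    v>0 : 0ℚ ℚ.< v
    v>0 = ℚₚ.<-trans δ>0 δ<v
    eq₁ : ∀ u v d → (u ℚ.- d) ℚ.* v ℚ.+ d ℚ.* (v ℚ.- d) ≡ u ℚ.* v ℚ.- d ℚ.* d
    eq₁ = solve-∀ ℚ-ring
    eq₂ : ∀ u v i j → u ℚ.* v ℚ.* (i ℚ.- j) ≡ u ℚ.* i ℚ.* v ℚ.- v ℚ.* j ℚ.* u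
    eq₂ = solve-∀ ℚ-ring

-- Completeness for located cuts

natural-above : ∀ q → ∃[ N ] q ℚ.≤ natural N
natural-above (mkℚ p d c) = ℤ.∣ p ∣ , *≤* (ℤₚ.≤-trans (ℤₚ.≤-reflexive (ℤₚ.*-identityʳ p)) (bound p))
  where
  bound : ∀ p → p ℤ.≤ + ℤ.∣ p ∣ ℤ.* + suc d
  bound (+ n) = ≡.subst (+ n ℤ.≤_) (ℤₚ.pos-* n (suc d)) (ℤ.+≤+ (ℕₚ.m≤m*n n (suc d)))
  bound -[1+ n ] = ≡.subst (-[1+ n ] ℤ.≤_) (ℤₚ.pos-* (suc n) (suc d)) ℤ.-≤+

unit-fraction : ℕ → ℚ
unit-fraction k = mkℚ (+ 1) k (Coprimality.1-coprimeTo (suc k))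

unit-fraction-pos : ∀ k → 0ℚ ℚ.< unit-fraction k
unit-fraction-pos k = ℚₚ.positive⁻¹ (unit-fraction k)

unit-fraction-antitone : ∀ {k l} → k ℕ.≤ l → unit-fraction l ℚ.≤ unit-fraction k
unit-fraction-antitone {k} {l} k≤l = *≤* (ℤₚ.*-monoˡ-≤-nonNeg ℤ.1ℤ (ℤ.+≤+ (ℕ.s≤s k≤l)))

unit-fraction-below : ∀ ε → 0ℚ ℚ.< ε → ∃[ k ] unit-fraction k ℚ.≤ ε
unit-fraction-below (mkℚ (+ suc n) d c) ε>0 = d , *≤* (ℤₚ.*-monoʳ-≤-nonNeg (+ suc d) {+ 1} {+ suc n} (ℤ.+≤+ (ℕ.s≤s ℕ.z≤n)))
unit-fraction-below (mkℚ (+ zero) d c) (ℚ.*<* 0<0) = ⊥-elim (ℤₚ.<-irrefl ≡.refl 0<0)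
unit-fraction-below (mkℚ -[1+ n ] d c) (ℚ.*<* ())

fromℚ-cancel-≤ : ∀ {p q} → fromℚ p ≤ fromℚ q → p ℚ.≤ q
fromℚ-cancel-≤ p≤q = ≤-of-< λ ε ε>0 → let (N , lt) = p≤q ε ε>0 in lt N ℕₚ.≤-refl

fromℚ-mono-≤ : ∀ {p q} → p ℚ.≤ q → fromℚ p ≤ fromℚ q
fromℚ-mono-≤ {p} {q} p≤q ε ε>0 = always λ _ → ℚ-0<-⇒< (ε>0 ⊕≤ ℚ-≤⇒0≤- p≤q) (eq p q ε)
  where
  eq : ∀ p q e → e ℚ.+ (q ℚ.- p) ≡ q ℚ.+ e ℚ.- p
  eq = solve-∀ ℚ-ring

module Completeness
  (U : ℝ → Set) (L : ℚ → ℝ → Set)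
  (decide : ∀ ε → 0ℚ ℚ.< ε → ∀ r → U (fromℚ r) ⊎ L ε (fromℚ r))
  (separated : ∀ {ε x y} → L ε x → U y → x ≤ y + fromℚ ε)
  (lower : ∃[ l ] (∀ x → U x → l ≤ x)) (upper : ∃[ u ] (∀ x → u ≤ x → U x)) where

  below : ∃[ a ] ¬ U (fromℚ a)
  below =
    let (l , l≤U) = lower
        (B , B>0 , bound) = eventually-bounded l
        -- If U held at a, then eventually l < a + 1 = -B - 1, while l ≥ -B.
        a = ℚ.- B ℚ.- 1ℚ ℚ.- 1ℚ
    in a , λ Ua → never (both (l≤U (fromℚ a) Ua 1ℚ (ℚₚ.positive⁻¹ 1ℚ)) bound <&> λ {n} (l<a+1 , |l|≤B) →
      ℚₚ.<-irrefl ≡.refl (≡.subst (0ℚ ℚ.<_) (eq (seq l n) B)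
        ((ℚ-<⇒0<- l<a+1 ⊕≤ ℚ-≤⇒0≤- (ℚₚ.≤-trans (≡.subst (ℚ.- seq l n ℚ.≤_) (ℚₚ.∣-p∣≡∣p∣ (seq l n)) (p≤∣p∣ (ℚ.- seq l n))) |l|≤B))
          ⊕ ℚₚ.positive⁻¹ 1ℚ)))
    where
    eq : ∀ l B → (ℚ.- B ℚ.- 1ℚ ℚ.- 1ℚ ℚ.+ 1ℚ ℚ.- l ℚ.+ (B ℚ.- ℚ.- l)) ℚ.+ 1ℚ ≡ 0ℚ
    eq = solve-∀ ℚ-ring

  above : ∃[ b ] (∀ r → b ℚ.≤ r → U (fromℚ r))
  above =
    let (u , u≤⇒U) = upper
        (B , B>0 , bound) = eventually-bounded u
    in B , λ r B≤r → u≤⇒U (fromℚ r) λ ε ε>0 → bound <&> λ {n} |u|≤B →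
      ℚ-0<-⇒< (ε>0 ⊕≤ ℚ-≤⇒0≤- (ℚₚ.≤-trans (p≤∣p∣ (seq u n)) (ℚₚ.≤-trans |u|≤B B≤r))) (eq (seq u n) r ε)
    where
    eq : ∀ u r e → e ℚ.+ (r ℚ.- u) ≡ r ℚ.+ e ℚ.- u
    eq = solve-∀ ℚ-ring

  a = proj₁ below

  -- Walks down a grid of mesh ε from a point in U. As U fails at `a`, some step must answer L,
  -- directly above which U was just seen to hold.
  search : ∀ ε → 0ℚ ℚ.< ε → ∀ N → U (fromℚ (a ℚ.+ natural N ℚ.* ε)) →
    ∃[ r ] (L ε (fromℚ r) × U (fromℚ (r ℚ.+ ε)))
  search ε ε>0 zero Ua = contradiction (≡.subst (U ∘ fromℚ) (eq a ε) Ua) (proj₂ below)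
    where
    eq : ∀ a e → a ℚ.+ 0ℚ ℚ.* e ≡ a
    eq = solve-∀ ℚ-ring
  search ε ε>0 (suc N) Ur = case decide ε ε>0 (a ℚ.+ natural N ℚ.* ε) of λ where
      (inj₁ Ur′) → search ε ε>0 N Ur′
      (inj₂ Lr) → a ℚ.+ natural N ℚ.* ε , Lr , ≡.subst (U ∘ fromℚ)
        (≡.trans (≡.cong (λ m → a ℚ.+ m ℚ.* ε) (natural-suc N)) (eq a (natural N) ε)) Ur
    where
    eq : ∀ a m e → a ℚ.+ (m ℚ.+ 1ℚ) ℚ.* e ≡ a ℚ.+ m ℚ.* e ℚ.+ e
    eq = solve-∀ ℚ-ring

  bracket : ∀ ε → 0ℚ ℚ.< ε → ∃[ r ] (L ε (fromℚ r) × U (fromℚ (r ℚ.+ ε)))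
  bracket ε ε>0 =
    let (b , b≤⇒U) = above
        (N , ≤N) = natural-above ((b ℚ.- a) ℚ.* inv ε)
    in search ε ε>0 N (b≤⇒U _ (ℚ-0≤-⇒≤ (ℚ-*-nonNeg (ℚ-≤⇒0≤- ≤N) (ℚₚ.<⇒≤ ε>0))
      (≡.trans (eq₁ a b ε (inv ε) (natural N)) (≡.trans (≡.cong (λ i → a ℚ.+ natural N ℚ.* ε ℚ.- (a ℚ.+ (b ℚ.- a) ℚ.* i)) (*-inv ε>0)) (eq₂ a b (natural N ℚ.* ε))))))
    where
    eq₁ : ∀ a b e i N → (N ℚ.- (b ℚ.- a) ℚ.* i) ℚ.* e ≡ a ℚ.+ N ℚ.* e ℚ.- (a ℚ.+ (b ℚ.- a) ℚ.* (e ℚ.* i))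
    eq₁ = solve-∀ ℚ-ring
    eq₂ : ∀ a b m → a ℚ.+ m ℚ.- (a ℚ.+ (b ℚ.- a) ℚ.* 1ℚ) ≡ a ℚ.+ m ℚ.- b
    eq₂ = solve-∀ ℚ-ring

  e : ℕ → ℚ
  e = unit-fraction

  r : ℕ → ℚ
  r k = proj₁ (bracket (e k) (unit-fraction-pos k))

  L-r : ∀ k → L (e k) (fromℚ (r k))
  L-r k = proj₁ (proj₂ (bracket (e k) (unit-fraction-pos k)))

  t : ℕ → ℚ
  t k = r k ℚ.+ e k

  U-t : ∀ k → U (fromℚ (t k))
  U-t k = proj₂ (proj₂ (bracket (e k) (unit-fraction-pos k)))

  -- Separation of the lower end at stage k from the upper end at stage l gives t k ≤ t l + 2 e k.
  -- As k and l are arbitrary, the upper ends form a Cauchy sequence.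
  r≤t : ∀ k l → r k ℚ.≤ t l ℚ.+ e k
  r≤t k l = fromℚ-cancel-≤ {r k} {t l ℚ.+ e k} (separated (L-r k) (U-t l))

  module _ (ε : ℚ) (ε>0 : 0ℚ ℚ.< ε) where
    private
      -- Then 2 e m is at most ε/2, and the remaining ε/2 makes the inequality strict.
      quarter = ½ ℚ.* (½ ℚ.* ε)
      small = unit-fraction-below quarter (half-pos (half-pos ε>0))

    K : ℕ
    K = proj₁ small

    e≤quarter : ∀ {n} → K ℕ.≤ n → e n ℚ.≤ quarter
    e≤quarter K≤n = ℚₚ.≤-trans (unit-fraction-antitone K≤n) (proj₂ small)

    t<t+ε : ∀ m n → K ℕ.≤ m → t m ℚ.< t n ℚ.+ ε
    t<t+ε m n K≤m = ℚ-0<-⇒<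
      ((half-pos ε>0 ⊕≤ ℚ-≤⇒0≤- (r≤t m n)) ⊕≤ ℚₚ.+-mono-≤ (ℚ-≤⇒0≤- (e≤quarter K≤m)) (ℚ-≤⇒0≤- (e≤quarter K≤m)))
      (eq (r m) (e m) (t n) ε)
      where
      eq : ∀ r e t ε → ½ ℚ.* ε ℚ.+ (t ℚ.+ e ℚ.- r) ℚ.+ (½ ℚ.* (½ ℚ.* ε) ℚ.- e ℚ.+ (½ ℚ.* (½ ℚ.* ε) ℚ.- e)) ≡ t ℚ.+ ε ℚ.- (r ℚ.+ e)
      eq r e t ε = ≡.trans (ring r e t (½ ℚ.* (½ ℚ.* ε)) (½ ℚ.* ε)) (≡.trans
        (≡.cong (λ h → t ℚ.+ (½ ℚ.* ε ℚ.+ h) ℚ.- (r ℚ.+ e)) (half-sum (½ ℚ.* ε)))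
        (≡.cong (λ h → t ℚ.+ h ℚ.- (r ℚ.+ e)) (half-sum ε)))
        where
        ring : ∀ r e t q h → h ℚ.+ (t ℚ.+ e ℚ.- r) ℚ.+ (q ℚ.- e ℚ.+ (q ℚ.- e)) ≡ t ℚ.+ (h ℚ.+ (q ℚ.+ q)) ℚ.- (r ℚ.+ e)
        ring = solve-∀ ℚ-ring

  limit : ℝ
  limit = mkℝ t λ ε ε>0 → K ε ε>0 , λ m n m≥ n≥ → <⇒abs< {t m} {t n} (t<t+ε ε ε>0 m n m≥) (t<t+ε ε ε>0 n m n≥)

  approximated : ∀ ε → 0ℚ ℚ.< ε →
    (∃[ s ] (U (fromℚ s) × fromℚ s ≤ limit + fromℚ ε)) ×
    (∃₂ λ δ s → δ ℚ.≤ ε × L δ (fromℚ s) × limit ≤ fromℚ s + fromℚ ε)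
  approximated ε ε>0 =
      (t j , U-t j , λ η η>0 → always λ n → ℚ-0<-⇒< (ℚ-<⇒0<- (t<t+ε ε ε>0 j n ℕₚ.≤-refl) ⊕ η>0) (eq₁ (t j) (t n) ε η))
    , (e k , r k , ℚₚ.≤-trans e≤½ε (half-≤ ε>0) , L-r k , λ η η>0 → k , λ n k≤n →
        ℚ-0<-⇒< ((ℚ-<⇒0<- (t<t+ε ½ε ½ε>0 n k k≤n) ⊕≤ ℚ-≤⇒0≤- e≤½ε) ⊕ η>0)
          (≡.trans (eq₂ (r k) (e k) (t n) ½ε η) (≡.cong (λ ε → r k ℚ.+ ε ℚ.+ η ℚ.- t n) (half-sum ε))))
    where
    ½ε = ½ ℚ.* ε
    ½ε>0 = half-pos ε>0
    j = K ε ε>0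
    -- The limit lies within ε/2 of t k = r k + e k, and the other half of ε pays for e k.
    k = K ½ε ½ε>0
    half-≤ : ∀ {q} → 0ℚ ℚ.< q → ½ ℚ.* q ℚ.≤ q
    half-≤ {q} q>0 = ℚ-0≤-⇒≤ (ℚₚ.<⇒≤ (half-pos q>0))
      (≡.trans (eq (½ ℚ.* q)) (≡.cong (ℚ._- ½ ℚ.* q) (half-sum q)))
      where
      eq : ∀ h → h ≡ h ℚ.+ h ℚ.- h
      eq = solve-∀ ℚ-ring
    e≤½ε : e k ℚ.≤ ½ε
    e≤½ε = ℚₚ.≤-trans (e≤quarter ½ε ½ε>0 ℕₚ.≤-refl)
      (ℚₚ.≤-trans (half-≤ (half-pos ½ε>0)) (half-≤ ½ε>0))
    eq₁ : ∀ s t ε η → t ℚ.+ ε ℚ.- s ℚ.+ η ≡ t ℚ.+ ε ℚ.+ η ℚ.- s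
    eq₁ = solve-∀ ℚ-ring
    eq₂ : ∀ r e t h η → (r ℚ.+ e ℚ.+ h ℚ.- t ℚ.+ (h ℚ.- e)) ℚ.+ η ≡ r ℚ.+ (h ℚ.+ h) ℚ.+ η ℚ.- t
    eq₂ = solve-∀ ℚ-ring

realStructure : RealStructure
realStructure = record
  { Carrier = ℝ
  ; _≈_ = _≈_
  ; _≤_ = _≤_
  ; _+_ = _+_
  ; _*_ = _*_
  ; -_ = neg
  ; ι = fromℚ
  ; isCommutativeRing = ℝ-isCommutativeRing
  ; ι-+ = λ p q → pointwise {fromℚ (p ℚ.+ q)} {fromℚ p + fromℚ q} λ _ → ≡.refl
  ; ι-* = λ p q → pointwise {fromℚ (p ℚ.* q)} {fromℚ p * fromℚ q} λ _ → ≡.refl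
  ; ι-neg = λ p → pointwise {fromℚ (ℚ.- p)} {neg (fromℚ p)} λ _ → ≡.refl
  ; ι-mono = fromℚ-mono-≤
  ; 1≰0 = λ 1≤0 → ℚₚ.<-irrefl ≡.refl (ℚₚ.<-≤-trans (ℚₚ.positive⁻¹ 1ℚ) (fromℚ-cancel-≤ {1ℚ} {0ℚ} 1≤0))
  ; ≤-reflexive = λ {x} {y} → ≈⇒≤ {x} {y}
  ; ≤-trans = λ {x} {y} {z} → ≤-transitive {x} {y} {z}
  ; ≤-antisym = λ {x} {y} → ≤-antisymmetric {x} {y}
  ; ≤-stable = λ {x} {y} → stable {x} {y}
  ; ≰⇒≥ = λ {x} {y} → ≰⇒≥-real {x} {y}
  ; +-monoˡ-≤ = λ z {x} {y} → +-monotone z {x} {y}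
  ; *-nonNeg = λ {x} {y} → *-nonNegative {x} {y}
  ; small-or-positive = small-or-invertible
  ; archimedean = λ {x} {y} → archimedean-real {x} {y}
  ; complete = λ U L decide separated lower upper →
      let open Completeness U L decide separated lower upper in limit , approximated
  }

theorem1p2 : (n : ℕ) → 1 ≤ℕ n →
    BirkhoffJamesOrthogonal (betaMatrix n) 𝐈 ⇔ (2 ∣ n)
theorem1p2 n _ = LinearAlgebra.beta-orthogonal⇔even-over realStructure
  {n} {_≈_} {_≤_} {0ℝ} {∑} {_≋_} {_⊞_} {_⊠_} {_⊡_} {_ᵀ} {diag} {𝐈} {betaMatrix n}
  ≡.refl ≡.refl ≡.refl ≡.refl ≡.refl ≡.refl ≡.refl ≡.refl ≡.refl ≡.refl ≡.refl ≡.refl
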